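{- Fix an integer $k\ge3$, let $r:=\frac{4k-4}{4k-5}$, and for every $n$ let $l^*(n):=\min\{j\in\mathbb{N}:\sum_{l=0}^{j}4\operatorname{ex}(4(k-1)\lceil r^{l}\rceil,2k)\ge n\}$ and $$U_k(n):=\sum_{l=0}^{l^*(n)}\frac{4\operatorname{ex}(4(k-1)\lceil r^{l}\rceil,2k)}{r^{l}}.$$ Let $\alpha_k(n)$ be the approximation ratio of the $k$-Opt algorithm for \textsc{Metric TSP} on instances with $n$ vertices (so that $\alpha_k(n)\le U_k(n)$). Then this upper bound is tight up to a factor $O(\log n)$: $U_k(n)\in O(\log(n)\cdot\alpha_k(n))$.
   Context: A \textsc{Metric TSP} instance is a complete graph $K_n$ with nonnegative costs satisfying the triangle inequality; a tour is a Hamiltonian cycle. A $k$-move replaces at most $k$ edges of a tour by other edges to get a new tour; a tour is $k$-optimal if no $k$-move yields a shorter tour. $\alpha_k(n)$ is the supremum over all $n$-vertex instances and all $k$-optimal tours $T$ of $c(T)/c(T^*)$, $T^*$ an optimal tour. $\operatorname{ex}(m,2k)$ is the maximum number of edges of a graph on $m$ vertices with girth at least $2k$. -}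

module Defs where

open import Data.Nat as ℕ using (ℕ; zero; suc; _∸_; _≤_; _<_)
import Data.Nat.Properties as ℕP
open import Data.Nat.Logarithm using (⌈log₂_⌉)
open import Data.Integer as ℤ using (ℤ; +_)
open import Data.Rational using (ℚ; 0ℚ; 1ℚ; _+_; _*_; _/_; ceiling)
  renaming (_≤_ to _≤ℚ_; _<_ to _<ℚ_)
open import Data.Fin as Fin using (Fin; toℕ; fromℕ<)
open import Data.Bool using (Bool; true; false; if_then_else_; not; _∧_)
open import Data.List using (List; []; _∷_; length; filter; concatMap)
open import Data.Fin.Base using ()
open import Data.Bool.ListAction using (any)
open import Data.Fin.Properties using (_≟_)
open import Relation.Nullary.Decidable using (⌊_⌋; yes; no)
open import Relation.Binary.PropositionalEquality using (_≡_)
open import Function.Definitions using (Injective)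
open import Data.Product using (Σ; ∃; ∃-syntax; _×_; _,_)
open import Relation.Nullary using (¬_)
open import Data.Vec.Functional using (Vector)
open import Data.List using () renaming (upTo to upToL)
import Data.List as L

ℕ→ℚ : ℕ → ℚ
ℕ→ℚ n = + n / 1

_^ℚ_ : ℚ → ℕ → ℚ
q ^ℚ zero  = 1ℚ
q ^ℚ suc l = q * (q ^ℚ l)

Σℚ : {n : ℕ} → (Fin n → ℚ) → ℚ
Σℚ {zero}  f = 0ℚ
Σℚ {suc n} f = f Fin.zero + Σℚ {n} (λ i → f (Fin.suc i))

Σℕ≤ : ℕ → (ℕ → ℕ) → ℕ
Σℕ≤ zero    f = f 0
Σℕ≤ (suc j) f = Σℕ≤ j f ℕ.+ f (suc j)

Σℚ≤ : ℕ → (ℕ → ℚ) → ℚ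
Σℚ≤ zero    f = f 0
Σℚ≤ (suc j) f = Σℚ≤ j f + f (suc j)

allFin : (n : ℕ) → List (Fin n)
allFin n = L.allFin n

count : {n : ℕ} → (Fin n → Bool) → ℕ
count {n} p = length (filter (λ i → p i Data.Bool.≟ true) (allFin n))
  where import Data.Bool

record Graph (m : ℕ) : Set where
  field
    adj   : Fin m → Fin m → Bool
    sym   : ∀ i j → adj i j ≡ adj j i
    irrefl : ∀ i → adj i i ≡ false
open Graph public

numEdges : {m : ℕ} → Graph m → ℕ
numEdges {m} G =
  length (filter (λ ij → (toℕ (Data.Product.proj₁ ij) ℕ.<? toℕ (Data.Product.proj₂ ij)) Relation.Nullary.Decidable.×-dec
                         (adj G (Data.Product.proj₁ ij) (Data.Product.proj₂ ij) Data.Bool.≟ true))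
                 (concatMap (λ i → L.map (λ j → i , j) (allFin m)) (allFin m)))
  where import Data.Bool
        import Relation.Nullary.Decidable

next : {n : ℕ} → Fin n → Fin n
next {suc n} i with suc (toℕ i) ℕ.<? suc n
... | yes p = fromℕ< p
... | no  _ = Fin.zero

record Cycle {m : ℕ} (G : Graph m) (ℓ : ℕ) : Set where
  field
    len≥3 : 3 ≤ ℓ
    vert  : Fin ℓ → Fin m
    inj   : Injective _≡_ _≡_ vert
    edges : ∀ i → adj G (vert i) (vert (next i)) ≡ true

-- girth(G) ≥ g : G has no cycle of length < g (acyclic graphs have girth ∞)
GirthAtLeast : {m : ℕ} → Graph m → ℕ → Set
GirthAtLeast G g = ∀ ℓ → ℓ < g → ¬ Cycle G ℓ

IsEx : ℕ → (ℕ → ℕ) → Set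
IsEx g e = ∀ m →
  (∃[ G ] (GirthAtLeast {m} G g × numEdges G ≡ e m)) ×
  (∀ (G : Graph m) → GirthAtLeast G g → numEdges G ≤ e m)

-- r = (4k-4)/(4k-5), written for k ≥ 3 as suc(4k∸5)/suc(4k∸6)
r : ℕ → ℚ
r k = + suc (4 ℕ.* k ∸ 5) / suc (4 ℕ.* k ∸ 6)

rinv : ℕ → ℚ
rinv k = + suc (4 ℕ.* k ∸ 6) / suc (4 ℕ.* k ∸ 5)

-- 4 ex(4(k-1) ⌈r^l⌉, 2k)   (⌈r^l⌉ ≥ 1, so ∣⌈r^l⌉∣ is its value in ℕ)
term : ℕ → (ℕ → ℕ) → ℕ → ℕ
term k e l = 4 ℕ.* e (4 ℕ.* (k ∸ 1) ℕ.* ℤ.∣ ceiling (r k ^ℚ l) ∣)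

IsLStar : ℕ → (ℕ → ℕ) → ℕ → ℕ → Set
IsLStar k e n j = n ≤ Σℕ≤ j (term k e) × (∀ i → i < j → Σℕ≤ i (term k e) < n)

-- U_k(n) with l*(n) = j :  Σ_{l=0}^{j} term l / r^l
U : ℕ → (ℕ → ℕ) → ℕ → ℚ
U k e j = Σℚ≤ j (λ l → ℕ→ℚ (term k e l) * (rinv k ^ℚ l))

record Metric (n : ℕ) : Set where
  field
    d      : Fin n → Fin n → ℚ
    nonneg : ∀ i j → 0ℚ ≤ℚ d i j
    diag   : ∀ i → d i i ≡ 0ℚ
    symm   : ∀ i j → d i j ≡ d j i
    tri    : ∀ i j l → d i l ≤ℚ d i j + d j l
open Metric public

-- a tour: a cyclic ordering of all n vertices (injective σ : Fin n → Fin n);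
-- its edges are {σ i, σ (next i)}
record Tour (n : ℕ) : Set where
  field
    σ   : Fin n → Fin n
    inj : Injective _≡_ _≡_ σ
open Tour public

cost : {n : ℕ} → Metric n → Tour n → ℚ
cost M T = Σℚ (λ i → d M (σ T i) (σ T (next i)))

hasEdge : {n : ℕ} → Tour n → Fin n → Fin n → Bool
hasEdge {n} T a b = any (λ i →
     (⌊ σ T i ≟ a ⌋ ∧ ⌊ σ T (next i) ≟ b ⌋) Data.Bool.∨
     (⌊ σ T i ≟ b ⌋ ∧ ⌊ σ T (next i) ≟ a ⌋)) (allFin n)
  where import Data.Bool

removed : {n : ℕ} → Tour n → Tour n → ℕ
removed T T' = count (λ i → not (hasEdge T' (σ T i) (σ T (next i))))

KOptimal : {n : ℕ} → ℕ → Metric n → Tour n → Set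
KOptimal {n} k M T = ∀ (T' : Tour n) → removed T T' ≤ k → cost M T ≤ℚ cost M T'

-- α_k(n) ≥ ρ is witnessed: some n-vertex instance and k-optimal tour T with
-- c(T) ≥ ρ · c(S) for some tour S of positive cost (hence c(T)/c(T*) ≥ ρ)
RatioAtLeast : ℕ → ℕ → ℚ → Set
RatioAtLeast k n ρ =
  Σ (Metric n) λ M → Σ (Tour n) λ T → KOptimal k M T ×
    Σ (Tour n) λ S → (0ℚ <ℚ cost M S) × (ρ * cost M S ≤ℚ cost M T)

{-# OPTIONS --safe #-}
-- If all graphs in the sum U_k(n) had bounded average degree, every summand would
-- be bounded and U_k(n) would be O(log n), as the sum has O(log n) terms.  Hence
-- U_k(n) > ρ C log n forces some level l < l*(n) whose extremal graph G has m
-- vertices and more than ρ c m edges; the last level is no exception, since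
-- ex(2m, 2k) ≤ 6 ex(m, 2k).
--
-- From G, build a closed walk that uses each edge once: follow unused edges until
-- stuck at a vertex, then jump through 2k private vertices to an edge not yet used.
-- A vertex where the walk got stuck is never visited again, so there are at most m
-- jumps.  The cities are the time steps of the walk (with idle steps to make n of
-- them), under the path metric of the walk truncated at k; the walk is the tour T.
-- If another tour keeps all but k edges of T and is shorter, then the sum mod 2 of T
-- and of shortest paths for its steps is an even edge set with fewer than 2k edges,
-- hence empty because the girth is at least 2k, which makes T no longer than that
-- tour.  So T is k-optimal of cost at least |E(G)|, whereas visiting the cities
-- vertex by vertex costs O(m).
module Submission where

-- Truncation at `k` serves both sides of the ratio. In the short tour every change of place costs
-- at most `k`. In the optimality proof a step of truncated length `k` pays alone for the at most
-- `k` dropped steps of T, so every step of the rival tour may be assumed to have a shortest path. A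
-- kept step is the only short path between its ends, hence it lies on a path; with K kept steps, R
-- dropped ones and a rival shorter than `K + R`, the sum mod 2 then has fewer than `2R ≤ 2k` edges.
-- A direct jump could close a short cycle with edges of G. An excursion through `2 * k` private
-- vertices cannot: an even edge set contains all of it or nothing. The short tour changes vertex at
-- most m times, meets at most `2km` private vertices and closes up once, whence the constant
-- `k * (2 * k + 2)` per vertex. A graph denser than this has more edges than the excursions have
-- cities, so the walk has at most `2 ex(m, 2k)` times. This fits into n cities at every level below
-- l*, where `4 ex(m, 2k) < n`; at l* itself it may fail, which is why that level is compared with
-- the one before. Ratios up to one need a separate, trivial instance.

-- Cyclic successor, finite sums and parity

module FiniteSums where
  open import Data.Nat hiding (_≟_)
  open import Data.Nat.Properties hiding (suc-injective; 0≢1+n; _≟_)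
  open import Data.Fin using (Fin; zero; suc; toℕ; fromℕ; inject₁)
  open import Data.Fin.Properties using (_≟_; toℕ-inject₁; toℕ-fromℕ; toℕ<n; toℕ-fromℕ<; toℕ-injective; any?; suc-injective; 0≢1+n)
  open import Data.Bool using (Bool; true; false; _∧_; _xor_; not)
  open import Data.Bool.Properties using (xor-∧-commutativeRing; xor-identityʳ; ¬-not) renaming (_≟_ to _≟B_)
  open import Data.Product using (∃; _×_; _,_)
  open import Data.Sum using (_⊎_; inj₁; inj₂)
  open import Relation.Nullary using (yes; no; ¬_; contradiction)
  open import Relation.Nullary.Decidable using (¬?; _×-dec_)
  open import Relation.Binary.PropositionalEquality hiding ([_])
  open import Function using (_∘_; Injective)
  open import Algebra using (CommutativeRing; CommutativeMonoid)
  open import Defs using (next)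
  import Algebra.Properties.Semiring.Sum
  import Algebra.Properties.CommutativeMonoid.Sum as CMSum

  module ℕΣ = Algebra.Properties.Semiring.Sum +-*-semiring
  module ⊕Σ = Algebra.Properties.Semiring.Sum (CommutativeRing.semiring xor-∧-commutativeRing)

  [_] : Bool → ℕ
  [ true ]  = 1
  [ false ] = 0

  next-inject₁ : ∀ {n} (i : Fin n) → next (inject₁ i) ≡ suc i
  next-inject₁ {n} i with suc (toℕ (inject₁ i)) <? suc n
  ... | yes p = toℕ-injective (trans (toℕ-fromℕ< p) (cong suc (toℕ-inject₁ i)))
  ... | no ¬p = contradiction (s≤s (subst (_< n) (sym (toℕ-inject₁ i)) (toℕ<n i))) ¬p

  next-last : ∀ n → next (fromℕ n) ≡ zero
  next-last n with suc (toℕ (fromℕ n)) <? suc n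
  ... | yes p = contradiction (subst (_< n) (toℕ-fromℕ n) (s<s⁻¹ p)) (<-irrefl refl)
  ... | no _ = refl

  toℕ-next : ∀ {n} (i : Fin n) → (suc (toℕ i) < n × toℕ (next i) ≡ suc (toℕ i)) ⊎ (suc (toℕ i) ≡ n × toℕ (next i) ≡ 0)
  toℕ-next {suc n} i with suc (toℕ i) <? suc n
  ... | yes p = inj₁ (p , toℕ-fromℕ< p)
  ... | no ¬p = inj₂ (≤-antisym (toℕ<n i) (≮⇒≥ ¬p) , refl)

  next-injective : ∀ {n} {i j : Fin n} → next i ≡ next j → i ≡ j
  next-injective {n} {i} {j} eq with toℕ-next i | toℕ-next j
  ... | inj₁ (_ , p) | inj₁ (_ , q) = toℕ-injective (cong pred (trans (sym p) (trans (cong toℕ eq) q)))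
  ... | inj₁ (_ , p) | inj₂ (_ , q) = contradiction (trans (sym p) (trans (cong toℕ eq) q)) λ ()
  ... | inj₂ (_ , p) | inj₁ (_ , q) = contradiction (trans (sym p) (trans (cong toℕ eq) q)) λ ()
  ... | inj₂ (p , _) | inj₂ (q , _) = toℕ-injective (cong pred (trans p (sym q)))

  next≢ : ∀ {n} (i : Fin n) → 2 ≤ n → next i ≢ i
  next≢ i 2≤n eq with toℕ-next i
  ... | inj₁ (_ , p) = contradiction (trans (sym (cong toℕ eq)) p) λ q → <-irrefl q ≤-refl
  ... | inj₂ (p , q) = <-irrefl (trans (cong suc (trans (sym q) (cong toℕ eq))) p) 2≤n

  next-next≢ : ∀ {n} (i : Fin n) → 3 ≤ n → next (next i) ≢ i
  next-next≢ {n} i 3≤n eq with toℕ-next i | toℕ-next (next i)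
  ... | inj₁ (_ , p) | inj₁ (_ , q) =
    contradiction (trans (sym (cong toℕ eq)) (trans q (cong suc p))) λ e → <-irrefl e (m≤n⇒m≤1+n ≤-refl)
  ... | inj₁ (_ , p) | inj₂ (r , q) =
    <-irrefl (trans (cong (2 +_) (trans (sym q) (cong toℕ eq))) (trans (cong suc (sym p)) r)) 3≤n
  ... | inj₂ (r , p) | inj₁ (_ , q) =
    <-irrefl (trans (cong suc (trans (cong suc (sym p)) (trans (sym q) (cong toℕ eq)))) r) 3≤n
  ... | inj₂ (r , p) | inj₂ (s , q) = <-irrefl (trans (cong suc (sym p)) s) (≤-trans (s≤s (s≤s z≤n)) 3≤n)

  module _ {a ℓ} (M : CommutativeMonoid a ℓ) where
    open CommutativeMonoid M renaming (Carrier to C; refl to ≈-refl; trans to ≈-trans)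
    open CMSum M using (sum; sum-init-last; sum-cong-≗)

    sum-next-split : ∀ {n} (f : Fin (suc n) → Fin (suc n) → C) →
      sum (λ i → f i (next i)) ≈ sum (λ i → f (inject₁ i) (suc i)) ∙ f (fromℕ n) zero
    sum-next-split {n} f = ≈-trans (sum-init-last (λ i → f i (next i)))
      (∙-cong (reflexive (sum-cong-≗ (λ i → cong (f (inject₁ i)) (next-inject₁ i))))
              (reflexive (cong (f (fromℕ n)) (next-last n))))

    sum-next : ∀ {n} (f : Fin n → C) → sum (f ∘ next) ≈ sum f
    sum-next {zero} f = ≈-refl
    sum-next {suc n} f = ≈-trans (sum-next-split (λ _ → f)) (comm _ _)

  sum-mono-≤ : ∀ {n} {f g : Fin n → ℕ} → (∀ i → f i ≤ g i) → ℕΣ.sum f ≤ ℕΣ.sum g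
  sum-mono-≤ {zero} le = z≤n
  sum-mono-≤ {suc n} le = +-mono-≤ (le zero) (sum-mono-≤ (le ∘ suc))

  term≤sum : ∀ {n} (f : Fin n → ℕ) i → f i ≤ ℕΣ.sum f
  term≤sum f zero = m≤m+n _ _
  term≤sum f (suc i) = ≤-trans (term≤sum (f ∘ suc) i) (m≤n+m _ _)

  sum≡0⇒ : ∀ {n} (f : Fin n → ℕ) → ℕΣ.sum f ≡ 0 → ∀ i → f i ≡ 0
  sum≡0⇒ f eq i = n≤0⇒n≡0 (subst (f i ≤_) eq (term≤sum f i))

  sum-zero : ∀ {n} (f : Fin n → ℕ) → (∀ i → f i ≡ 0) → ℕΣ.sum f ≡ 0
  sum-zero {zero} f eq = refl
  sum-zero {suc n} f eq = cong₂ _+_ (eq zero) (sum-zero (f ∘ suc) (eq ∘ suc))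

  -- Slack in one summand survives in the whole sum. It comes from a long step of a tour or from an
  -- element deleted from a counted set.
  term+sum≤sum : ∀ {n} {f g : Fin n → ℕ} {c} i → (∀ j → f j ≤ g j) → c + f i ≤ g i → c + ℕΣ.sum f ≤ ℕΣ.sum g
  term+sum≤sum {f = f} {g} {c} zero le h =
    subst (_≤ ℕΣ.sum g) (+-assoc c (f zero) _) (+-mono-≤ h (sum-mono-≤ (le ∘ suc)))
  term+sum≤sum {f = f} {g} {c} (suc i) le h =
    subst (_≤ ℕΣ.sum g) (trans (+-comm (f zero) _) (trans (+-assoc c _ (f zero)) (cong (c +_) (+-comm _ (f zero)))))
      (+-mono-≤ (le zero) (term+sum≤sum {c = c} i (le ∘ suc) h))

  ⊕-zero : ∀ {n} (f : Fin n → Bool) → (∀ i → f i ≡ false) → ⊕Σ.sum f ≡ false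
  ⊕-zero {zero} f eq = refl
  ⊕-zero {suc n} f eq = cong₂ _xor_ (eq zero) (⊕-zero (f ∘ suc) (eq ∘ suc))

  ⊕-single : ∀ {n} (f : Fin n → Bool) i → (∀ j → j ≢ i → f j ≡ false) → ⊕Σ.sum f ≡ f i
  ⊕-single f zero eq = trans (cong (f zero xor_) (⊕-zero (f ∘ suc) (λ j → eq (suc j) λ ()))) (xor-identityʳ _)
  ⊕-single f (suc i) eq = cong₂ _xor_ (eq zero λ ()) (⊕-single (f ∘ suc) i (λ j ne → eq (suc j) (ne ∘ suc-injective)))

  -- A single true summand would make the sum odd. With summands indexed by the edges at a vertex, a
  -- trail inside an even edge set can leave the vertex by another edge.
  ⊕-second : ∀ {n} (f : Fin n → Bool) i → ⊕Σ.sum f ≡ false → f i ≡ true → ∃ λ j → j ≢ i × f j ≡ true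
  ⊕-second f i even fi with any? (λ j → ¬? (j ≟ i) ×-dec (f j ≟B true))
  ... | yes p = p
  ... | no ¬p = contradiction (trans (sym fi) (trans (sym (⊕-single f i (λ j ne → ¬-not λ fj → ¬p (j , ne , fj)))) even)) λ ()

  sum-parity : ∀ {n} (f : Fin n → Bool) → ∃ λ h → ℕΣ.sum ([_] ∘ f) ≡ [ ⊕Σ.sum f ] + 2 * h
  sum-parity {zero} f = 0 , refl
  sum-parity {suc n} f with f zero | sum-parity (f ∘ suc)
  ... | false | h , eq = h , eq
  ... | true | h , eq with ⊕Σ.sum (f ∘ suc)
  ...   | false = h , cong suc eq
  ...   | true = suc h , trans (cong suc eq) (cong suc (sym (+-suc h (h + 0))))

  -- In an even sum, a set bit has a partner.
  even-sum≥ : ∀ {n} (f : Fin n → Bool) i → f i ≡ true → [ not (⊕Σ.sum f) ] + 1 ≤ ℕΣ.sum ([_] ∘ f)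
  even-sum≥ f i fi with ⊕Σ.sum f | sum-parity f | subst (λ b → [ b ] ≤ ℕΣ.sum ([_] ∘ f)) fi (term≤sum ([_] ∘ f) i)
  ... | true | _ | ge = ge
  ... | false | zero , eq | ge = contradiction (subst (1 ≤_) eq ge) λ ()
  ... | false | suc h , eq | _ = ≤-trans (s≤s (subst (1 ≤_) (sym (+-suc h (h + 0))) (s≤s z≤n))) (≤-reflexive (sym eq))

  odd-sum≥ : ∀ {n} (f : Fin n → Bool) → [ ⊕Σ.sum f ] ≤ ℕΣ.sum ([_] ∘ f)
  odd-sum≥ f with sum-parity f
  ... | h , eq = subst ([ ⊕Σ.sum f ] ≤_) (sym eq) (m≤m+n _ _)

  -- Induction on `l`: the image of `zero` is deleted from `b`, and injectivity keeps the other
  -- images inside what remains.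
  injection≤sum : ∀ {l n} (b : Fin n → Bool) (f : Fin l → Fin n) → Injective _≡_ _≡_ f →
    (∀ t → b (f t) ≡ true) → l ≤ ℕΣ.sum ([_] ∘ b)
  injection≤sum {zero} b f inj bf = z≤n
  injection≤sum {suc l} {n} b f inj bf =
    ≤-trans (s≤s (injection≤sum b′ (f ∘ suc) (suc-injective ∘ inj) bf′)) (term+sum≤sum (f zero) le h)
    where
    b′ : Fin n → Bool
    b′ i with i ≟ f zero
    ... | yes _ = false
    ... | no _ = b i
    bf′ : ∀ t → b′ (f (suc t)) ≡ true
    bf′ t with f (suc t) ≟ f zero
    ... | yes p = contradiction (sym (inj p)) 0≢1+n
    ... | no _ = bf (suc t)
    le : ∀ i → [ b′ i ] ≤ [ b i ]
    le i with i ≟ f zero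
    ... | yes _ = z≤n
    ... | no _ = ≤-refl
    h : 1 + [ b′ (f zero) ] ≤ [ b (f zero) ]
    h with f zero ≟ f zero
    ... | yes _ = ≤-reflexive (cong [_] (sym (bf zero)))
    ... | no ne = contradiction refl ne

-- Natural numbers inside the rationals

module RationalSums where
  open import Data.Nat as ℕ using (ℕ; zero; suc)
  import Data.Nat.Properties as ℕP
  open import Data.Integer as ℤ using (+_)
  import Data.Integer.Properties as ℤP
  open import Data.Rational
  open import Data.Rational.Properties
  open import Data.Rational.Literals using (fromℤ)
  open import Data.Fin using (Fin; zero; suc)
  open import Relation.Binary.PropositionalEquality hiding ([_])
  open import Function using (_∘_)
  open import Defs using (ℕ→ℚ; Σℚ)
  open FiniteSums

  -- The fraction `+ n / 1` is stuck on a gcd, whereas `fromℤ` is a normal form on which sums,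
  -- products and order compute.
  ℕ→ℚ≡fromℤ : ∀ n → ℕ→ℚ n ≡ fromℤ (+ n)
  ℕ→ℚ≡fromℤ n = fromℚᵘ-toℚᵘ (fromℤ (+ n))

  ℕ→ℚ-+ : ∀ a b → ℕ→ℚ (a ℕ.+ b) ≡ ℕ→ℚ a + ℕ→ℚ b
  ℕ→ℚ-+ a b = sym (begin
    ℕ→ℚ a + ℕ→ℚ b                        ≡⟨ cong₂ _+_ (ℕ→ℚ≡fromℤ a) (ℕ→ℚ≡fromℤ b) ⟩
    (+ a ℤ.* + 1 ℤ.+ + b ℤ.* + 1) / 1      ≡⟨ cong (_/ 1) (cong₂ ℤ._+_ (ℤP.*-identityʳ (+ a)) (ℤP.*-identityʳ (+ b))) ⟩
    ℕ→ℚ (a ℕ.+ b)                         ∎)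
    where open ≡-Reasoning

  ℕ→ℚ-* : ∀ a b → ℕ→ℚ (a ℕ.* b) ≡ ℕ→ℚ a * ℕ→ℚ b
  ℕ→ℚ-* a b = sym (begin
    ℕ→ℚ a * ℕ→ℚ b       ≡⟨ cong₂ _*_ (ℕ→ℚ≡fromℤ a) (ℕ→ℚ≡fromℤ b) ⟩
    (+ a ℤ.* + b) / 1    ≡⟨ cong (_/ 1) (sym (ℤP.pos-* a b)) ⟩
    ℕ→ℚ (a ℕ.* b)        ∎)
    where open ≡-Reasoning

  ℕ→ℚ-mono-≤ : ∀ a b → a ℕ.≤ b → ℕ→ℚ a ≤ ℕ→ℚ b
  ℕ→ℚ-mono-≤ a b a≤b = subst₂ _≤_ (sym (ℕ→ℚ≡fromℤ a)) (sym (ℕ→ℚ≡fromℤ b))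
    (*≤* (ℤP.*-monoʳ-≤-nonNeg (+ 1) (ℤ.+≤+ a≤b)))

  ℕ→ℚ-mono-< : ∀ a b → a ℕ.< b → ℕ→ℚ a < ℕ→ℚ b
  ℕ→ℚ-mono-< a b a<b = subst₂ _<_ (sym (ℕ→ℚ≡fromℤ a)) (sym (ℕ→ℚ≡fromℤ b))
    (*<* (ℤP.*-monoʳ-<-pos (+ 1) (ℤ.+<+ a<b)))

  ℕ→ℚ-cancel-< : ∀ a b → ℕ→ℚ a < ℕ→ℚ b → a ℕ.< b
  ℕ→ℚ-cancel-< a b a<b = ℕP.≰⇒> λ b≤a → <-irrefl refl (<-≤-trans a<b (ℕ→ℚ-mono-≤ b a b≤a))

  0≤ℕ→ℚ : ∀ n → 0ℚ ≤ ℕ→ℚ n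
  0≤ℕ→ℚ n = ℕ→ℚ-mono-≤ 0 n ℕ.z≤n

  Σℚ-ℕ→ℚ : ∀ {n} (f : Fin n → ℕ) → Σℚ (ℕ→ℚ ∘ f) ≡ ℕ→ℚ (ℕΣ.sum f)
  Σℚ-ℕ→ℚ {zero} f = refl
  Σℚ-ℕ→ℚ {suc n} f = trans (cong (λ q → ℕ→ℚ (f zero) + q) (Σℚ-ℕ→ℚ (f ∘ suc))) (sym (ℕ→ℚ-+ (f zero) _))

-- Chains mod 2 and the truncated path metric

module Chains where
  open import Data.Nat hiding (_≟_)
  open import Data.Nat.Properties hiding (_≟_)
  open import Data.Fin using (Fin; zero; suc)
  open import Data.Fin.Properties using (_≟_; all?)
  open import Data.Fin.Subset.Properties using (anySubset?)
  open import Data.Vec using (Vec; lookup; tabulate)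
  open import Data.Vec.Properties using (lookup∘tabulate)
  open import Data.Bool using (Bool; true; false; _∧_; _xor_; not)
  open import Data.Bool.Properties using (xor-comm; xor-same; ∧-distribʳ-xor; xor-assoc)
    renaming (_≟_ to _≟B_)
  open import Data.Product using (Σ; _×_; _,_; proj₁; proj₂)
  open import Relation.Nullary using (yes; no; ¬_; contradiction; Dec)
  open import Relation.Nullary.Decidable using (⌊_⌋; _×-dec_)
  open import Relation.Binary.PropositionalEquality hiding ([_])
  open import Function using (_∘_)
  open FiniteSums

  ⌊⌋-yes : ∀ {a} {A : Set a} {d : Dec A} → A → ⌊ d ⌋ ≡ true
  ⌊⌋-yes {d = yes _} _ = refl
  ⌊⌋-yes {d = no ¬a} a = contradiction a ¬a

  ⌊⌋-no : ∀ {a} {A : Set a} {d : Dec A} → ¬ A → ⌊ d ⌋ ≡ false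
  ⌊⌋-no {d = yes a} ¬a = contradiction a ¬a
  ⌊⌋-no {d = no _} _ = refl

  -- The search returns `k` when nothing smaller qualifies; this default is the truncation of the
  -- metric.
  least : {Q : ℕ → Set} → (∀ ℓ → Dec (Q ℓ)) → ∀ k →
          Σ ℕ λ d → d ≤ k × (∀ {ℓ} → Q ℓ → d ≤ ℓ) × (d < k → Q d)
  least Q? zero = 0 , z≤n , (λ _ → z≤n) , λ ()
  least {Q} Q? (suc k) with Q? 0
  ... | yes q = 0 , z≤n , (λ _ → z≤n) , λ _ → q
  ... | no ¬q with least (Q? ∘ suc) k
  ...   | d , d≤k , min , wit = suc d , s≤s d≤k , min′ , wit ∘ s≤s⁻¹
    where
    min′ : ∀ {ℓ} → Q ℓ → suc d ≤ ℓ
    min′ {zero} q = contradiction q ¬q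
    min′ {suc ℓ} q = s≤s (min q)

  -- The multigraph on Fin p with edges {tail i , head i}; a chain mod 2 is a
  -- set of edges, and loops have weight zero.
  module _ {n p : ℕ} (tail head : Fin n → Fin p) where

    Chain : Set
    Chain = Fin n → Bool

    δ : Fin p → Fin p → Bool
    δ v x = ⌊ v ≟ x ⌋

    nonloop : Fin n → Bool
    nonloop i = not ⌊ tail i ≟ head i ⌋

    weight : Chain → ℕ
    weight X = ℕΣ.sum (λ i → [ X i ∧ nonloop i ])

    -- The boundary map of homology mod 2: the parity of the degree of `v` in `X`. Loops cancel.
    ∂ : Chain → Fin p → Bool
    ∂ X v = ⊕Σ.sum (λ i → X i ∧ (δ v (tail i) xor δ v (head i)))

    infixl 5 _⊕_
    _⊕_ : Chain → Chain → Chain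
    (X ⊕ Y) i = X i xor Y i

    ∂-cong : ∀ {X Y} → (∀ i → X i ≡ Y i) → ∀ v → ∂ X v ≡ ∂ Y v
    ∂-cong eq v = ⊕Σ.sum-cong-≗ λ i → cong (_∧ _) (eq i)

    ∂-⊕ : ∀ X Y v → ∂ (X ⊕ Y) v ≡ ∂ X v xor ∂ Y v
    ∂-⊕ X Y v = trans (⊕Σ.sum-cong-≗ λ i → ∧-distribʳ-xor (δ v (tail i) xor δ v (head i)) (X i) (Y i))
      (⊕Σ.∑-distrib-+ (λ i → X i ∧ (δ v (tail i) xor δ v (head i))) _)

    ∂-sum : ∀ {q} (X : Fin q → Chain) v → ∂ (λ i → ⊕Σ.sum (λ a → X a i)) v ≡ ⊕Σ.sum (λ a → ∂ (X a) v)
    ∂-sum X v = trans (⊕Σ.sum-cong-≗ λ i → ⊕Σ.*-distribʳ-sum (δ v (tail i) xor δ v (head i)) (λ a → X a i))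
      (⊕Σ.∑-comm (λ i a → X a i ∧ (δ v (tail i) xor δ v (head i))))

    ∂-zero : ∀ v → ∂ (λ _ → false) v ≡ false
    ∂-zero v = ⊕-zero (λ (_ : Fin n) → false) λ _ → refl

    single : Fin n → Chain
    single j i = ⌊ i ≟ j ⌋

    ∂-single : ∀ j v → ∂ (single j) v ≡ δ v (tail j) xor δ v (head j)
    ∂-single j v = trans (⊕-single (λ i → single j i ∧ (δ v (tail i) xor δ v (head i))) j
        λ i ne → cong (_∧ _) (⌊⌋-no {d = i ≟ j} ne))
      (cong (_∧ (δ v (tail j) xor δ v (head j))) (⌊⌋-yes {d = j ≟ j} refl))

    weight-⊕ : ∀ X Y → weight (X ⊕ Y) ≤ weight X + weight Y
    weight-⊕ X Y = ≤-trans (sum-mono-≤ λ i → le (X i) (Y i) (nonloop i))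
      (≤-reflexive (ℕΣ.∑-distrib-+ (λ i → [ X i ∧ nonloop i ]) _))
      where
      le : ∀ a b c → [ (a xor b) ∧ c ] ≤ [ a ∧ c ] + [ b ∧ c ]
      le false b c = ≤-refl
      le true false c = m≤m+n _ _
      le true true c = z≤n

    weight-single : ∀ j → weight (single j) ≤ [ nonloop j ]
    weight-single j = go n tail head j
      where
      go : ∀ n (s t : Fin n → Fin p) j → ℕΣ.sum (λ i → [ ⌊ i ≟ j ⌋ ∧ not ⌊ s i ≟ t i ⌋ ]) ≤ [ not ⌊ s j ≟ t j ⌋ ]
      go (suc n) s t zero = ≤-reflexive (trans (cong ([ not ⌊ s zero ≟ t zero ⌋ ] +_)
        (sum-zero {n} (λ _ → 0) λ _ → refl)) (+-identityʳ _))
      go (suc n) s t (suc j) = ≤-trans (≤-reflexive (ℕΣ.sum-cong-≗ λ i → cong (λ b → [ b ∧ _ ]) (eq i))) (go n (s ∘ suc) (t ∘ suc) j)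
        where
        eq : ∀ i → ⌊ suc i ≟ suc j ⌋ ≡ ⌊ i ≟ j ⌋
        eq i with i ≟ j
        ... | yes _ = refl
        ... | no _ = refl

    weight≡0⇒ : ∀ X → weight X ≡ 0 → ∀ i → nonloop i ≡ true → X i ≡ false
    weight≡0⇒ X eq i nl with X i | sum≡0⇒ (λ i → [ X i ∧ nonloop i ]) eq i
    ... | false | _ = refl
    ... | true | e rewrite nl = contradiction e λ ()

    -- Such a chain consists of loops, whose two ends cancel.
    weight≡0⇒∂ : ∀ X → weight X ≡ 0 → ∀ v → ∂ X v ≡ false
    weight≡0⇒∂ X eq v = ⊕-zero _ term≡false
      where
      term≡false : ∀ i → X i ∧ (δ v (tail i) xor δ v (head i)) ≡ false
      term≡false i with X i | sum≡0⇒ (λ i → [ X i ∧ nonloop i ]) eq i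
      ... | false | _ = refl
      ... | true | e with tail i ≟ head i
      ...   | yes p rewrite p = xor-same (δ v (head i))
      ...   | no _ = contradiction e λ ()

    Joins : Fin p → Fin p → Chain → Set
    Joins x y X = ∀ v → ∂ X v ≡ δ v x xor δ v y

    -- The chain is stored as a `Vec`, hence as a `Subset`, so that exhaustive search decides its
    -- existence.
    Within : Fin p → Fin p → ℕ → Set
    Within x y ℓ = Σ (Vec Bool n) λ X → Joins x y (lookup X) × weight (lookup X) ≤ ℓ

    within? : ∀ x y ℓ → Dec (Within x y ℓ)
    within? x y ℓ = anySubset? λ X → all? (λ v → ∂ (lookup X) v ≟B (δ v x xor δ v y)) ×-dec (weight (lookup X) ≤? ℓ)

    -- Any chain with boundary x + y contains a path from x to y, so dist is the
    -- path metric truncated at k; chains make the triangle inequality an addition.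
    module Distance (k : ℕ) where

      -- Opaque, so that type checking never unfolds a distance into the search over all chains.
      abstract
        dist : Fin p → Fin p → ℕ
        dist x y = proj₁ (least (within? x y) k)

        dist≤k : ∀ x y → dist x y ≤ k
        dist≤k x y = proj₁ (proj₂ (least (within? x y) k))

        dist≤weight : ∀ {x y} X → Joins x y X → dist x y ≤ weight X
        dist≤weight {x} {y} X joins = proj₁ (proj₂ (proj₂ (least (within? x y) k)))
          ( tabulate X
          , (λ v → trans (∂-cong (lookup∘tabulate X) v) (joins v))
          , ≤-reflexive (ℕΣ.sum-cong-≗ λ i → cong (λ b → [ b ∧ nonloop i ]) (lookup∘tabulate X i)))

        geodesic : ∀ {x y} → dist x y < k → Σ Chain λ X → Joins x y X × weight X ≤ dist x y
        geodesic {x} {y} lt with proj₂ (proj₂ (proj₂ (least (within? x y) k))) lt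
        ... | X , joins , w = lookup X , joins , w

      dist-refl : ∀ x → dist x x ≡ 0
      dist-refl x = n≤0⇒n≡0 (≤-trans (dist≤weight (λ _ → false) λ v → trans (∂-zero v) (sym (xor-same (δ v x))))
        (≤-reflexive (sum-zero {n} (λ _ → 0) λ _ → refl)))

      dist-sym-≤ : ∀ x y → dist x y ≤ dist y x
      dist-sym-≤ x y with dist y x <? k
      ... | no ≮k = ≤-trans (dist≤k x y) (≮⇒≥ ≮k)
      ... | yes <k with geodesic <k
      ...   | X , joins , w = ≤-trans (dist≤weight X λ v → trans (joins v) (xor-comm (δ v y) (δ v x))) w

      dist-sym : ∀ x y → dist x y ≡ dist y x
      dist-sym x y = ≤-antisym (dist-sym-≤ x y) (dist-sym-≤ y x)

      dist-tri : ∀ x y z → dist x z ≤ dist x y + dist y z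
      dist-tri x y z with dist x y <? k | dist y z <? k
      ... | no ≮k | _ = ≤-trans (dist≤k x z) (≤-trans (≮⇒≥ ≮k) (m≤m+n _ _))
      ... | yes _ | no ≮k = ≤-trans (dist≤k x z) (≤-trans (≮⇒≥ ≮k) (m≤n+m _ _))
      ... | yes a | yes b with geodesic a | geodesic b
      ...   | X , jX , wX | Y , jY , wY = ≤-trans (dist≤weight (X ⊕ Y) joins) (≤-trans (weight-⊕ X Y) (+-mono-≤ wX wY))
        where
        cancel : ∀ a b c → (a xor b) xor (b xor c) ≡ a xor c
        cancel false b c = trans (sym (xor-assoc b b c)) (cong (_xor c) (xor-same b))
        cancel true false c = refl
        cancel true true c = refl
        joins : Joins x z (X ⊕ Y)
        joins v = trans (∂-⊕ X Y v) (trans (cong₂ _xor_ (jX v) (jY v)) (cancel (δ v x) (δ v y) (δ v z)))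

      dist-edge : ∀ j → dist (tail j) (head j) ≤ [ nonloop j ]
      dist-edge j = ≤-trans (dist≤weight (single j) (∂-single j)) (weight-single j)

      -- A chain of weight zero has no boundary, but one joining `x` to another vertex has boundary
      -- one at `x`. The hypothesis `1 ≤ k` makes a geodesic available at distance zero.
      1≤dist : 1 ≤ k → ∀ {x y} → x ≢ y → 1 ≤ dist x y
      1≤dist 1≤k {x} {y} x≢y = n≢0⇒n>0 λ dist≡0 → x≢y (same dist≡0)
        where
        same : dist x y ≡ 0 → x ≡ y
        same eq with geodesic (≤-trans (s≤s (≤-reflexive eq)) 1≤k)
        ... | X , joins , w with trans (sym (joins x)) (weight≡0⇒∂ X (n≤0⇒n≡0 (≤-trans w (≤-reflexive eq))) x)
        ...   | e with x ≟ x | x ≟ y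
        ...     | _ | yes p = p
        ...     | yes _ | no _ = contradiction e λ ()
        ...     | no ¬p | no _ = contradiction refl ¬p

-- Closed walks as k-optimal tours

module ClosedWalks where
  open import Data.Nat hiding (_≟_)
  open import Data.Nat.Properties hiding (_≟_; suc-injective)
  import Data.Rational as ℚ
  open import Data.Fin using (Fin; zero; suc)
  open import Data.Fin.Properties using (_≟_; all?; ¬∀⟶∃¬; suc-injective)
  open import Data.Bool using (Bool; true; false; _∧_; _xor_; not)
  open import Data.Bool.Properties using (xor-comm; xor-same)
    renaming (_≟_ to _≟B_)
  open import Data.Bool.ListAction using (any)
  open import Data.List using (List; []; _∷_; length; filter; tabulate)
  import Algebra
  open import Data.Bool.Properties using (xor-∧-commutativeRing)
  open import Data.Product using (∃; _×_; _,_; proj₁; proj₂)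
  open import Data.Sum using (_⊎_; inj₁; inj₂)
  open import Relation.Nullary using (yes; no; ¬_; contradiction; Dec)
  open import Relation.Nullary.Decidable using (⌊_⌋)
  open import Relation.Binary.PropositionalEquality hiding ([_])
  open import Function using (_∘_)
  open import Defs hiding (sym)
  open FiniteSums
  open RationalSums
  open Chains

  any-tabulate : ∀ {A : Set} {n} (p : A → Bool) (f : Fin n → A) → any p (tabulate f) ≡ true → ∃ λ i → p (f i) ≡ true
  any-tabulate {n = suc n} p f eq with p (f zero) in e
  ... | true = zero , e
  ... | false with any-tabulate p (f ∘ suc) eq
  ...   | i , h = suc i , h

  length-filter-tabulate : ∀ {A : Set} {n} (p : A → Bool) (f : Fin n → A) →
    length (filter (λ i → p i ≟B true) (tabulate f)) ≡ ℕΣ.sum (λ i → [ p (f i) ])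
  length-filter-tabulate {n = zero} p f = refl
  length-filter-tabulate {n = suc n} p f with p (f zero)
  ... | true = cong suc (length-filter-tabulate p (f ∘ suc))
  ... | false = length-filter-tabulate p (f ∘ suc)

  count≡sum : ∀ {n} (p : Fin n → Bool) → count p ≡ ℕΣ.sum ([_] ∘ p)
  count≡sum p = length-filter-tabulate p λ i → i

  hasEdge⇒ : ∀ {n} (S : Tour n) a b → hasEdge S a b ≡ true → ∃ λ i →
    (σ S i ≡ a × σ S (next i) ≡ b) ⊎ (σ S i ≡ b × σ S (next i) ≡ a)
  hasEdge⇒ S a b eq with any-tabulate _ (λ i → i) eq
  ... | i , h with σ S i ≟ a | σ S (next i) ≟ b | σ S i ≟ b | σ S (next i) ≟ a
  ...   | yes p | yes q | _ | _ = i , inj₁ (p , q)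
  ...   | yes _ | no _ | yes p | yes q = i , inj₂ (p , q)
  ...   | no _ | _ | yes p | yes q = i , inj₂ (p , q)
  ...   | yes _ | no _ | yes _ | no _ = contradiction h λ ()
  ...   | yes _ | no _ | no _ | _ = contradiction h λ ()
  ...   | no _ | _ | yes _ | no _ = contradiction h λ ()
  ...   | no _ | _ | no _ | _ = contradiction h λ ()

  not-false : ∀ {b} → not b ≡ false → b ≡ true
  not-false {true} _ = refl

  idTour : ∀ n → Tour n
  idTour n = record { σ = λ i → i ; inj = λ eq → eq }

  module _ {n p : ℕ} (loc : Fin n → Fin p) where

    private
      tl hd : Fin n → Fin p
      tl = loc
      hd i = loc (next i)

    -- The girth condition on the multigraph of the walk, in the form used by the exchange argument.
    -- Only idle steps, which are loops, may occur in a short even chain; parallel steps may not.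
    ShortEvenTrivial : ℕ → Set
    ShortEvenTrivial g = ∀ X → (∀ v → ∂ tl hd X v ≡ false) → weight tl hd X < g → weight tl hd X ≡ 0

    steps : ℕ
    steps = ℕΣ.sum λ i → [ nonloop tl hd i ]

    module _ (k : ℕ) where
      open Distance tl hd k

      distMetric : Metric n
      distMetric = record
        { d = λ i j → ℕ→ℚ (dist (loc i) (loc j))
        ; nonneg = λ i j → 0≤ℕ→ℚ (dist (loc i) (loc j))
        ; diag = λ i → cong ℕ→ℚ (dist-refl (loc i))
        ; symm = λ i j → cong ℕ→ℚ (dist-sym (loc i) (loc j))
        ; tri = λ i j l → subst (ℕ→ℚ (dist (loc i) (loc l)) ℚ.≤_) (ℕ→ℚ-+ (dist (loc i) (loc j)) (dist (loc j) (loc l)))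
                            (ℕ→ℚ-mono-≤ (dist (loc i) (loc l)) (dist (loc i) (loc j) + dist (loc j) (loc l)) (dist-tri (loc i) (loc j) (loc l)))
        }

      len : Tour n → ℕ
      len S = ℕΣ.sum λ i → dist (loc (σ S i)) (loc (σ S (next i)))

      cost≡len : ∀ S → cost distMetric S ≡ ℕ→ℚ (len S)
      cost≡len S = Σℚ-ℕ→ℚ λ i → dist (loc (σ S i)) (loc (σ S (next i)))

      len-id≤steps : len (idTour n) ≤ steps
      len-id≤steps = sum-mono-≤ dist-edge

      steps≤len-id : 1 ≤ k → steps ≤ len (idTour n)
      steps≤len-id 1≤k = sum-mono-≤ le
        where
        le : ∀ i → [ nonloop tl hd i ] ≤ dist (tl i) (hd i)
        le i with tl i ≟ hd i
        ... | yes _ = z≤n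
        ... | no ne = 1≤dist 1≤k ne

      module _ (2≤k : 2 ≤ k) (even⇒trivial : ShortEvenTrivial (2 * k)) (S : Tour n)
               (few-removed : removed (idTour n) S ≤ k) where

        private
          x y : Fin n → Fin p
          x i = loc (σ S i)
          y i = loc (σ S (next i))

          D : Fin n → ℕ
          D i = dist (x i) (y i)

          kept : Fin n → Bool
          kept j = hasEdge S j (next j)

          nl : Fin n → Bool
          nl = nonloop tl hd

          K R : ℕ
          K = ℕΣ.sum λ j → [ kept j ∧ nl j ]
          R = ℕΣ.sum λ j → [ not (kept j) ∧ nl j ]

          R≤k : R ≤ k
          R≤k = ≤-trans (sum-mono-≤ λ j → le (not (kept j)) (nl j))
                        (≤-trans (≤-reflexive (sym (count≡sum (not ∘ kept)))) few-removed)
            where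
            le : ∀ a b → [ a ∧ b ] ≤ [ a ]
            le false b = z≤n
            le true false = z≤n
            le true true = ≤-refl

          steps≡K+R : steps ≡ K + R
          steps≡K+R = trans (ℕΣ.sum-cong-≗ λ j → eq (kept j) (nl j)) (ℕΣ.∑-distrib-+ (λ j → [ kept j ∧ nl j ]) _)
            where
            eq : ∀ a b → [ b ] ≡ [ a ∧ b ] + [ not a ∧ b ]
            eq true b = sym (+-identityʳ _)
            eq false b = refl

          -- A far step has no geodesic at hand. The empty default leaves its whole length, at least
          -- `k`, free to pay for dropped steps.
          route : ∀ i → Dec (D i < k) → Chain tl hd
          route i (yes <k) = proj₁ (geodesic <k)
          route i (no _) = λ _ → false

          X : Fin n → Chain tl hd
          X i = route i (D i <? k)

          w : Chain tl hd → ℕ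
          w = weight tl hd

          zero-weight : w (λ _ → false) ≡ 0
          zero-weight = sum-zero {n} (λ _ → 0) λ _ → refl

          wX≤D : ∀ i → w (X i) ≤ D i
          wX≤D i with D i <? k
          ... | yes <k = proj₂ (proj₂ (geodesic <k))
          ... | no _ = ≤-trans (≤-reflexive zero-weight) z≤n

          joins : ∀ i → D i < k → Joins tl hd (x i) (y i) (X i)
          joins i lt with D i <? k
          ... | yes <k = proj₁ (proj₂ (geodesic <k))
          ... | no ≮k = contradiction lt ≮k

          -- A kept step is the only short route between its ends, since two
          -- different ones would form a short even chain.
          kept-route : ∀ j → kept j ≡ true → nl j ≡ true → ∃ λ i → X i j ≡ true
          kept-route j kj nj with hasEdge⇒ S j (next j) kj
          ... | i , ends = i , X≡true
            where
            δδ : ∀ v → δ tl hd v (x i) xor δ tl hd v (y i) ≡ δ tl hd v (tl j) xor δ tl hd v (hd j)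
            δδ v = ends-δ ends
              where
              ends-δ : (σ S i ≡ j × σ S (next i) ≡ next j) ⊎ (σ S i ≡ next j × σ S (next i) ≡ j) →
                       δ tl hd v (x i) xor δ tl hd v (y i) ≡ δ tl hd v (tl j) xor δ tl hd v (hd j)
              ends-δ (inj₁ (p , q)) = cong₂ (λ a b → δ tl hd v (loc a) xor δ tl hd v (loc b)) p q
              ends-δ (inj₂ (p , q)) = trans (cong₂ (λ a b → δ tl hd v (loc a) xor δ tl hd v (loc b)) p q)
                                        (xor-comm (δ tl hd v (hd j)) (δ tl hd v (tl j)))
            single≤1 : w (single tl hd j) ≤ 1
            single≤1 = ≤-trans (weight-single tl hd j) (≤-reflexive (cong [_] nj))
            D≤1 : D i ≤ 1
            D≤1 = ≤-trans (dist≤weight (single tl hd j) λ v → trans (∂-single tl hd j v) (sym (δδ v))) single≤1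
            E : Chain tl hd
            E = _⊕_ tl hd (X i) (single tl hd j)
            even : ∀ v → ∂ tl hd E v ≡ false
            even v = trans (∂-⊕ tl hd (X i) (single tl hd j) v)
              (trans (cong₂ _xor_ (trans (joins i (≤-trans (s≤s D≤1) 2≤k) v) (δδ v)) (∂-single tl hd j v))
                     (xor-same (δ tl hd v (tl j) xor δ tl hd v (hd j))))
            wE<2k : w E < 2 * k
            wE<2k = ≤-trans (s≤s (≤-trans (weight-⊕ tl hd (X i) (single tl hd j)) (+-mono-≤ (≤-trans (wX≤D i) D≤1) single≤1)))
                            (≤-trans (n≤1+n 3) (*-monoʳ-≤ 2 2≤k))
            X≡true : X i j ≡ true
            X≡true with X i j | weight≡0⇒ tl hd E (even⇒trivial E even wE<2k) j nj
            ... | true | _ = refl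
            ... | false | e = trans (sym e) (⌊⌋-yes {d = j ≟ j} refl)

          sum-w-swap : ℕΣ.sum (w ∘ X) ≡ ℕΣ.sum (λ j → ℕΣ.sum λ i → [ X i j ∧ nl j ])
          sum-w-swap = ℕΣ.∑-comm λ i j → [ X i j ∧ nl j ]

          -- Every kept step of the walk lies on the route of some step of `S`.
          K≤ΣwX : K ≤ ℕΣ.sum (w ∘ X)
          K≤ΣwX = ≤-trans (sum-mono-≤ le) (≤-reflexive (sym sum-w-swap))
            where
            le : ∀ j → [ kept j ∧ nl j ] ≤ ℕΣ.sum λ i → [ X i j ∧ nl j ]
            le j with kept j in kj | nl j in nj
            ... | false | _ = z≤n
            ... | true | false = z≤n
            ... | true | true with kept-route j kj nj
            ...   | i , h = ≤-trans (≤-reflexive (cong (λ b → [ b ∧ true ]) (sym h))) (term≤sum (λ i → [ X i j ∧ true ]) i)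

          -- The far step pays for the at most `k` dropped steps. Its own route is empty, so the
          -- kept steps are paid for by the other steps of `S`.
          steps≤-far : ∀ i → ¬ D i < k → steps ≤ len S
          steps≤-far i ≮k = ≤-trans (≤-reflexive (trans steps≡K+R (+-comm K R)))
            (≤-trans (+-mono-≤ R≤k K≤ΣwX) (term+sum≤sum i wX≤D far))
            where
            far : k + w (X i) ≤ D i
            far with D i <? k
            ... | yes <k = contradiction <k ≮k
            ... | no ≮k = ≤-trans (≤-reflexive (trans (cong (k +_) zero-weight) (+-identityʳ k))) (≮⇒≥ ≮k)

          -- The routes of all steps of S and all steps of the walk add up to an even
          -- chain in which the kept steps cancel.
          Z : Chain tl hd
          Z j = not (⊕Σ.sum λ i → X i j)

          -- A closed walk enters each vertex as often as it leaves it, so its boundary vanishes;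
          -- here `f` marks the visits to one vertex.
          closed : ∀ (f : Fin n → Bool) → ⊕Σ.sum (λ i → f i xor f (next i)) ≡ false
          closed f = trans (⊕Σ.∑-distrib-+ f (f ∘ next))
            (trans (cong (⊕Σ.sum f xor_) (sum-next (Algebra.CommutativeRing.+-commutativeMonoid xor-∧-commutativeRing) f))
                   (xor-same (⊕Σ.sum f)))

          ∂Z : (∀ i → D i < k) → ∀ v → ∂ tl hd Z v ≡ false
          ∂Z near v = trans (∂-⊕ tl hd (λ _ → true) (λ j → ⊕Σ.sum λ i → X i j) v)
            (cong₂ _xor_ (closed (δ tl hd v ∘ loc))
              (trans (∂-sum tl hd X v) (trans (⊕Σ.sum-cong-≗ λ i → joins i (near i) v) (closed (δ tl hd v ∘ loc ∘ σ S)))))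

          -- The comparison is made edge by edge. A dropped step is charged to `R`. A kept step lies
          -- on some route; if `Z` contains it, the number of routes through it is even, hence at
          -- least two.
          wZ+K≤ : w Z + K ≤ ℕΣ.sum (w ∘ X) + R
          wZ+K≤ = subst₂ _≤_ (ℕΣ.∑-distrib-+ (λ j → [ Z j ∧ nl j ]) _)
                    (trans (ℕΣ.∑-distrib-+ (λ j → ℕΣ.sum λ i → [ X i j ∧ nl j ]) _) (cong (_+ R) (sym sum-w-swap)))
                    (sum-mono-≤ le)
            where
            drop : ∀ b → b ≡ b ∧ true
            drop true = refl
            drop false = refl
            le : ∀ j → [ Z j ∧ nl j ] + [ kept j ∧ nl j ] ≤ (ℕΣ.sum λ i → [ X i j ∧ nl j ]) + [ not (kept j) ∧ nl j ]
            le j with nl j in nj | kept j in kj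
            ... | false | b = subst (_≤ (ℕΣ.sum λ i → [ X i j ∧ false ]) + [ not b ∧ false ])
                                (cong₂ (λ a c → [ a ] + [ c ]) (sym (∧-false (Z j))) (sym (∧-false b))) z≤n
              where
              ∧-false : ∀ b → b ∧ false ≡ false
              ∧-false true = refl
              ∧-false false = refl
            ... | true | false = ≤-trans (≤-reflexive (+-identityʳ _))
                   (≤-trans (bit≤1 (Z j ∧ true)) (m≤n+m 1 _))
              where
              bit≤1 : ∀ b → [ b ] ≤ 1
              bit≤1 true = ≤-refl
              bit≤1 false = z≤n
            ... | true | true with kept-route j kj nj
            ...   | i , h = ≤-trans
                      (subst₂ (λ a s → [ a ] + 1 ≤ s) (drop (Z j)) (ℕΣ.sum-cong-≗ λ i → cong [_] (drop (X i j)))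
                        (even-sum≥ (λ i → X i j) i h))
                      (m≤m+n _ _)

          -- If `S` were shorter, `wZ+K≤` would make `Z` shorter than `2 * k` and thus trivial. Each
          -- non-idle step would then lie on an odd number of routes, so on at least one, and `S`
          -- would be long enough after all.
          steps≤-near : (∀ i → D i < k) → steps ≤ len S
          steps≤-near near with steps ≤? len S
          ... | yes le = le
          ... | no ≰ = ≤-trans (sum-mono-≤ le) (≤-trans (≤-reflexive (sym sum-w-swap)) (sum-mono-≤ wX≤D))
            where
            len<K+R : len S < K + R
            len<K+R = subst (len S <_) steps≡K+R (≰⇒> ≰)
            wZ<2k : w Z < 2 * k
            wZ<2k = +-cancelʳ-< K (w Z) (2 * k) (begin-strict
              w Z + K                  ≤⟨ wZ+K≤ ⟩
              ℕΣ.sum (w ∘ X) + R      ≤⟨ +-monoˡ-≤ R (sum-mono-≤ wX≤D) ⟩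
              len S + R                <⟨ +-monoˡ-< R len<K+R ⟩
              K + R + R                ≡⟨ +-assoc K R R ⟩
              K + (R + R)              ≤⟨ +-monoʳ-≤ K (+-mono-≤ R≤k R≤k) ⟩
              K + (k + k)              ≡⟨ cong (λ a → K + (k + a)) (+-identityʳ k) ⟨
              K + 2 * k                ≡⟨ +-comm K (2 * k) ⟩
              2 * k + K                ∎)
              where open ≤-Reasoning
            le : ∀ j → [ nl j ] ≤ ℕΣ.sum λ i → [ X i j ∧ nl j ]
            le j with nl j in nj
            ... | false = z≤n
            ... | true = subst₂ (λ a b → [ a ] ≤ b) odd (ℕΣ.sum-cong-≗ λ i → cong [_] (drop (X i j))) (odd-sum≥ (λ i → X i j))
              where
              drop : ∀ b → b ≡ b ∧ true
              drop true = refl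
              drop false = refl
              odd : ⊕Σ.sum (λ i → X i j) ≡ true
              odd = not-false (weight≡0⇒ tl hd Z (even⇒trivial Z (∂Z near) wZ<2k) j nj)

        steps≤len : steps ≤ len S
        steps≤len with all? (λ i → D i <? k)
        ... | yes near = steps≤-near near
        ... | no ¬near with ¬∀⟶∃¬ n _ (λ i → D i <? k) ¬near
        ...   | i , far = steps≤-far i far

      idTour-KOptimal : 2 ≤ k → ShortEvenTrivial (2 * k) → KOptimal k distMetric (idTour n)
      idTour-KOptimal 2≤k trivial S few = subst₂ ℚ._≤_ (sym (cost≡len (idTour n))) (sym (cost≡len S))
        (ℕ→ℚ-mono-≤ (len (idTour n)) (len S) (≤-trans len-id≤steps (steps≤len 2≤k trivial S few)))

-- A cycle from a non-backtracking trail

module CycleExtraction where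
  open import Data.Nat hiding (_≟_)
  open import Data.Nat.Properties hiding (_≟_)
  open import Data.Nat.Induction using (<-rec)
  open import Data.Fin as Fin using (Fin; zero; suc; toℕ; fromℕ<)
  open import Data.Fin.Properties using (_≟_; any?; pigeonhole; toℕ<n; toℕ-injective; toℕ-fromℕ<)
  open import Data.Product using (Σ; ∃; _×_; _,_; proj₁; proj₂)
  open import Data.Sum using (inj₁; inj₂)
  open import Relation.Nullary using (yes; no; ¬_; contradiction; Dec)
  open import Relation.Binary.Definitions using (tri<; tri≈; tri>)
  open import Relation.Binary.PropositionalEquality hiding ([_])
  open import Function using (_∘_; Injective)
  open import Defs using (next)
  open FiniteSums

  module _ {m : ℕ} (H : Fin m → Fin m → Set)
           (irrefl : ∀ {u v} → H u v → u ≢ v)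
           (continue : ∀ {u v} → H u v → ∃ λ v′ → v′ ≢ u × H v v′) where

    private
      -- The witness in `H` is part of a dart because the continuation depends on it and not only on
      -- the two ends.
      Dart : Set
      Dart = Σ (Fin m) λ u → Σ (Fin m) λ v → H u v

      advance : Dart → Dart
      advance (u , v , h) = v , proj₁ (continue h) , proj₂ (proj₂ (continue h))

    -- Follow darts without turning back; the stretch between the first repeated
    -- vertex and its previous visit is a cycle.
    module _ (d₀ : Dart) where

      private
        dart : ℕ → Dart
        dart zero = d₀
        dart (suc t) = advance (dart t)

        a : ℕ → Fin m
        a t = proj₁ (dart t)

        a-H : ∀ t → H (a t) (a (suc t))
        a-H t = proj₂ (proj₂ (dart t))

        no-return : ∀ t → a (suc (suc t)) ≢ a t
        no-return t = proj₁ (proj₂ (continue (proj₂ (proj₂ (dart t)))))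

        Repeats : ℕ → Set
        Repeats b = ∃ λ (x : Fin b) → a (toℕ x) ≡ a b

        repeats? : ∀ b → Dec (Repeats b)
        repeats? b = any? λ x → a (toℕ x) ≟ a b

        FirstRepeat : Set
        FirstRepeat = ∃ λ b → Repeats b × (∀ c → c < b → ¬ Repeats c)

        first-repeat : ∀ b → Repeats b → FirstRepeat
        first-repeat = <-rec (λ b → Repeats b → FirstRepeat) search
          where
          search : ∀ b → (∀ {c} → c < b → Repeats c → FirstRepeat) → Repeats b → FirstRepeat
          search b rec rb with any? (λ (c : Fin b) → repeats? (toℕ c))
          ... | yes (c , rc) = rec (toℕ<n c) rc
          ... | no none = b , rb , λ c c<b rc → none (fromℕ< c<b , subst Repeats (sym (toℕ-fromℕ< c<b)) rc)

        some-repeat : FirstRepeat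
        some-repeat with pigeonhole (n<1+n m) (a ∘ toℕ)
        ... | i , j , i<j , eq = first-repeat (toℕ j) (fromℕ< i<j , trans (cong a (toℕ-fromℕ< i<j)) eq)

      cycle : ∃ λ ℓ → 3 ≤ ℓ × Σ (Fin ℓ → Fin m) λ vert → Injective _≡_ _≡_ vert × (∀ t → H (vert t) (vert (next t)))
      cycle with some-repeat
      ... | b , (x , ax≡ab) , first = ℓ , 3≤ℓ ℓ s+ℓ≡b , vert , vert-inj , vert-H
        where
        s ℓ : ℕ
        s = toℕ x
        ℓ = b ∸ s
        s+ℓ≡b : s + ℓ ≡ b
        s+ℓ≡b = m+[n∸m]≡n (<⇒≤ (toℕ<n x))
        -- Length one contradicts irreflexivity, and length two would mean turning back.
        3≤ℓ : ∀ ℓ → s + ℓ ≡ b → 3 ≤ ℓ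
        3≤ℓ 0 eq = contradiction (toℕ<n x) (<-irrefl (trans (sym (+-identityʳ s)) eq))
        3≤ℓ 1 eq = contradiction (trans ax≡ab (cong a (trans (sym eq) (+-comm s 1)))) (irrefl (a-H s))
        3≤ℓ 2 eq = contradiction (sym (trans ax≡ab (cong a (trans (sym eq) (+-comm s 2))))) (no-return s)
        3≤ℓ (suc (suc (suc ℓ))) eq = s≤s (s≤s (s≤s z≤n))
        vert : Fin ℓ → Fin m
        vert t = a (s + toℕ t)
        s+t<b : ∀ (t : Fin ℓ) → s + toℕ t < b
        s+t<b t = subst (s + toℕ t <_) s+ℓ≡b (+-monoʳ-< s (toℕ<n t))
        distinct : ∀ {i j} → i < j → j < b → a i ≢ a j
        distinct i<j j<b eq = first _ j<b (fromℕ< i<j , trans (cong a (toℕ-fromℕ< i<j)) eq)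
        vert-inj : Injective _≡_ _≡_ vert
        vert-inj {t} {u} eq with <-cmp (toℕ t) (toℕ u)
        ... | tri< t<u _ _ = contradiction eq (distinct (+-monoʳ-< s t<u) (s+t<b u))
        ... | tri≈ _ t≡u _ = toℕ-injective t≡u
        ... | tri> _ _ u<t = contradiction (sym eq) (distinct (+-monoʳ-< s u<t) (s+t<b t))
        vert-H : ∀ t → H (vert t) (vert (next t))
        vert-H t with toℕ-next t
        ... | inj₁ (_ , eq) = subst (H (vert t)) (cong a (trans (sym (+-suc s (toℕ t))) (cong (s +_) (sym eq)))) (a-H (s + toℕ t))
        ... | inj₂ (last , eq) = subst (H (vert t)) (trans (cong a wrap) (trans (sym ax≡ab) (cong a start))) (a-H (s + toℕ t))
          where
          wrap : suc (s + toℕ t) ≡ b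
          wrap = trans (sym (+-suc s (toℕ t))) (trans (cong (s +_) last) s+ℓ≡b)
          start : s ≡ s + toℕ (next t)
          start = trans (sym (+-identityʳ s)) (cong (s +_) (sym eq))

-- Short even chains of a walk that uses each edge of a graph once

module GraphWalks where
  open import Data.Nat hiding (_≟_)
  open import Data.Nat.Properties hiding (_≟_)
  open import Data.Fin as Fin using (Fin; zero; suc; toℕ; fromℕ<; _↑ˡ_; _↑ʳ_)
  open import Data.Fin.Properties using (_≟_; any?; toℕ<n; toℕ-injective; toℕ-fromℕ<; splitAt-↑ˡ; splitAt-↑ʳ; ↑ˡ-injective; ↑ʳ-injective)
  open import Data.Bool using (Bool; true; false; _∧_; _xor_; not)
  open import Data.Bool.Properties using (∧-distribˡ-xor; ∧-zeroʳ; ∧-identityʳ; ¬-not) renaming (_≟_ to _≟B_)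
  open import Data.Maybe using (Maybe; just; nothing; maybe)
  open import Data.Maybe.Properties using (just-injective)
  open import Data.Product using (Σ; ∃; _×_; _,_; proj₁; proj₂)
  open import Data.Sum using (_⊎_; inj₁; inj₂; swap)
  open import Relation.Nullary using (yes; no; ¬_; contradiction; Dec)
  open import Relation.Nullary.Decidable using (⌊_⌋)
  open import Relation.Binary.PropositionalEquality hiding ([_])
  open import Function using (_∘_; Injective)
  open import Defs hiding (sym; inj)
  open FiniteSums
  open Chains
  open ClosedWalks
  open CycleExtraction

  xor-true : ∀ {a b} {A : Set a} {B : Set b} (d : Dec A) (e : Dec B) → ⌊ d ⌋ xor ⌊ e ⌋ ≡ true → (A × ¬ B) ⊎ (¬ A × B)
  xor-true (yes a) (no ¬b) _ = inj₁ (a , ¬b)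
  xor-true (no ¬a) (yes b) _ = inj₂ (¬a , b)

  true-xor : ∀ {a b} {A : Set a} {B : Set b} (d : Dec A) (e : Dec B) → (A × ¬ B) ⊎ (¬ A × B) → ⌊ d ⌋ xor ⌊ e ⌋ ≡ true
  true-xor (yes a) (no ¬b) _ = refl
  true-xor (no ¬a) (yes b) _ = refl
  true-xor (yes a) (yes b) (inj₁ (_ , ¬b)) = contradiction b ¬b
  true-xor (yes a) (yes b) (inj₂ (¬a , _)) = contradiction a ¬a
  true-xor (no ¬a) (no ¬b) (inj₁ (a , _)) = contradiction a ¬a
  true-xor (no ¬a) (no ¬b) (inj₂ (_ , b)) = contradiction b ¬b

  ∧-split : ∀ {a b} → a ∧ b ≡ true → a ≡ true × b ≡ true
  ∧-split {true} {true} _ = refl , refl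

  -- A closed walk visits a vertex of G at each time i with w i = just v; at the
  -- other times it is at a private vertex visited only once.
  module _ {m n : ℕ} (w : Fin n → Maybe (Fin m)) where

    place : Fin n → Fin (m + n)
    place i = maybe (_↑ˡ n) (m ↑ʳ i) (w i)

    place-just : ∀ {i v} → w i ≡ just v → place i ≡ v ↑ˡ n
    place-just {i} eq = cong (maybe (_↑ˡ n) (m ↑ʳ i)) eq

    place-nothing : ∀ {i} → w i ≡ nothing → place i ≡ m ↑ʳ i
    place-nothing {i} eq = cong (maybe (_↑ˡ n) (m ↑ʳ i)) eq

    ↑ˡ≢↑ʳ : ∀ {v : Fin m} {i : Fin n} → v ↑ˡ n ≢ m ↑ʳ i
    ↑ˡ≢↑ʳ {v} {i} eq = contradiction (trans (sym (splitAt-↑ˡ m v n)) (trans (cong (Fin.splitAt m) eq) (splitAt-↑ʳ m n i))) λ ()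

    private-place : ∀ {i j} → w i ≡ nothing → place j ≡ place i → j ≡ i
    private-place {i} {j} wi eq = go (w j) refl
      where
      go : ∀ x → w j ≡ x → j ≡ i
      go (just v) wj = contradiction (trans (sym (place-just wj)) (trans eq (place-nothing wi))) ↑ˡ≢↑ʳ
      go nothing wj = ↑ʳ-injective m j i (trans (sym (place-nothing wj)) (trans eq (place-nothing wi)))

    Traverses : Fin n → Fin m → Fin m → Set
    Traverses i u v = w i ≡ just u × w (next i) ≡ just v

    -- The run may not wrap around the end of the walk, so that its times form an interval of
    -- numbers.
    InRun : ℕ → Fin n → Set
    InRun N i = ∃ λ a → a ≤ toℕ i × toℕ i < a + N × a + N ≤ n × (∀ j → a ≤ toℕ j → toℕ j < a + N → w j ≡ nothing)

    module _ {g : ℕ} (G : Graph m) (girth : GirthAtLeast G g) (2≤n : 2 ≤ n)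
      (along-edges : ∀ {i u v} → Traverses i u v → u ≢ v → adj G u v ≡ true)
      (edges-once : ∀ {i j u v} → Traverses i u v → Traverses j u v ⊎ Traverses j v u → u ≢ v → i ≡ j)
      (long-runs : ∀ {i} → w i ≡ nothing → InRun g i) where

      private
        tl hd : Fin n → Fin (m + n)
        tl = place
        hd i = place (next i)

        nl : Fin n → Bool
        nl = nonloop tl hd

        tl≢hd⇒nl : ∀ {i} → tl i ≢ hd i → nl i ≡ true
        tl≢hd⇒nl {i} ne = cong not (⌊⌋-no {d = tl i ≟ hd i} ne)

      module _ (X : Fin n → Bool) (even : ∀ v → ∂ tl hd X v ≡ false) (short : weight tl hd X < g) where

        private
          -- Only the steps `i` and `next i` touch the private vertex between them, so evenness
          -- there forces both or neither into `X`.
          same-along-private : ∀ i → w (next i) ≡ nothing → X (next i) ≡ X i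
          same-along-private i wi = xor-eq (trans (sym (cong₂ _xor_ outgoing incoming))
              (trans (sym (trans (⊕Σ.sum-cong-≗ λ j → ∧-distribˡ-xor (X j) (δ tl hd L (tl j)) (δ tl hd L (hd j)))
                                 (⊕Σ.∑-distrib-+ (λ j → X j ∧ δ tl hd L (tl j)) _)))
                     (even L)))
            where
            L = place (next i)
            xor-eq : ∀ {a b} → a xor b ≡ false → a ≡ b
            xor-eq {true} {true} _ = refl
            xor-eq {false} {false} _ = refl
            outgoing : ⊕Σ.sum (λ j → X j ∧ δ tl hd L (tl j)) ≡ X (next i)
            outgoing = trans (⊕-single (λ j → X j ∧ δ tl hd L (tl j)) (next i) λ j ne →
                trans (cong (X j ∧_) (⌊⌋-no {d = L ≟ tl j} λ eq → ne (private-place wi (sym eq)))) (∧-zeroʳ (X j)))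
              (trans (cong (X (next i) ∧_) (⌊⌋-yes {d = L ≟ L} refl)) (∧-identityʳ _))
            incoming : ⊕Σ.sum (λ j → X j ∧ δ tl hd L (hd j)) ≡ X i
            incoming = trans (⊕-single (λ j → X j ∧ δ tl hd L (hd j)) i λ j ne →
                trans (cong (X j ∧_) (⌊⌋-no {d = L ≟ hd j} λ eq → ne (next-injective (private-place wi (sym eq))))) (∧-zeroʳ (X j)))
              (trans (cong (X i ∧_) (⌊⌋-yes {d = L ≟ L} refl)) (∧-identityʳ _))

          nl-private : ∀ {i} → w i ≡ nothing → nl i ≡ true
          nl-private {i} wi = tl≢hd⇒nl λ eq → next≢ i 2≤n (private-place wi (sym eq))

          -- An even chain containing one step out of a private vertex contains
          -- the whole run around it.
          no-private : ∀ {i} → X i ≡ true → w i ≢ nothing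
          no-private {i} Xi wi with long-runs wi
          ... | a , a≤i , i<a+g , a+g≤n , run =
            <⇒≱ short (injection≤sum (λ j → X j ∧ nl j) (λ t → fromℕ< (in-range t)) inj members)
            where
            in-range : ∀ (t : Fin g) → a + toℕ t < n
            in-range t = ≤-trans (+-monoʳ-< a (toℕ<n t)) a+g≤n
            a<n : a < n
            a<n = ≤-<-trans a≤i (toℕ<n i)
            constant : ∀ d (j : Fin n) → toℕ j ≡ a + d → d < g → X j ≡ X (fromℕ< a<n)
            constant zero j eq _ = cong X (toℕ-injective (trans eq (trans (+-identityʳ a) (sym (toℕ-fromℕ< a<n)))))
            constant (suc d) j eq lt = trans (cong X (sym next≡j))
              (trans (same-along-private j′ (trans (cong w next≡j) (run j (subst (a ≤_) (sym eq) (m≤m+n a _)) (subst (_< a + g) (sym eq) (+-monoʳ-< a lt)))))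
                     (constant d j′ (toℕ-fromℕ< a+d<n) (<⇒≤ lt)))
              where
              a+d<n : a + d < n
              a+d<n = ≤-trans (+-monoʳ-< a (<⇒≤ lt)) a+g≤n
              j′ : Fin n
              j′ = fromℕ< a+d<n
              next≡j : next j′ ≡ j
              next≡j with toℕ-next j′
              ... | inj₁ (_ , e) = toℕ-injective (trans e (trans (cong suc (toℕ-fromℕ< a+d<n)) (trans (sym (+-suc a d)) (sym eq))))
              ... | inj₂ (e , _) = contradiction (toℕ<n j) (<-irrefl (trans eq (trans (+-suc a d) (trans (cong suc (sym (toℕ-fromℕ< a+d<n))) e))))
            all-true : ∀ d (j : Fin n) → toℕ j ≡ a + d → d < g → X j ≡ true
            all-true d j eq lt = trans (constant d j eq lt)
              (trans (sym (constant (toℕ i ∸ a) i (sym (m+[n∸m]≡n a≤i)) (+-cancelˡ-< a _ _ (subst (_< a + g) (sym (m+[n∸m]≡n a≤i)) i<a+g)))) Xi)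
            inj : Injective _≡_ _≡_ (λ t → fromℕ< (in-range t))
            inj {t} {u} eq = toℕ-injective (+-cancelˡ-≡ a _ _
              (trans (sym (toℕ-fromℕ< (in-range t))) (trans (cong toℕ eq) (toℕ-fromℕ< (in-range u)))))
            members : ∀ t → X (fromℕ< (in-range t)) ∧ nl (fromℕ< (in-range t)) ≡ true
            members t = cong₂ _∧_ (all-true (toℕ t) _ (toℕ-fromℕ< (in-range t)) (toℕ<n t))
              (nl-private (run _ (subst (a ≤_) (sym (toℕ-fromℕ< (in-range t))) (m≤m+n a _))
                                 (subst (_< a + g) (sym (toℕ-fromℕ< (in-range t))) (+-monoʳ-< a (toℕ<n t)))))

          traversed : ∀ {i} → X i ≡ true → ∃ λ u → ∃ λ v → Traverses i u v
          traversed {i} Xi = go (w i) refl (w (next i)) refl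
            where
            go : ∀ x → w i ≡ x → ∀ y → w (next i) ≡ y → ∃ λ u → ∃ λ v → Traverses i u v
            go (just u) p (just v) q = u , v , p , q
            go nothing p _ _ = contradiction p (no-private Xi)
            go (just _) _ nothing q = contradiction q (no-private (trans (same-along-private i q) Xi))

          -- An edge of G remembers the time at which `X` traverses it, so that a cycle in `H` can
          -- be counted inside `X`.
          H : Fin m → Fin m → Set
          H u v = Σ (Fin n) λ i → X i ≡ true × (Traverses i u v ⊎ Traverses i v u) × u ≢ v

          H⇒adj : ∀ {u v} → H u v → adj G u v ≡ true
          H⇒adj (i , _ , inj₁ tr , ne) = along-edges tr ne
          H⇒adj {u} {v} (i , _ , inj₂ tr , ne) = trans (Graph.sym G u v) (along-edges tr (ne ∘ sym))

          places-differ : ∀ {i u v} → Traverses i u v → u ≢ v → tl i ≢ hd i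
          places-differ (p , q) ne eq = ne (↑ˡ-injective n _ _ (trans (sym (place-just p)) (trans eq (place-just q))))

          H⇒nl : ∀ {u v} (h : H u v) → nl (proj₁ h) ≡ true
          H⇒nl (i , _ , inj₁ tr , ne) = tl≢hd⇒nl (places-differ tr ne)
          H⇒nl (i , _ , inj₂ tr , ne) = tl≢hd⇒nl (places-differ tr (ne ∘ sym))

          once : ∀ {i j u v} → Traverses i u v ⊎ Traverses i v u → Traverses j u v ⊎ Traverses j v u → u ≢ v → i ≡ j
          once (inj₁ s) t ne = edges-once s t ne
          once (inj₂ s) t ne = edges-once s (swap t) (ne ∘ sym)

          incident : Fin m → Fin n → Bool
          incident v j = X j ∧ (δ tl hd (v ↑ˡ n) (tl j) xor δ tl hd (v ↑ˡ n) (hd j))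

          H⇒incident : ∀ {u v} (h : H u v) → incident v (proj₁ h) ≡ true
          H⇒incident {u} {v} (i , Xi , inj₁ (p , q) , ne) =
            cong₂ _∧_ Xi (true-xor (v ↑ˡ n ≟ tl i) (v ↑ˡ n ≟ hd i) (inj₂ ((λ e → ne (sym (↑ˡ-injective n _ _ (trans e (place-just p))))) , sym (place-just q))))
          H⇒incident {u} {v} (i , Xi , inj₂ (p , q) , ne) =
            cong₂ _∧_ Xi (true-xor (v ↑ˡ n ≟ tl i) (v ↑ˡ n ≟ hd i) (inj₁ (sym (place-just p) , λ e → ne (sym (↑ˡ-injective n _ _ (trans e (place-just q)))))))

          incident⇒H : ∀ v j → incident v j ≡ true → ∃ λ u → Σ (H v u) λ h → proj₁ h ≡ j
          incident⇒H v j eq with ∧-split {X j} eq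
          ... | Xj , e with traversed Xj
          ...   | x , y , p , q with xor-true (v ↑ˡ n ≟ tl j) (v ↑ˡ n ≟ hd j) e
          ...     | inj₁ (at-tl , not-hd) = y , (j , Xj , inj₁ (trans p (cong just (sym v≡x)) , q) , λ v≡y → not-hd (trans (cong (_↑ˡ n) v≡y) (sym (place-just q)))) , refl
            where v≡x = ↑ˡ-injective n _ _ (trans at-tl (place-just p))
          ...     | inj₂ (not-tl , at-hd) = x , (j , Xj , inj₂ (p , trans q (cong just (sym v≡y))) , λ v≡x → not-tl (trans (cong (_↑ˡ n) v≡x) (sym (place-just p)))) , refl
            where v≡y = ↑ˡ-injective n _ _ (trans at-hd (place-just q))

          -- Even degree at `v` supplies a second step of `X`. It cannot lead back to `u`, since the
          -- walk uses each edge only once.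
          continue : ∀ {u v} → H u v → ∃ λ v′ → v′ ≢ u × H v v′
          continue {u} {v} h with ⊕-second (incident v) (proj₁ h) (even (v ↑ˡ n)) (H⇒incident h)
          ... | j , j≢i , inc with incident⇒H v j inc
          ...   | v′ , h′ , refl = v′ , (λ eq → j≢i (sym (no-backtrack eq))) , h′
            where
            no-backtrack : v′ ≡ u → proj₁ h ≡ proj₁ h′
            no-backtrack refl = once (proj₁ (proj₂ (proj₂ h))) (swap (proj₁ (proj₂ (proj₂ h′)))) (proj₂ (proj₂ (proj₂ h)))

          HCycle : Set
          HCycle = ∃ λ ℓ → 3 ≤ ℓ × Σ (Fin ℓ → Fin m) λ vert → Injective _≡_ _≡_ vert × (∀ t → H (vert t) (vert (next t)))

          -- The steps of a cycle of `H` are distinct non-loops of `X`, so the cycle would be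
          -- shorter than the girth allows.
          no-H : ∀ {u v} → ¬ H u v
          no-H {u} {v} h = no-cycle (cycle H (proj₂ ∘ proj₂ ∘ proj₂) continue (u , v , h))
            where
            no-cycle : ¬ HCycle
            no-cycle (ℓ , 3≤ℓ , vert , vert-inj , vert-H) = girth ℓ (≤-<-trans (injection≤sum (λ j → X j ∧ nl j) step step-inj step-true) short)
                (record { len≥3 = 3≤ℓ ; vert = vert ; inj = vert-inj ; edges = λ t → H⇒adj (vert-H t) })
              where
              step : Fin ℓ → Fin n
              step t = proj₁ (vert-H t)
              step-true : ∀ t → X (step t) ∧ nl (step t) ≡ true
              step-true t = cong₂ _∧_ (proj₁ (proj₂ (vert-H t))) (H⇒nl (vert-H t))
              ends : ∀ {i u v x y} → Traverses i u v ⊎ Traverses i v u → Traverses i x y ⊎ Traverses i y x →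
                     (u ≡ x × v ≡ y) ⊎ (u ≡ y × v ≡ x)
              ends (inj₁ (p , q)) (inj₁ (p′ , q′)) = inj₁ (just-injective (trans (sym p) p′) , just-injective (trans (sym q) q′))
              ends (inj₁ (p , q)) (inj₂ (p′ , q′)) = inj₂ (just-injective (trans (sym p) p′) , just-injective (trans (sym q) q′))
              ends (inj₂ (p , q)) (inj₁ (p′ , q′)) = inj₂ (just-injective (trans (sym q) q′) , just-injective (trans (sym p) p′))
              ends (inj₂ (p , q)) (inj₂ (p′ , q′)) = inj₁ (just-injective (trans (sym q) q′) , just-injective (trans (sym p) p′))
              step-inj : Injective _≡_ _≡_ step
              step-inj {t} {u} eq with ends (subst (λ i → Traverses i _ _ ⊎ Traverses i _ _) eq (proj₁ (proj₂ (proj₂ (vert-H t))))) (proj₁ (proj₂ (proj₂ (vert-H u))))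
              ... | inj₁ (e , _) = vert-inj e
              -- One step used in both directions would close the cycle after two edges.
              ... | inj₂ (e , e′) = contradiction (trans (cong next (sym (vert-inj e))) (vert-inj e′)) (next-next≢ u 3≤ℓ)

        short-even-trivial : weight tl hd X ≡ 0
        short-even-trivial with any? (λ j → (X j ∧ nl j) ≟B true)
        ... | no none = sum-zero (λ j → [ X j ∧ nl j ]) λ j → cong [_] (¬-not λ e → none (j , e))
        ... | yes (j , e) with ∧-split {X j} e
        ...   | Xj , nlj with traversed Xj
        ...     | u , v , tr with u ≟ v
        ...       | no ne = contradiction (j , Xj , inj₁ tr , ne) no-H
        ...       | yes refl = contradiction (trans (sym nlj) (cong not (⌊⌋-yes {d = tl j ≟ hd j} (trans (place-just (proj₁ tr)) (sym (place-just (proj₂ tr))))))) λ ()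

      shortEvenTrivial : ShortEvenTrivial place g
      shortEvenTrivial X even short = short-even-trivial X even short

-- Counting with duplicate-free lists

module UniqueLists where
  open import Data.Nat using (_≤_)
  open import Data.Fin using (Fin; zero; suc)
  open import Data.Fin.Properties using (injective⇒≤)
  open import Data.List using (List; []; _∷_; length; lookup; map; concatMap; cartesianProduct; _++_; allFin)
  open import Data.List.Properties using (length-tabulate)
  open import Data.List.Relation.Unary.All as All using (All)
  open import Data.List.Relation.Unary.Any using (index)
  open import Data.List.Relation.Unary.Any.Properties using (lookup-index)
  open import Data.List.Relation.Unary.AllPairs using ([]; _∷_)
  open import Data.List.Relation.Unary.Unique.Propositional using (Unique)
  open import Data.List.Membership.Propositional using (_∈_)
  open import Data.List.Membership.Propositional.Properties using (∈-lookup; ∈-allFin)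
  open import Data.List.Relation.Binary.Subset.Propositional using (_⊆_)
  open import Relation.Nullary using (contradiction)
  open import Relation.Binary.PropositionalEquality
  open import Data.Product using (_,_)

  lookup-injective : ∀ {A : Set} {xs : List A} → Unique xs → ∀ {i j} → lookup xs i ≡ lookup xs j → i ≡ j
  lookup-injective (_ ∷ _) {zero} {zero} _ = refl
  lookup-injective (px ∷ _) {zero} {suc j} eq = contradiction eq (All.lookup px (∈-lookup j))
  lookup-injective (px ∷ _) {suc i} {zero} eq = contradiction (sym eq) (All.lookup px (∈-lookup i))
  lookup-injective (_ ∷ u) {suc i} {suc j} eq = cong suc (lookup-injective u eq)

  unique-⊆-length : ∀ {A : Set} {xs ys : List A} → Unique xs → xs ⊆ ys → length xs ≤ length ys
  unique-⊆-length {xs = xs} {ys} u sub = injective⇒≤ {f = pos} λ {i} {j} eq → lookup-injective u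
      (trans (lookup-index (sub (∈-lookup i))) (trans (cong (lookup ys) eq) (sym (lookup-index (sub (∈-lookup j))))))
    where
    pos : Fin (length xs) → Fin (length ys)
    pos i = index (sub (∈-lookup i))

  unique-Fin-length : ∀ {m} {xs : List (Fin m)} → Unique xs → length xs ≤ m
  unique-Fin-length {m} {xs} u = subst (length xs ≤_) (length-tabulate {n = m} λ i → i) (unique-⊆-length u λ {x} _ → ∈-allFin x)

  -- Turns the enumeration of pairs inside `numEdges` into a form whose membership and uniqueness
  -- are known.
  concatMap-pairs : ∀ {A B : Set} (xs : List A) (ys : List B) → concatMap (λ x → map (x ,_) ys) xs ≡ cartesianProduct xs ys
  concatMap-pairs [] ys = refl
  concatMap-pairs (x ∷ xs) ys = cong (map (x ,_) ys ++_) (concatMap-pairs xs ys)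

-- Covering the edges of a graph by trails joined by excursions

module TrailDecomposition where
  open import Data.Nat hiding (_≟_)
  open import Data.Nat.Properties hiding (_≟_)
  open import Data.Fin as Fin using (Fin; zero; suc; toℕ)
  open import Data.Fin.Properties using (_≟_)
  open import Data.Maybe using (Maybe; just; nothing)
  open import Data.List using (List; []; _∷_; length; _++_; replicate; map)
  open import Data.List.Properties using (length-++; length-replicate; ++-identityʳ)
  open import Data.Nat.ListAction using (sum)
  open import Data.List.Relation.Unary.All as All using (All; []; _∷_)
  open import Data.List.Relation.Unary.Any as Any using (here; there)
  open import Data.List.Relation.Unary.AllPairs using ([]; _∷_)
  open import Data.List.Relation.Unary.Unique.Propositional using (Unique)
  open import Data.List.Membership.Propositional using (_∈_; _∉_; find)
  open import Data.List.Membership.Propositional.Properties using (∈-∃++)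
  open import Data.List.Relation.Binary.Permutation.Propositional using (_↭_; ↭-refl; ↭-sym; ↭⇒↭ₛ)
  open import Data.List.Relation.Binary.Permutation.Propositional.Properties using (shift; ∈-resp-↭; ↭-length; All-resp-↭)
  import Data.List.Relation.Binary.Permutation.Setoid.Properties as SetoidPerm
  open import Data.Product using (∃; _×_; _,_; proj₁; proj₂)
  open import Data.Sum using (_⊎_; inj₁; inj₂; swap)
  open import Relation.Nullary using (yes; no; ¬_; contradiction; Dec)
  open import Relation.Nullary.Decidable using (_⊎-dec_)
  open import Relation.Binary.PropositionalEquality hiding ([_])
  open UniqueLists

  Unique-resp-↭ : ∀ {A : Set} {xs ys : List A} → xs ↭ ys → Unique xs → Unique ys
  Unique-resp-↭ {A} p = SetoidPerm.Unique-resp-↭ (setoid A) (↭⇒↭ₛ p)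

  -- Reading past the end gives `nothing`, so `Trav` fails there without any bound on the index.
  at : ∀ {A : Set} → List (Maybe A) → ℕ → Maybe A
  at [] _ = nothing
  at (x ∷ xs) zero = x
  at (x ∷ xs) (suc i) = at xs i

  isNothing : ∀ {A : Set} → Maybe A → ℕ
  isNothing nothing = 1
  isNothing (just _) = 0

  Trav : ∀ {A : Set} → List (Maybe A) → ℕ → A → A → Set
  Trav zs i u v = at zs i ≡ just u × at zs (suc i) ≡ just v

  RunAt : ∀ {A : Set} → ℕ → List (Maybe A) → ℕ → Set
  RunAt N ys i = ∃ λ a → a ≤ i × i < a + N × a + N ≤ length ys × (∀ j → a ≤ j → j < a + N → at ys j ≡ nothing)

  RunAt-∷ : ∀ {A : Set} {N ys i} {x : Maybe A} → RunAt N ys i → RunAt N (x ∷ ys) (suc i)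
  RunAt-∷ {N = N} {ys} {x = x} (a , a≤i , i<a+N , a+N≤ , run) = suc a , s≤s a≤i , s≤s i<a+N , s≤s a+N≤ , run′
    where
    run′ : ∀ j → suc a ≤ j → j < suc a + N → at (x ∷ ys) j ≡ nothing
    run′ (suc j) (s≤s p) (s≤s q) = run j p q

  RunAt-++ : ∀ {A : Set} {N ys i} (xs : List (Maybe A)) → RunAt N ys i → RunAt N (xs ++ ys) (length xs + i)
  RunAt-++ [] r = r
  RunAt-++ (x ∷ xs) r = RunAt-∷ (RunAt-++ xs r)

  at-replicate : ∀ {A : Set} N {zs : List (Maybe A)} j → j < N → at (replicate N nothing ++ zs) j ≡ nothing
  at-replicate (suc N) zero _ = refl
  at-replicate (suc N) (suc j) (s≤s lt) = at-replicate N j lt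

  RunAt-replicate : ∀ {A : Set} N {zs : List (Maybe A)} {i} → i < N → RunAt N (replicate N nothing ++ zs) i
  RunAt-replicate N {zs} lt = 0 , z≤n , lt , ≤-trans (m≤m+n N (length zs)) (≤-reflexive (sym len)) , λ j _ → at-replicate N j
    where
    len : length (replicate N nothing ++ zs) ≡ N + length zs
    len = trans (length-++ (replicate N nothing)) (cong (_+ length zs) (length-replicate N))

  past-replicate : ∀ {A : Set} N {zs : List (Maybe A)} {i v} → at (replicate N nothing ++ zs) i ≡ just v → ∃ λ i′ → i ≡ N + i′
  past-replicate zero {i = i} _ = i , refl
  past-replicate (suc N) {i = suc i} eq with past-replicate N eq
  ... | i′ , refl = i′ , refl

  at-past-replicate : ∀ {A : Set} N {zs : List (Maybe A)} i → at (replicate N nothing ++ zs) (N + i) ≡ at zs i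
  at-past-replicate zero i = refl
  at-past-replicate (suc N) i = at-past-replicate N i

  module _ {m : ℕ} where

    Edge : Set
    Edge = Fin m × Fin m

    Ends : Edge → Fin m → Fin m → Set
    Ends e u v = e ≡ (u , v) ⊎ e ≡ (v , u)

    Oriented : Edge → Set
    Oriented (u , v) = toℕ u < toℕ v

    Incident : Fin m → Edge → Set
    Incident v e = proj₁ e ≡ v ⊎ proj₂ e ≡ v

    incident? : ∀ v e → Dec (Incident v e)
    incident? v e = (proj₁ e ≟ v) ⊎-dec (proj₂ e ≟ v)

    -- `Oriented` admits one of the two orders of an edge, so the unordered pair of ends determines
    -- it.
    Ends-unique : ∀ {e e′ u v} → Oriented e → Oriented e′ → Ends e u v → Ends e′ u v → e ≡ e′
    Ends-unique _ _ (inj₁ refl) (inj₁ refl) = refl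
    Ends-unique o o′ (inj₁ refl) (inj₂ refl) = contradiction o′ (<-asym o)
    Ends-unique o o′ (inj₂ refl) (inj₁ refl) = contradiction o′ (<-asym o)
    Ends-unique _ _ (inj₂ refl) (inj₂ refl) = refl

    -- Walk rem J c ys: from vertex c, ys traverses each edge of rem once, with J
    -- excursions of N = suc N₁ private vertices each, the last one at the end.
    module _ (N₁ : ℕ) where

      private
        N : ℕ
        N = suc N₁

      data Walk : List Edge → ℕ → Fin m → List (Maybe (Fin m)) → Set where
        stop : ∀ {c} → Walk [] 1 c (replicate N nothing)
        move : ∀ {rem rem′ e J c u ys} → rem ↭ e ∷ rem′ → Ends e c u → Walk rem′ J u ys → Walk rem J c (just u ∷ ys)
        jump : ∀ {rem J c a ys} → Walk rem J a ys → Walk rem (suc J) c (replicate N nothing ++ just a ∷ ys)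

      -- When the walk is stuck at c, no remaining edge is incident to c and c is
      -- never visited again: the excursions are at most as many as the vertices.
      walk : ∀ L rem → length rem ≡ L → ∀ c dead → Unique dead → (∀ {v e} → v ∈ dead → e ∈ rem → ¬ Incident v e) →
             c ∉ dead → ∃ λ J → ∃ λ ys → Walk rem J c ys × J + length dead ≤ m
      walk L rem len c dead uniq isDead c∉ with Any.any? (incident? c) rem
      walk (suc L) rem len c dead uniq isDead c∉ | yes any with find any
      ... | e , e∈ , inc with ∈-∃++ e∈
      ...   | as , bs , refl = go inc
        where
        p : as ++ e ∷ bs ↭ e ∷ (as ++ bs)
        p = shift e as bs
        len′ : length (as ++ bs) ≡ L
        len′ = cong pred (trans (sym (↭-length p)) len)
        continue : ∀ u → Ends e c u → Incident u e → ∃ λ J → ∃ λ ys → Walk (as ++ e ∷ bs) J c ys × J + length dead ≤ m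
        continue u ends incu with walk L (as ++ bs) len′ u dead uniq (λ v∈ f∈ → isDead v∈ (∈-resp-↭ (↭-sym p) (there f∈))) (λ u∈ → isDead u∈ e∈ incu)
        ... | J , ys , W , le = J , just u ∷ ys , move p ends W , le
        go : Incident c e → ∃ λ J → ∃ λ ys → Walk (as ++ e ∷ bs) J c ys × J + length dead ≤ m
        go (inj₁ refl) = continue (proj₂ e) (inj₁ refl) (inj₂ refl)
        go (inj₂ refl) = continue (proj₁ e) (inj₂ refl) (inj₁ refl)
      walk zero [] len c dead uniq isDead c∉ | yes ()
      walk L [] len c dead uniq isDead c∉ | no _ =
        1 , replicate N nothing , stop , unique-Fin-length (All.tabulate (λ {v} v∈ eq → c∉ (subst (_∈ dead) (sym eq) v∈)) ∷ uniq)
      -- The jump lands on `a` and the edge to `b` is taken at once, so the number of remaining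
      -- edges drops here too. `b` is not dead because dead vertices meet no remaining edge, and
      -- each new jump is matched by the new dead vertex `c`.
      walk (suc L) ((a , b) ∷ rem) len c dead uniq isDead c∉ | no stuck
        with walk L rem (cong pred len) b (c ∷ dead) (All.tabulate (λ {v} v∈ eq → c∉ (subst (_∈ dead) (sym eq) v∈)) ∷ uniq)
                  (λ { (here refl) e∈ inc → stuck (there (Any.map (λ { refl → inc }) e∈)) ; (there v∈) e∈ → isDead v∈ (there e∈) })
                  (λ { (here refl) → stuck (here (inj₂ refl)) ; (there b∈) → isDead b∈ (here refl) (inj₂ refl) })
      ... | J , ys , W , le = suc J , _ , jump (move ↭-refl (inj₁ refl) W) , subst (_≤ m) (+-suc J (length dead)) le

      -- The offset `suc N` counts the current vertex and the excursion. No traversal has an end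
      -- inside the excursion, and `N` is positive, so none skips over it.
      trav-past-jump : ∀ {c : Fin m} {zs i u v} → Trav (just c ∷ replicate N nothing ++ zs) i u v → ∃ λ i′ → i ≡ suc N + i′ × Trav zs i′ u v
      trav-past-jump {zs = zs} {i} (p , q) with past-replicate N {i = i} q
      ... | zero , refl = contradiction (trans (sym (at-replicate N {zs} (N₁ + 0) (s≤s (≤-reflexive (+-identityʳ N₁))))) p) λ ()
      ... | suc i′ , refl = i′ , cong suc (+-suc N₁ i′) ,
            trans (sym (at-past-replicate N i′)) (trans (cong (at (replicate N nothing ++ zs)) (sym (+-suc N₁ i′))) p) ,
            trans (sym (at-past-replicate N (suc i′))) q

      walk-edge : ∀ {rem J c ys} → Walk rem J c ys → ∀ {i u v} → Trav (just c ∷ ys) i u v → ∃ λ e → e ∈ rem × Ends e u v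
      walk-edge {c = c} stop {i} (p , q) = contradiction (trans (sym q) (trans (cong (λ zs → at (just c ∷ zs) (suc i)) (sym (++-identityʳ (replicate N nothing)))) (none i))) λ ()
        where
        none : ∀ i → at (replicate N nothing ++ []) i ≡ nothing {A = Fin m}
        none i with i <? N
        ... | yes lt = at-replicate N i lt
        ... | no ≮ = trans (cong (at (replicate N nothing ++ [])) (sym (m+[n∸m]≡n (≮⇒≥ ≮)))) (at-past-replicate N (i ∸ N))
      walk-edge (move {e = e} perm ends W) {zero} (refl , refl) = e , ∈-resp-↭ (↭-sym perm) (here refl) , ends
      walk-edge (move perm ends W) {suc i} tr with walk-edge W tr
      ... | e , e∈ , en = e , ∈-resp-↭ (↭-sym perm) (there e∈) , en
      walk-edge (jump W) {i} tr with trav-past-jump {i = i} tr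
      ... | i′ , _ , tr′ = walk-edge W tr′

      -- `move` takes its edge off a duplicate-free list, and by `walk-edge` later traversals use
      -- only edges still on the list.
      walk-once : ∀ {rem J c ys} → Walk rem J c ys → Unique rem → All Oriented rem →
                  ∀ {i j u v} → Trav (just c ∷ ys) i u v → Trav (just c ∷ ys) j u v ⊎ Trav (just c ∷ ys) j v u → i ≡ j
      walk-once W@stop _ _ {i} tr _ = contradiction (proj₁ (proj₂ (walk-edge W {i} tr))) λ ()
      walk-once (move {rem′ = rem′} {e = e} {c = c} {u = x} {ys = ys} perm ends W) uniq orient = go _ _
        where
        fresh : Unique (e ∷ rem′)
        fresh = Unique-resp-↭ perm uniq
        orient′ : All Oriented (e ∷ rem′)
        orient′ = All-resp-↭ perm orient
        not-again : ∀ {j} → ¬ (Trav (just x ∷ ys) j c x ⊎ Trav (just x ∷ ys) j x c)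
        not-again tr with fresh | orient′ | tr
        ... | e∉ ∷ _ | o ∷ os | inj₁ t with walk-edge W t
        ...   | e′ , e′∈ , en = All.lookup e∉ e′∈ (Ends-unique o (All.lookup os e′∈) ends en)
        not-again tr | e∉ ∷ _ | o ∷ os | inj₂ t with walk-edge W t
        ...   | e′ , e′∈ , en = All.lookup e∉ e′∈ (Ends-unique o (All.lookup os e′∈) ends (swap en))
        go : ∀ i j {u v} → Trav (just c ∷ just x ∷ ys) i u v →
             Trav (just c ∷ just x ∷ ys) j u v ⊎ Trav (just c ∷ just x ∷ ys) j v u → i ≡ j
        go zero zero _ _ = refl
        go zero (suc j) (refl , refl) tr = contradiction tr (not-again {j})
        go (suc i) zero tr (inj₁ (refl , refl)) = contradiction (inj₁ tr) (not-again {i})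
        go (suc i) zero tr (inj₂ (refl , refl)) = contradiction (inj₂ tr) (not-again {i})
        go (suc i) (suc j) tr tr′ = cong suc (walk-once W (tail-unique fresh) (All.tail orient′) tr tr′)
          where
          tail-unique : ∀ {x xs} → Unique {A = Edge} (x ∷ xs) → Unique xs
          tail-unique (_ ∷ u) = u
      walk-once (jump {c = c} {a = a} {ys = ys} W) uniq orient {i} {j} tr tr′ with trav-past-jump {i = i} tr | past tr′
        where
        past : ∀ {u v} → Trav (just c ∷ replicate N nothing ++ just a ∷ ys) j u v ⊎ Trav (just c ∷ replicate N nothing ++ just a ∷ ys) j v u →
               ∃ λ j′ → j ≡ suc N + j′ × (Trav (just a ∷ ys) j′ u v ⊎ Trav (just a ∷ ys) j′ v u)
        past (inj₁ t) with trav-past-jump {i = j} t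
        ... | j′ , eq , t′ = j′ , eq , inj₁ t′
        past (inj₂ t) with trav-past-jump {i = j} t
        ... | j′ , eq , t′ = j′ , eq , inj₂ t′
      ... | i′ , refl , t | j′ , refl , t′ = cong (suc N +_) (walk-once W uniq orient t t′)

      walk-runs : ∀ {rem J c ys} → Walk rem J c ys → ∀ {i} → i < length ys → at ys i ≡ nothing → RunAt N ys i
      walk-runs stop {i} lt _ = subst (λ zs → RunAt N zs i) (++-identityʳ (replicate N nothing))
                                  (RunAt-replicate N (subst (i <_) (length-replicate N) lt))
      walk-runs (move _ _ W) {suc i} (s≤s lt) eq = RunAt-∷ (walk-runs W lt eq)
      walk-runs (jump {a = a} {ys = ys} W) {i} lt eq with i <? N
      ... | yes i<N = RunAt-replicate N i<N
      ... | no i≮N = split (i ∸ N) (m+[n∸m]≡n (≮⇒≥ i≮N))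
        where
        pre : List (Maybe (Fin m))
        pre = replicate N nothing
        len : length (pre ++ just a ∷ ys) ≡ N + suc (length ys)
        len = trans (length-++ pre) (cong (_+ suc (length ys)) (length-replicate N))
        split : ∀ d → N + d ≡ i → RunAt N (pre ++ just a ∷ ys) i
        split d e with trans (sym (at-past-replicate N {just a ∷ ys} d)) (trans (cong (at (pre ++ just a ∷ ys)) e) eq)
        split (suc d) e | at≡ = subst (RunAt N (pre ++ just a ∷ ys)) (trans (cong (_+ suc d) (length-replicate N)) e)
          (RunAt-++ pre (RunAt-∷ (walk-runs W (s<s⁻¹ (+-cancelˡ-< N _ _ (subst₂ _<_ (sym e) len lt))) at≡)))

      walk-nothings : ∀ {rem J c ys} → Walk rem J c ys → sum (map isNothing ys) ≡ J * N
      walk-nothings stop = trans (nothings N) (sym (+-identityʳ N))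
        where
        nothings : ∀ k → sum (map isNothing (replicate k (nothing {A = Fin m}))) ≡ k
        nothings zero = refl
        nothings (suc k) = cong suc (nothings k)
      walk-nothings (move _ _ W) = walk-nothings W
      walk-nothings (jump {a = a} {ys = ys} W) = trans (nothings N) (cong (N +_) (walk-nothings W))
        where
        nothings : ∀ k → sum (map isNothing (replicate k nothing ++ just a ∷ ys)) ≡ k + sum (map isNothing ys)
        nothings zero = refl
        nothings (suc k) = cong suc (nothings k)

      -- Besides its `N` private vertices, each excursion accounts for one more visit: the landing
      -- vertex, or the start of the walk in the case of the last excursion.
      walk-length : ∀ {rem J c ys} → Walk rem J c ys → suc (length ys) ≡ length rem + J * suc N
      walk-length stop = trans (cong suc (length-replicate N)) (sym (+-identityʳ (suc N)))
      walk-length (move perm _ W) = trans (cong suc (walk-length W)) (cong (_+ _) (sym (↭-length perm)))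
      walk-length (jump {rem = rem} {J = J} {a = a} {ys = ys} W) = begin
        suc (length (replicate N nothing ++ just a ∷ ys))   ≡⟨ cong suc (length-++ (replicate N nothing)) ⟩
        suc (length (replicate N (nothing {A = Fin m})) + suc (length ys))    ≡⟨ cong₂ (λ a b → suc (a + b)) (length-replicate N) (walk-length W) ⟩
        suc N + (length rem + J * suc N)                    ≡⟨ +-assoc (suc N) (length rem) _ ⟨
        suc N + length rem + J * suc N                      ≡⟨ cong (_+ J * suc N) (+-comm (suc N) (length rem)) ⟩
        length rem + suc N + J * suc N                      ≡⟨ +-assoc (length rem) (suc N) _ ⟩
        length rem + (suc N + J * suc N)                    ∎
        where open ≡-Reasoning

      -- Since the walk ends with an excursion, the step that closes it up leaves a private vertex
      -- and traverses no edge.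
      walk-last : ∀ {rem J c ys} → Walk rem J c ys → at (just c ∷ ys) (length ys) ≡ nothing
      walk-last {c = c} stop = trans (cong (at (replicate N nothing)) (length-replicate N₁)) (all-nothing N₁)
        where
        all-nothing : ∀ k → at (replicate (suc k) (nothing {A = Fin m})) k ≡ nothing
        all-nothing zero = refl
        all-nothing (suc k) = all-nothing k
      walk-last (move _ _ W) = walk-last W
      walk-last (jump {c = c} {a = a} {ys = ys} W) = trans (cong (at (just c ∷ pre ++ just a ∷ ys)) len)
          (trans (at-past-replicate N (length ys)) (walk-last W))
        where
        pre : List (Maybe (Fin m))
        pre = replicate N nothing
        len : length (pre ++ just a ∷ ys) ≡ suc (N + length ys)
        len = trans (length-++ pre) (trans (cong (_+ suc (length ys)) (length-replicate N)) (+-suc N (length ys)))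

-- The list of edges of a graph

module EdgeLists where
  open import Data.Nat using (ℕ; _<_; _<?_)
  open import Data.Fin using (Fin; toℕ)
  open import Data.Bool using (Bool; true)
  open import Data.Bool.Properties using () renaming (_≟_ to _≟B_)
  open import Data.List using (List; length; filter; concatMap; map)
  open import Data.List.Relation.Unary.All as All using (All)
  open import Data.List.Relation.Unary.Unique.Propositional using (Unique)
  import Data.List.Relation.Unary.Unique.Propositional.Properties as Unique
  open import Data.List.Membership.Propositional using (_∈_)
  open import Data.List.Membership.Propositional.Properties using (∈-filter⁻; ∈-filter⁺; ∈-allFin; ∈-cartesianProduct⁺)
  open import Data.Product using (_×_; _,_; proj₁; proj₂)
  open import Relation.Nullary using (Dec)
  open import Relation.Nullary.Decidable using (_×-dec_)
  open import Relation.Binary.PropositionalEquality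
  open import Defs hiding (sym)
  open UniqueLists
  open TrailDecomposition using (Oriented)

  module _ {m : ℕ} (G : Graph m) where

    IsEdge : Fin m × Fin m → Set
    IsEdge ij = toℕ (proj₁ ij) < toℕ (proj₂ ij) × adj G (proj₁ ij) (proj₂ ij) ≡ true

    isEdge? : ∀ ij → Dec (IsEdge ij)
    isEdge? ij = (toℕ (proj₁ ij) <? toℕ (proj₂ ij)) ×-dec (adj G (proj₁ ij) (proj₂ ij) ≟B true)

    -- Spelled so that `length edgeList` is `numEdges G` by computation.
    pairs edgeList : List (Fin m × Fin m)
    pairs = concatMap (λ i → map (i ,_) (allFin m)) (allFin m)
    edgeList = filter isEdge? pairs

    edgeList-unique : Unique edgeList
    edgeList-unique = Unique.filter⁺ isEdge? (subst Unique (sym (concatMap-pairs (allFin m) (allFin m)))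
      (Unique.cartesianProduct⁺ (Unique.allFin⁺ m) (Unique.allFin⁺ m)))

    ∈-edgeList⁻ : ∀ {e} → e ∈ edgeList → IsEdge e
    ∈-edgeList⁻ e∈ = proj₂ (∈-filter⁻ isEdge? {xs = pairs} e∈)

    ∈-edgeList⁺ : ∀ {e} → IsEdge e → e ∈ edgeList
    ∈-edgeList⁺ {u , v} ie = ∈-filter⁺ isEdge? (subst ((u , v) ∈_) (sym (concatMap-pairs (allFin m) (allFin m)))
      (∈-cartesianProduct⁺ (∈-allFin u) (∈-allFin v))) ie

    edgeList-oriented : All Oriented edgeList
    edgeList-oriented = All.tabulate λ e∈ → proj₁ (∈-edgeList⁻ e∈)

-- Closed walks of a prescribed length

module ClosedTrails where
  open import Data.Nat hiding (_≟_)
  open import Data.Nat.Properties hiding (_≟_)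
  open import Data.Fin as Fin using (Fin; zero; suc; toℕ; fromℕ<; _↑ˡ_)
  open import Data.Fin.Properties using (_≟_; toℕ<n; toℕ-injective; toℕ-fromℕ<; ↑ˡ-injective)
  open import Data.Bool using (Bool; true; not)
  open import Data.Maybe using (Maybe; just; nothing)
  open import Data.Maybe.Properties using (just-injective)
  open import Data.List using (List; []; _∷_; length; _++_; replicate; map)
  open import Data.List.Properties using (length-++; length-replicate)
  open import Data.Nat.ListAction using () renaming (sum to sumL)
  open import Data.List.Relation.Unary.All as All using (All)
  open import Data.List.Relation.Unary.Unique.Propositional using (Unique)
  open import Data.List.Relation.Unary.AllPairs using ([])
  open import Data.List.Membership.Propositional using (_∈_)
  open import Data.Product using (∃; _×_; _,_; proj₁; proj₂)
  open import Data.Sum using (_⊎_; inj₁; inj₂)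
  open import Relation.Nullary using (¬_; contradiction)
  open import Relation.Binary.PropositionalEquality hiding ([_])
  open import Function using (_∘_; Injective)
  open import Defs hiding (sym; inj)
  open FiniteSums
  open Chains
  open ClosedWalks
  open GraphWalks
  open TrailDecomposition
  open EdgeLists

  sum-at : ∀ {A : Set} (f : Maybe A → ℕ) (xs : List (Maybe A)) {n} → length xs ≡ n →
           ℕΣ.sum (λ (i : Fin n) → f (at xs (toℕ i))) ≡ sumL (map f xs)
  sum-at f [] refl = refl
  sum-at f (x ∷ xs) refl = cong (f x +_) (sum-at f xs refl)

  module _ {m : ℕ} (c : Fin m) (ys : List (Maybe (Fin m))) where

    -- Idling at the start vertex brings the walk to exactly the required number of cities. The idle
    -- steps are loops, hence free.
    padded : ℕ → List (Maybe (Fin m))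
    padded p = replicate p (just c) ++ just c ∷ ys

    length-padded : ∀ p → length (padded p) ≡ p + suc (length ys)
    length-padded p = trans (length-++ (replicate p (just c))) (cong (_+ suc (length ys)) (length-replicate p))

    at-padded : ∀ p i → at (padded p) (p + i) ≡ at (just c ∷ ys) i
    at-padded zero i = refl
    at-padded (suc p) i = at-padded p i

    at-padded-zero : ∀ p → at (padded p) 0 ≡ just c
    at-padded-zero zero = refl
    at-padded-zero (suc p) = refl

    trav-padded : ∀ p {i u v} → Trav (padded p) i u v → u ≢ v → ∃ λ i′ → i ≡ p + i′ × Trav (just c ∷ ys) i′ u v
    trav-padded zero {i} tr _ = i , refl , tr
    trav-padded (suc p) {zero} (e , e′) ne = contradiction (just-injective (trans (sym e) (trans (sym (at-padded-zero p)) e′))) ne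
    trav-padded (suc p) {suc i} tr ne with trav-padded p {i} tr ne
    ... | i′ , refl , tr′ = i′ , refl , tr′

    runs-padded : ∀ {N} → (∀ {i} → i < length ys → at ys i ≡ nothing → RunAt N ys i) →
                  ∀ p {i} → i < length (padded p) → at (padded p) i ≡ nothing → RunAt N (padded p) i
    runs-padded runs zero {suc i} (s≤s lt) eq = RunAt-∷ (runs lt eq)
    runs-padded runs (suc p) {suc i} (s≤s lt) eq = RunAt-∷ (runs-padded runs p lt eq)

    nothings-padded : ∀ p → sumL (map isNothing (padded p)) ≡ sumL (map isNothing ys)
    nothings-padded zero = refl
    nothings-padded (suc p) = nothings-padded p

  record ClosedTrail {m : ℕ} (G : Graph m) (g n : ℕ) : Set where
    field
      w : Fin n → Maybe (Fin m)
      along-edges : ∀ {i u v} → Traverses w i u v → u ≢ v → adj G u v ≡ true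
      edges-once : ∀ {i j u v} → Traverses w i u v → Traverses w j u v ⊎ Traverses w j v u → u ≢ v → i ≡ j
      long-runs : ∀ {i} → w i ≡ nothing → InRun w g i
      covers : numEdges G ≤ steps (place w)
      few-private : ℕΣ.sum (λ i → isNothing (w i)) ≤ m * g

  closedTrail : ∀ {m} (G : Graph m) N₁ n → Fin m → 2 ≤ n → numEdges G + m * suc (suc N₁) ≤ n → ClosedTrail G (suc N₁) n
  closedTrail {m} G N₁ n c 2≤n large with walk N₁ (numEdges G) (edgeList G) refl c [] [] (λ ()) (λ ())
  ... | J , ys , W , J+0≤m = record
    { w = w ; along-edges = along-edges ; edges-once = edges-once ; long-runs = long-runs
    ; covers = covers ; few-private = few-private }
    where
    N : ℕ
    N = suc N₁
    J≤m : J ≤ m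
    J≤m = subst (_≤ m) (+-identityʳ J) J+0≤m
    size≤n : suc (length ys) ≤ n
    size≤n = ≤-trans (≤-reflexive (walk-length N₁ W)) (≤-trans (+-monoʳ-≤ (numEdges G) (*-monoˡ-≤ (suc N) J≤m)) large)
    p : ℕ
    p = n ∸ suc (length ys)
    p+size≡n : p + suc (length ys) ≡ n
    p+size≡n = m∸n+n≡m size≤n
    zs full : List (Maybe (Fin m))
    zs = just c ∷ ys
    full = padded c ys p
    length-full : length full ≡ n
    length-full = trans (length-padded c ys p) p+size≡n
    w : Fin n → Maybe (Fin m)
    w i = at full (toℕ i)
    last-nothing : ∀ i → suc i ≡ n → at full i ≡ nothing
    last-nothing i eq = trans (cong (at full) i≡) (trans (at-padded c ys p (length ys)) (walk-last N₁ W))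
      where
      i≡ : i ≡ p + length ys
      i≡ = cong pred (trans eq (trans (sym p+size≡n) (+-suc p (length ys))))
    trav : ∀ {i u v} → Traverses w i u v → Trav full (toℕ i) u v
    trav {i} (a , b) with toℕ-next i
    ... | inj₁ (_ , e) = a , trans (cong (at full) (sym e)) b
    ... | inj₂ (e , _) = contradiction (trans (sym (last-nothing (toℕ i) e)) a) λ ()
    along-edges : ∀ {i u v} → Traverses w i u v → u ≢ v → adj G u v ≡ true
    along-edges {i} tr ne with trav-padded c ys p {toℕ i} (trav tr) ne
    ... | i′ , _ , tr′ with walk-edge N₁ W {i′} tr′
    ...   | _ , e∈ , inj₁ refl = proj₂ (∈-edgeList⁻ G e∈)
    ...   | _ , e∈ , inj₂ refl = trans (Graph.sym G _ _) (proj₂ (∈-edgeList⁻ G e∈))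
    edges-once : ∀ {i j u v} → Traverses w i u v → Traverses w j u v ⊎ Traverses w j v u → u ≢ v → i ≡ j
    edges-once {i} {j} {u} {v} tr tr′ ne with trav-padded c ys p {toℕ i} (trav tr) ne | past tr′
      where
      past : Traverses w j u v ⊎ Traverses w j v u → ∃ λ j′ → toℕ j ≡ p + j′ × (Trav zs j′ u v ⊎ Trav zs j′ v u)
      past (inj₁ t) with trav-padded c ys p {toℕ j} (trav t) ne
      ... | j′ , eq , t′ = j′ , eq , inj₁ t′
      past (inj₂ t) with trav-padded c ys p {toℕ j} (trav t) (ne ∘ sym)
      ... | j′ , eq , t′ = j′ , eq , inj₂ t′
    ... | i′ , eq , t | j′ , eq′ , t′ = toℕ-injective (trans eq (trans (cong (p +_)
          (walk-once N₁ W (edgeList-unique G) (edgeList-oriented G) {i′} {j′} t t′)) (sym eq′)))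
    long-runs : ∀ {i} → w i ≡ nothing → InRun w N i
    long-runs {i} eq with runs-padded c ys (walk-runs N₁ W) p (subst (toℕ i <_) (sym length-full) (toℕ<n i)) eq
    ... | a , a≤i , i<a+N , a+N≤ , run = a , a≤i , i<a+N , subst (a + N ≤_) length-full a+N≤ , λ j → run (toℕ j)
    few-private : ℕΣ.sum (λ i → isNothing (w i)) ≤ m * N
    few-private = ≤-trans (≤-reflexive (trans (sum-at isNothing full length-full)
        (trans (nothings-padded c ys p) (walk-nothings N₁ W)))) (*-monoˡ-≤ N J≤m)
    -- The first `numEdges G` times after the padding are counted. They need not be the traversals:
    -- after the padding no step is idle, whether it follows an edge or an excursion.
    covers : numEdges G ≤ steps (place w)
    covers = injection≤sum (nonloop (place w) (place w ∘ next)) pos pos-inj moves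
      where
      in-range : ∀ (t : Fin (numEdges G)) → p + toℕ t < n
      in-range t = ≤-trans (+-monoʳ-< p (≤-trans (toℕ<n t) (≤-trans (m≤m+n _ _) (≤-reflexive (sym (walk-length N₁ W))))))
                     (≤-reflexive p+size≡n)
      pos : Fin (numEdges G) → Fin n
      pos t = fromℕ< (in-range t)
      toℕ-pos : ∀ t → toℕ (pos t) ≡ p + toℕ t
      toℕ-pos t = toℕ-fromℕ< (in-range t)
      pos-inj : Injective _≡_ _≡_ pos
      pos-inj {t} {u} eq = toℕ-injective (+-cancelˡ-≡ p _ _ (trans (sym (toℕ-pos t)) (trans (cong toℕ eq) (toℕ-pos u))))
      never-stays : ∀ t {u} → ¬ Traverses w (pos t) u u
      never-stays t tr with trav tr
      ... | a , b with walk-edge N₁ W {toℕ t} (trans (sym (trans (cong (at full) (toℕ-pos t)) (at-padded c ys p (toℕ t)))) a ,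
                         trans (sym (trans (cong (at full) (trans (cong suc (toℕ-pos t)) (sym (+-suc p (toℕ t))))) (at-padded c ys p (suc (toℕ t))))) b)
      ...   | _ , e∈ , inj₁ refl = <-irrefl refl (proj₁ (∈-edgeList⁻ G e∈))
      ...   | _ , e∈ , inj₂ refl = <-irrefl refl (proj₁ (∈-edgeList⁻ G e∈))
      distinct : ∀ i → (∀ {u} → ¬ Traverses w i u u) → place w i ≢ place w (next i)
      distinct i moving eq = go (w i) refl (w (next i)) refl
        where
        go : ∀ x → w i ≡ x → ∀ y → w (next i) ≡ y → _
        go nothing a _ _ = next≢ i 2≤n (private-place w a (sym eq))
        go (just u) a nothing b = next≢ i 2≤n (sym (private-place w b eq))
        go (just u) a (just v) b = moving (a , trans b (cong just (sym
          (↑ˡ-injective n u v (trans (sym (place-just w a)) (trans eq (place-just w b)))))))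
      moves : ∀ t → nonloop (place w) (place w ∘ next) (pos t) ≡ true
      moves t = cong not (⌊⌋-no {d = place w (pos t) ≟ place w (next (pos t))} (distinct (pos t) (never-stays t)))

-- A cheap tour that visits the cities vertex by vertex

module SortedTours where
  open import Data.Nat
  open import Data.Nat.Properties
  open import Data.Fin as Fin using (Fin; zero; suc; inject₁; fromℕ)
  open import Data.List using (List; []; _∷_; length; lookup; map; tabulate)
  open import Data.List.Properties using (length-tabulate; map-tabulate)
  open import Data.Nat.ListAction using () renaming (sum to sumL)
  open import Data.Nat.ListAction.Properties using (sum-↭)
  open import Data.List.Relation.Unary.Linked using (Linked; []; [-]; _∷_)
  open import Data.List.Relation.Unary.Any using (here; there)
  open import Data.List.Relation.Unary.Unique.Propositional using (Unique)
  import Data.List.Relation.Unary.Unique.Propositional.Properties as Unique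
  open import Data.List.Membership.Propositional using (_∈_)
  open import Data.List.Membership.Propositional.Properties using (∈-allFin)
  open import Data.List.Relation.Binary.Permutation.Propositional using (_↭_; ↭-sym)
  open import Data.List.Relation.Binary.Permutation.Propositional.Properties using (∈-resp-↭; ↭-length; map⁺)
  import Data.List.Sort as Sort
  import Relation.Binary.Construct.On as On
  open import Data.Product using (Σ; ∃; _×_; _,_)
  open import Data.Sum using (inj₁; inj₂)
  open import Relation.Nullary using (contradiction)
  open import Relation.Binary.PropositionalEquality hiding ([_])
  open import Function using (_∘_; Injective)
  open import Defs using (Tour; σ; next; allFin)
  open FiniteSums
  open UniqueLists
  open TrailDecomposition using (Unique-resp-↭)

  sum-tabulate : ∀ {n} (f : Fin n → ℕ) → sumL (tabulate f) ≡ ℕΣ.sum f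
  sum-tabulate {zero} f = refl
  sum-tabulate {suc n} f = cong (f zero +_) (sum-tabulate (f ∘ suc))

  module _ {A : Set} (D : A → A → ℕ) where

    path : A → List A → ℕ
    path x [] = 0
    path x (y ∷ ys) = D x y + path y ys

    sum-path : ∀ x xs → ℕΣ.sum (λ i → D (lookup (x ∷ xs) (inject₁ i)) (lookup xs i)) ≡ path x xs
    sum-path x [] = refl
    sum-path x (y ∷ ys) = cong (D x y +_) (sum-path y ys)

    cyclic-sum : ∀ x xs → ℕΣ.sum (λ i → D (lookup (x ∷ xs) i) (lookup (x ∷ xs) (next i))) ≡
                 path x xs + D (lookup (x ∷ xs) (fromℕ (length xs))) x
    cyclic-sum x xs = trans (sum-next-split +-0-commutativeMonoid (λ i j → D (lookup (x ∷ xs) i) (lookup (x ∷ xs) j)))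
      (cong (_+ D (lookup (x ∷ xs) (fromℕ (length xs))) x) (sum-path x xs))

    enumerate : ∀ x xs {l} → length (x ∷ xs) ≡ l → Unique (x ∷ xs) → Σ (Fin l → A) λ f → Injective _≡_ _≡_ f ×
      ∃ λ z → ℕΣ.sum (λ i → D (f i) (f (next i))) ≡ path x xs + D z x
    enumerate x xs refl uniq = lookup (x ∷ xs) , lookup-injective uniq , _ , cyclic-sum x xs

    module _ (D-refl : ∀ x → D x x ≡ 0) (D-tri : ∀ x y z → D x z ≤ D x y + D y z) where

      D≤path : ∀ {x xs y} → y ∈ (x ∷ xs) → D x y ≤ path x xs
      D≤path {x} (here refl) = ≤-trans (≤-reflexive (D-refl x)) z≤n
      D≤path {x} {x′ ∷ xs} {y} (there y∈) = ≤-trans (D-tri x x′ y) (+-monoʳ-≤ (D x x′) (D≤path y∈))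

  module _ {n : ℕ} (D : Fin n → Fin n → ℕ) (k : ℕ) (D≤k : ∀ i j → D i j ≤ k)
           (D-refl : ∀ i → D i i ≡ 0) (D-sym : ∀ i j → D i j ≡ D j i) (D-tri : ∀ i j l → D i l ≤ D i j + D j l)
           (key extra : Fin n → ℕ) (m : ℕ) (key≤m : ∀ i → key i ≤ m)
           (together : ∀ i j → key i ≡ key j → extra i ≡ 0 → D i j ≡ 0) where

    private
      open Sort (On.decTotalOrder ≤-decTotalOrder key) using (sort; sort-↭; sort-↗)

      sum-D : Tour n → ℕ
      sum-D S = ℕΣ.sum λ i → D (σ S i) (σ S (next i))

    -- `k * key` is a potential. Distances are at most `k`, so a rise of the key pays for any step;
    -- at equal keys only a step out of a city with `extra` can cost anything, and `k * extra` pays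
    -- for it. Along a sorted list the bounds telescope, and the last key is at most `m`.
    step-bound : ∀ i j → key i ≤ key j → D i j + k * key i ≤ k * extra i + k * key j
    step-bound i j le with extra i in ex | m≤n⇒m<n∨m≡n le
    ... | suc e | _ = +-mono-≤ (≤-trans (D≤k i j) (m≤m*n k (suc e))) (*-monoʳ-≤ k le)
    ... | zero | inj₁ lt = ≤-trans (+-monoˡ-≤ (k * key i) (D≤k i j))
            (≤-trans (≤-reflexive (sym (*-suc k (key i)))) (≤-trans (*-monoʳ-≤ k lt) (m≤n+m _ (k * 0))))
    ... | zero | inj₂ eq = ≤-trans (≤-reflexive (cong₂ (λ a b → a + k * b) (together i j eq ex) eq)) (m≤n+m _ (k * 0))

    sorted-path : ∀ x xs → Linked (λ i j → key i ≤ key j) (x ∷ xs) → path D x xs + k * key x ≤ k * (m + sumL (map extra (x ∷ xs)))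
    sorted-path x [] [-] = *-monoʳ-≤ k (≤-trans (key≤m x) (m≤m+n m _))
    sorted-path x (y ∷ ys) (le ∷ sorted) = begin
      D x y + path D y ys + k * key x              ≡⟨ cong (_+ k * key x) (+-comm (D x y) _) ⟩
      path D y ys + D x y + k * key x              ≡⟨ +-assoc (path D y ys) _ _ ⟩
      path D y ys + (D x y + k * key x)            ≤⟨ +-monoʳ-≤ (path D y ys) (step-bound x y le) ⟩
      path D y ys + (k * extra x + k * key y)      ≡⟨ cong (path D y ys +_) (+-comm (k * extra x) _) ⟩
      path D y ys + (k * key y + k * extra x)      ≡⟨ +-assoc (path D y ys) _ _ ⟨
      path D y ys + k * key y + k * extra x        ≤⟨ +-monoˡ-≤ (k * extra x) (sorted-path y ys sorted) ⟩
      k * (m + rest) + k * extra x                 ≡⟨ *-distribˡ-+ k (m + rest) (extra x) ⟨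
      k * (m + rest + extra x)                     ≡⟨ cong (k *_) (trans (+-assoc m rest (extra x)) (cong (m +_) (+-comm rest (extra x)))) ⟩
      k * (m + (extra x + rest))                   ∎
      where
      open ≤-Reasoning
      rest = sumL (map extra (y ∷ ys))

    -- The final `+ k` pays for the closing step. The second bound serves to show that the tour has
    -- positive cost: at cost zero all cities would be at distance zero.
    shortTour : 1 ≤ n → Σ (Tour n) λ S → sum-D S ≤ k * (m + ℕΣ.sum extra) + k × (∀ i j → D i j ≤ sum-D S + sum-D S)
    shortTour 1≤n = from (sort (allFin n)) (sort-↭ (allFin n)) (sort-↗ (allFin n))
      where
      from : ∀ xs → xs ↭ allFin n → Linked (λ i j → key i ≤ key j) xs →
             Σ (Tour n) λ S → sum-D S ≤ k * (m + ℕΣ.sum extra) + k × (∀ i j → D i j ≤ sum-D S + sum-D S)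
      from [] p _ = contradiction (trans (↭-length p) (length-tabulate {n = n} λ i → i)) (<⇒≢ 1≤n)
      from (x ∷ xs) p sorted with enumerate D x xs (trans (↭-length p) (length-tabulate {n = n} λ i → i))
                                    (Unique-resp-↭ (↭-sym p) (Unique.allFin⁺ n))
      ... | f , f-inj , z , eq = record { σ = f ; inj = f-inj } , upper , all-close
        where
        upper : ℕΣ.sum (λ i → D (f i) (f (next i))) ≤ k * (m + ℕΣ.sum extra) + k
        upper = ≤-trans (≤-reflexive eq) (+-mono-≤ (≤-trans (m≤m+n (path D x xs) (k * key x)) (≤-trans (sorted-path x xs sorted)
            (≤-reflexive (cong (λ s → k * (m + s)) (trans (sum-↭ (map⁺ extra p))
              (trans (cong sumL (map-tabulate (λ i → i) extra)) (sum-tabulate extra))))))) (D≤k z x))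
        path≤ : path D x xs ≤ ℕΣ.sum (λ i → D (f i) (f (next i)))
        path≤ = ≤-trans (m≤m+n _ _) (≤-reflexive (sym eq))
        reach : ∀ i → D x i ≤ ℕΣ.sum (λ i → D (f i) (f (next i)))
        reach i = ≤-trans (D≤path D D-refl D-tri (∈-resp-↭ (↭-sym p) (∈-allFin i))) path≤
        all-close : ∀ i j → D i j ≤ ℕΣ.sum (λ i → D (f i) (f (next i))) + ℕΣ.sum (λ i → D (f i) (f (next i)))
        all-close i j = ≤-trans (D-tri i x j) (+-mono-≤ (≤-trans (≤-reflexive (D-sym i x)) (reach i)) (reach j))

-- Instances of large ratio

module Instances where
  open import Data.Nat hiding (_≟_)
  open import Data.Nat.Properties hiding (_≟_)
  open import Data.Rational as ℚ using (ℚ; 0ℚ)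
  import Data.Rational.Properties as ℚP
  open import Data.Fin as Fin using (Fin; suc; toℕ; _↑ˡ_)
  open import Data.Fin.Properties using (toℕ<n; toℕ-injective)
  open import Data.Maybe using (Maybe; just; nothing; maybe)
  open import Data.Product using (Σ; _×_; _,_; proj₁; proj₂)
  open import Relation.Nullary using (yes; no; contradiction)
  open import Relation.Binary.PropositionalEquality hiding ([_])
  open import Function using (_∘_)
  open import Defs hiding (sym)
  open FiniteSums
  open RationalSums
  open Chains
  open ClosedWalks
  open GraphWalks
  open TrailDecomposition
  open ClosedTrails
  open SortedTours

  -- Private vertices share the key `m` and so come last. They may lie far apart, which is why each
  -- of them is also charged through `extra`.
  vertexKey : ∀ {m} → Maybe (Fin m) → ℕ
  vertexKey {m} = maybe toℕ m

  vertexKey≤m : ∀ {m} (x : Maybe (Fin m)) → vertexKey x ≤ m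
  vertexKey≤m (just v) = <⇒≤ (toℕ<n v)
  vertexKey≤m nothing = ≤-refl

  same-key : ∀ {m n} (w : Fin n → Maybe (Fin m)) i j → vertexKey (w i) ≡ vertexKey (w j) → isNothing (w i) ≡ 0 →
             place w i ≡ place w j
  same-key w i j eq ex with w i | w j
  ... | just u | just v = cong (_↑ˡ _) (toℕ-injective eq)
  ... | just u | nothing = contradiction (toℕ<n u) (<-irrefl eq)
  same-key w i j eq () | nothing | _

  -- In the bound, `m` stands for changes of key and `m * (2 * k)` for private vertices, each
  -- costing at most `k`; the last `k` closes the tour.
  trail-ratio : ∀ {m} (G : Graph m) k n → 2 ≤ k → GirthAtLeast G (2 * k) → 2 ≤ n → ClosedTrail G (2 * k) n →
          1 ≤ numEdges G → ∀ ρ → 0ℚ ℚ.≤ ρ →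
          ρ ℚ.* ℕ→ℚ (k * (m + m * (2 * k)) + k) ℚ.≤ ℕ→ℚ (numEdges G) → RatioAtLeast k n ρ
  trail-ratio {m} G k n 2≤k girth 2≤n trail 1≤E ρ 0≤ρ bound = result
    where
    open ClosedTrail trail
    loc : Fin n → Fin (m + n)
    loc = place w
    open Distance loc (loc ∘ next) k
    trivial : ShortEvenTrivial loc (2 * k)
    trivial = shortEvenTrivial w G girth 2≤n along-edges edges-once long-runs
    key : Fin n → ℕ
    key i = vertexKey (w i)
    extra : Fin n → ℕ
    extra i = isNothing (w i)
    T : Tour n
    T = idTour n
    short : Σ (Tour n) λ S → len loc k S ≤ k * (m + ℕΣ.sum extra) + k × (∀ i j → dist (loc i) (loc j) ≤ len loc k S + len loc k S)
    short = shortTour (λ i j → dist (loc i) (loc j)) k (λ i j → dist≤k _ _) (λ i → dist-refl _) (λ i j → dist-sym _ _)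
      (λ i j l → dist-tri _ _ _) key extra m (λ i → vertexKey≤m (w i))
      (λ i j eq ex → trans (cong (dist (loc i)) (sym (same-key w i j eq ex))) (dist-refl (loc i))) (<⇒≤ 2≤n)
    S : Tour n
    S = proj₁ short
    E≤len : numEdges G ≤ len loc k T
    E≤len = ≤-trans covers (steps≤len-id loc k (<⇒≤ 2≤k))
    0<len : 0 < len loc k S
    0<len = n≢0⇒n>0 λ eq → <⇒≱ (≤-trans 1≤E E≤len) (≤-reflexive (sum-zero (λ i → dist (loc i) (loc (next i)))
      λ i → n≤0⇒n≡0 (≤-trans (proj₂ (proj₂ short) i (next i)) (≤-reflexive (cong₂ _+_ eq eq)))))
    len≤ : len loc k S ≤ k * (m + m * (2 * k)) + k
    len≤ = ≤-trans (proj₁ (proj₂ short)) (+-monoˡ-≤ k (*-monoʳ-≤ k (+-monoʳ-≤ m few-private)))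
    result : RatioAtLeast k n ρ
    result = distMetric loc k , T , idTour-KOptimal loc k 2≤k trivial , S ,
      subst (0ℚ ℚ.<_) (sym (cost≡len loc k S)) (ℕ→ℚ-mono-< 0 (len loc k S) 0<len) ,
      subst₂ (λ a b → ρ ℚ.* a ℚ.≤ b) (sym (cost≡len loc k S)) (sym (cost≡len loc k T))
        (ℚP.≤-trans (ℚP.*-monoˡ-≤-nonNeg ρ {{ℚ.nonNegative 0≤ρ}} (ℕ→ℚ-mono-≤ (len loc k S) (k * (m + m * (2 * k)) + k) len≤))
          (ℚP.≤-trans bound (ℕ→ℚ-mono-≤ (numEdges G) (len loc k T) E≤len)))

  ratio : ∀ {m} (G : Graph m) k n → 2 ≤ k → GirthAtLeast G (2 * k) → Fin m → 2 ≤ n →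
          numEdges G + m * suc (2 * k) ≤ n → 1 ≤ numEdges G → ∀ ρ → 0ℚ ℚ.≤ ρ →
          ρ ℚ.* ℕ→ℚ (k * (m + m * (2 * k)) + k) ℚ.≤ ℕ→ℚ (numEdges G) → RatioAtLeast k n ρ
  -- Excursions must have successor length, and `2 * k` computes to the successor of `k₁ + 1 * k`.
  ratio G k@(suc k₁) n 2≤k girth c 2≤n large = trail-ratio G k n 2≤k girth 2≤n (closedTrail G (k₁ + 1 * k) n c 2≤n large)

  module _ {n : ℕ} where
    open import Data.Fin.Properties using (_≟_)

    discrete : Fin n → Fin n → ℕ
    discrete i j with i ≟ j
    ... | yes _ = 0
    ... | no _ = 1

    discrete-refl : ∀ i → discrete i i ≡ 0
    discrete-refl i with i ≟ i
    ... | yes _ = refl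
    ... | no ne = contradiction refl ne

    discrete-≢ : ∀ {i j} → i ≢ j → discrete i j ≡ 1
    discrete-≢ {i} {j} ne with i ≟ j
    ... | yes eq = contradiction eq ne
    ... | no _ = refl

    discrete-sym : ∀ i j → discrete i j ≡ discrete j i
    discrete-sym i j with i ≟ j
    ... | yes refl = sym (discrete-refl i)
    ... | no ne = sym (discrete-≢ (ne ∘ sym))

    discrete-tri : ∀ i j l → discrete i l ≤ discrete i j + discrete j l
    discrete-tri i j l with i ≟ j
    ... | yes refl = ≤-refl
    ... | no _ with i ≟ l
    ...   | yes _ = z≤n
    ...   | no _ = s≤s z≤n

    uniformMetric : Metric n
    uniformMetric = record
      { d = λ i j → ℕ→ℚ (discrete i j)
      ; nonneg = λ i j → 0≤ℕ→ℚ (discrete i j)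
      ; diag = λ i → cong ℕ→ℚ (discrete-refl i)
      ; symm = λ i j → cong ℕ→ℚ (discrete-sym i j)
      ; tri = λ i j l → subst (ℕ→ℚ (discrete i l) ℚ.≤_) (ℕ→ℚ-+ (discrete i j) (discrete j l))
                          (ℕ→ℚ-mono-≤ (discrete i l) (discrete i j + discrete j l) (discrete-tri i j l))
      }

    uniform-cost : 2 ≤ n → ∀ S → cost uniformMetric S ≡ ℕ→ℚ (ℕΣ.sum {n} λ _ → 1)
    uniform-cost 2≤n S = trans (Σℚ-ℕ→ℚ λ i → discrete (σ S i) (σ S (next i)))
      (cong ℕ→ℚ (ℕΣ.sum-cong-≗ λ i → discrete-≢ λ eq → next≢ i 2≤n (sym (Tour.inj S eq))))

  -- In the uniform metric all tours cost the same, so each of them is optimal and attains ratio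
  -- one.
  ratio-≤1 : ∀ k n → 2 ≤ n → ∀ ρ → ρ ℚ.≤ ℚ.1ℚ → RatioAtLeast k n ρ
  ratio-≤1 k (suc n) 2≤n ρ ρ≤1 = uniformMetric , T , (λ S _ → ℚP.≤-reflexive (trans (uniform-cost 2≤n T) (sym (uniform-cost 2≤n S)))) ,
      T , positive , ℚP.≤-trans (ℚP.*-monoʳ-≤-nonNeg c {{ℚ.nonNegative (ℚP.<⇒≤ positive)}} ρ≤1) (ℚP.≤-reflexive (ℚP.*-identityˡ c))
    where
    T : Tour (suc n)
    T = idTour (suc n)
    c : ℚ
    c = cost uniformMetric T
    positive : 0ℚ ℚ.< c
    positive = subst (0ℚ ℚ.<_) (sym (uniform-cost 2≤n T)) (ℕ→ℚ-mono-< 0 (ℕΣ.sum {suc n} λ _ → 1) (s≤s z≤n))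

-- Growth of the extremal function

module ExtremalFunction where
  open import Data.Nat
  open import Data.Nat.Properties
  open import Data.Nat.DivMod
  open import Data.Fin as Fin using (Fin; zero; suc; toℕ; fromℕ<; splitAt; _↑ˡ_; _↑ʳ_)
  open import Data.Fin.Properties as FinP using (toℕ<n; toℕ-injective; fromℕ<-toℕ; toℕ-fromℕ<; splitAt-↑ˡ; splitAt-↑ʳ; toℕ-↑ˡ; toℕ-↑ʳ; join-splitAt)
  open import Data.Bool using (Bool; true; false; _xor_)
  open import Data.Bool.Properties using (xor-comm; xor-same)
  open import Data.Maybe using (Maybe; just; nothing)
  open import Data.List using (List; []; _∷_; length; map; _++_)
  open import Data.List.Properties using (length-map; length-++; length-tabulate)
  open import Data.List.Relation.Unary.Any using (here; there)
  open import Data.List.Relation.Unary.Any.Properties using (++⁺ˡ; ++⁺ʳ)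
  import Data.List.Relation.Unary.Unique.Propositional.Properties as Unique
  open import Data.List.Membership.Propositional using (_∈_)
  open import Data.List.Membership.Propositional.Properties using (∈-map⁺; ∈-map⁻)
  open import Data.Product using (∃; _×_; _,_; proj₁; proj₂)
  open import Data.Sum using (_⊎_; inj₁; inj₂)
  open import Relation.Nullary using (Dec; yes; no; ¬_; contradiction)
  open import Relation.Nullary.Decidable using (⌊_⌋)
  open import Relation.Binary.PropositionalEquality hiding ([_])
  open import Function using (_∘_; Injective)
  open import Defs hiding (sym; inj)
  open FiniteSums
  open UniqueLists
  open EdgeLists

  ⌊⌋⇒ : ∀ {a} {A : Set a} (d : Dec A) → ⌊ d ⌋ ≡ true → A
  ⌊⌋⇒ (yes a) _ = a

  star : ∀ m → Graph (suc m)
  star m = record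
    { adj = λ i j → ⌊ i FinP.≟ zero ⌋ xor ⌊ j FinP.≟ zero ⌋
    ; sym = λ i j → xor-comm ⌊ i FinP.≟ zero ⌋ ⌊ j FinP.≟ zero ⌋
    ; irrefl = λ i → xor-same ⌊ i FinP.≟ zero ⌋
    }

  -- Edges alternate between the centre and leaves, so a cycle would return to the centre after two
  -- steps.
  star-acyclic : ∀ m {ℓ} → ¬ Cycle (star m) ℓ
  star-acyclic m {ℓ} C with Cycle.len≥3 C
  ... | s≤s _ = by-centre zero
    where
    open Cycle C
    centre : Fin ℓ → Bool
    centre t = ⌊ vert t FinP.≟ zero ⌋
    alternate : ∀ {a b c} → a xor b ≡ true → b xor c ≡ true → a ≡ true → c ≡ true
    alternate {true} {false} {true} _ _ _ = refl
    no-centre : ∀ t → centre t ≢ true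
    no-centre t eq = next-next≢ t len≥3 (inj (trans (⌊⌋⇒ (_ FinP.≟ _) (alternate (edges t) (edges (next t)) eq)) (sym (⌊⌋⇒ (_ FinP.≟ _) eq))))
    by-centre : ∀ t → _
    by-centre t with centre t in eq | centre (next t) in eq′ | edges t
    ... | true | _ | _ = no-centre t eq
    ... | false | true | _ = no-centre (next t) eq′

  star-edges : ∀ m → m ≤ numEdges (star m)
  star-edges m = ≤-trans (≤-reflexive (sym (trans (length-map spoke (allFin m)) (length-tabulate {n = m} λ i → i))))
      (unique-⊆-length (Unique.map⁺ spoke-injective (Unique.allFin⁺ m)) λ e∈ → spoke-edge (∈-map⁻ spoke e∈))
    where
    spoke : Fin m → Fin (suc m) × Fin (suc m)
    spoke j = zero , suc j
    spoke-injective : ∀ {i j} → spoke i ≡ spoke j → i ≡ j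
    spoke-injective refl = refl
    spoke-edge : ∀ {e} → (∃ λ j → j ∈ allFin m × e ≡ spoke j) → e ∈ edgeList (star m)
    spoke-edge (j , _ , refl) = ∈-edgeList⁺ (star m) (s≤s z≤n , refl)

  -- The star is admissible for every girth. This linear lower bound later keeps the number of
  -- levels logarithmic.
  ex≥ : ∀ {g e} → IsEx g e → ∀ m → m ≤ e (suc m)
  ex≥ isEx m = ≤-trans (star-edges m) (proj₂ (isEx (suc m)) (star m) λ ℓ _ → star-acyclic m)

  module _ {M a : ℕ} (G : Graph M) (f : Fin a → Maybe (Fin M)) where

    adjMaybe : Maybe (Fin M) → Maybe (Fin M) → Bool
    adjMaybe (just u) (just v) = adj G u v
    adjMaybe _ _ = false

    adjMaybe⇒ : ∀ x y → adjMaybe x y ≡ true → ∃ λ u → ∃ λ v → x ≡ just u × y ≡ just v × adj G u v ≡ true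
    adjMaybe⇒ (just u) (just v) eq = u , v , refl , refl , eq
    adjMaybe⇒ (just _) nothing ()
    adjMaybe⇒ nothing _ ()

    adjMaybe-sym : ∀ x y → adjMaybe x y ≡ adjMaybe y x
    adjMaybe-sym (just u) (just v) = Graph.sym G u v
    adjMaybe-sym (just _) nothing = refl
    adjMaybe-sym nothing (just _) = refl
    adjMaybe-sym nothing nothing = refl

    adjMaybe-irrefl : ∀ x → adjMaybe x x ≡ false
    adjMaybe-irrefl (just u) = irrefl G u
    adjMaybe-irrefl nothing = refl

    -- For `f` injective where defined, this is the subgraph induced on its image, with isolated
    -- vertices where `f` is undefined.
    pullback : Graph a
    pullback = record
      { adj = λ i j → adjMaybe (f i) (f j)
      ; sym = λ i j → adjMaybe-sym (f i) (f j)
      ; irrefl = λ i → adjMaybe-irrefl (f i)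
      }

    pullback-girth : (∀ {i j u} → f i ≡ just u → f j ≡ just u → i ≡ j) → ∀ {g} → GirthAtLeast G g → GirthAtLeast pullback g
    pullback-girth f-inj girth ℓ ℓ<g C = girth ℓ ℓ<g (record { len≥3 = len≥3 ; vert = vert′ ; inj = inj′ ; edges = edges′ })
      where
      open Cycle C
      vert′ : Fin ℓ → Fin M
      vert′ t = proj₁ (adjMaybe⇒ (f (vert t)) (f (vert (next t))) (edges t))
      f-vert : ∀ t → f (vert t) ≡ just (vert′ t)
      f-vert t = proj₁ (proj₂ (proj₂ (adjMaybe⇒ (f (vert t)) (f (vert (next t))) (edges t))))
      inj′ : Injective _≡_ _≡_ vert′
      inj′ {s} {t} eq = inj (f-inj (f-vert s) (trans (f-vert t) (cong just (sym eq))))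
      edges′ : ∀ t → adj G (vert′ t) (vert′ (next t)) ≡ true
      edges′ t = subst₂ (λ x y → adjMaybe x y ≡ true) (f-vert t) (f-vert (next t)) (edges t)

  module _ {M a : ℕ} (G : Graph M) {I : Set} (f : I → Fin a → Maybe (Fin M)) where

    pulled-edges : List I → List (Maybe (Fin M) × Maybe (Fin M))
    pulled-edges [] = []
    pulled-edges (x ∷ xs) = map (λ (i , j) → f x i , f x j) (edgeList (pullback G (f x))) ++ pulled-edges xs

    ∈-pulled-edges : ∀ {x} xs → x ∈ xs → ∀ {e} → e ∈ edgeList (pullback G (f x)) → (f x (proj₁ e) , f x (proj₂ e)) ∈ pulled-edges xs
    ∈-pulled-edges (x ∷ xs) (here refl) e∈ = ++⁺ˡ (∈-map⁺ (λ (i , j) → f x i , f x j) e∈)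
    ∈-pulled-edges (x ∷ xs) (there x∈) e∈ = ++⁺ʳ (map (λ (i , j) → f x i , f x j) (edgeList (pullback G (f x)))) (∈-pulled-edges xs x∈ e∈)

    length-pulled-edges : ∀ {b} xs → (∀ {x} → x ∈ xs → numEdges (pullback G (f x)) ≤ b) → length (pulled-edges xs) ≤ length xs * b
    length-pulled-edges [] le = z≤n
    length-pulled-edges (x ∷ xs) le = ≤-trans
      (≤-reflexive (trans (length-++ (map (λ (i , j) → f x i , f x j) (edgeList (pullback G (f x))))) (cong (_+ length (pulled-edges xs)) (length-map (λ (i , j) → f x i , f x j) (edgeList (pullback G (f x)))))))
      (+-mono-≤ (le (here refl)) (length-pulled-edges xs (le ∘ there)))

    -- A union bound over the pullbacks. Requiring `i` before `j` makes the listed pair agree with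
    -- the oriented edge of `G`.
    covered-edges : ∀ {b} xs → (∀ {x} → x ∈ xs → numEdges (pullback G (f x)) ≤ b) →
      (∀ {u v} → toℕ u < toℕ v → ∃ λ x → x ∈ xs × ∃ λ i → ∃ λ j → toℕ i < toℕ j × f x i ≡ just u × f x j ≡ just v) →
      numEdges G ≤ length xs * b
    covered-edges xs le cover = ≤-trans
        (≤-trans (≤-reflexive (sym (length-map justs (edgeList G))))
          (unique-⊆-length (Unique.map⁺ justs-injective (edgeList-unique G)) λ e∈ → covered (∈-map⁻ justs e∈)))
        (length-pulled-edges xs le)
      where
      justs : Fin M × Fin M → Maybe (Fin M) × Maybe (Fin M)
      justs (u , v) = just u , just v
      justs-injective : ∀ {d e} → justs d ≡ justs e → d ≡ e
      justs-injective refl = refl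
      covered : ∀ {p} → (∃ λ e → e ∈ edgeList G × p ≡ justs e) → p ∈ pulled-edges xs
      covered ((u , v) , e∈ , refl) with ∈-edgeList⁻ G e∈
      ... | u<v , uv with cover u<v
      ...   | x , x∈ , i , j , i<j , fi , fj = subst₂ (λ y z → (y , z) ∈ pulled-edges xs) fi fj
              (∈-pulled-edges xs x∈ (∈-edgeList⁺ (pullback G (f x)) (i<j , trans (cong₂ (adjMaybe G (f x)) fi fj) uv)))

  module _ (M q : ℕ) .{{_ : NonZero q}} where

    toFin? : ℕ → Maybe (Fin M)
    toFin? x with x <? M
    ... | yes lt = just (fromℕ< lt)
    ... | no _ = nothing

    toFin?-toℕ : ∀ {x} (u : Fin M) → x ≡ toℕ u → toFin? x ≡ just u
    toFin?-toℕ u refl with toℕ u <? M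
    ... | yes lt = cong just (fromℕ<-toℕ u lt)
    ... | no ≮ = contradiction (toℕ<n u) ≮

    toFin?-just : ∀ x {u} → toFin? x ≡ just u → x ≡ toℕ u
    toFin?-just x eq with x <? M
    toFin?-just x refl | yes lt = sym (toℕ-fromℕ< lt)

    position : ℕ × ℕ → Fin q ⊎ Fin q → ℕ
    position (α , β) (inj₁ s) = toℕ s + α * q
    position (α , β) (inj₂ t) = toℕ t + β * q

    twoBlocks : ℕ × ℕ → Fin (q + q) → Maybe (Fin M)
    twoBlocks αβ i = toFin? (position αβ (splitAt q i))

    position-injective : ∀ {α β} → α < β → ∀ {x y} → position (α , β) x ≡ position (α , β) y → x ≡ y
    position-injective {α} {β} α<β = go _ _
      where
      blocks-disjoint : ∀ (s t : Fin q) → toℕ s + α * q ≢ toℕ t + β * q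
      blocks-disjoint s t = <⇒≢ (<-≤-trans (+-monoˡ-< (α * q) (toℕ<n s)) (≤-trans (*-monoˡ-≤ q α<β) (m≤n+m _ _)))
      go : ∀ x y → position (α , β) x ≡ position (α , β) y → x ≡ y
      go (inj₁ s) (inj₁ t) eq = cong inj₁ (toℕ-injective (+-cancelʳ-≡ (α * q) _ _ eq))
      go (inj₂ s) (inj₂ t) eq = cong inj₂ (toℕ-injective (+-cancelʳ-≡ (β * q) _ _ eq))
      go (inj₁ s) (inj₂ t) eq = contradiction eq (blocks-disjoint s t)
      go (inj₂ s) (inj₁ t) eq = contradiction (sym eq) (blocks-disjoint t s)

    twoBlocks-injective : ∀ {α β} → α < β → ∀ {i j u} → twoBlocks (α , β) i ≡ just u → twoBlocks (α , β) j ≡ just u → i ≡ j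
    twoBlocks-injective α<β {i} {j} p r = trans (sym (join-splitAt q q i)) (trans (cong (Fin.join q q)
      (position-injective α<β {splitAt q i} {splitAt q j} (trans (toFin?-just _ p) (sym (toFin?-just _ r))))) (join-splitAt q q j))

    -- The pairs of distinct blocks among four; their number is the factor in `ex-doubling`.
    blockPairs : List (ℕ × ℕ)
    blockPairs = (0 , 1) ∷ (0 , 2) ∷ (0 , 3) ∷ (1 , 2) ∷ (1 , 3) ∷ (2 , 3) ∷ []

    blockPairs-< : ∀ {α β} → (α , β) ∈ blockPairs → α < β
    blockPairs-< (here refl) = s≤s z≤n
    blockPairs-< (there (here refl)) = s≤s z≤n
    blockPairs-< (there (there (here refl))) = s≤s z≤n
    blockPairs-< (there (there (there (here refl)))) = s≤s (s≤s z≤n)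
    blockPairs-< (there (there (there (there (here refl))))) = s≤s (s≤s z≤n)
    blockPairs-< (there (there (there (there (there (here refl)))))) = s≤s (s≤s (s≤s z≤n))

    <⇒blockPairs : ∀ {α β} → α < β → β < 4 → (α , β) ∈ blockPairs
    <⇒blockPairs {0} {1} _ _ = here refl
    <⇒blockPairs {0} {2} _ _ = there (here refl)
    <⇒blockPairs {0} {3} _ _ = there (there (here refl))
    <⇒blockPairs {1} {2} _ _ = there (there (there (here refl)))
    <⇒blockPairs {1} {3} _ _ = there (there (there (there (here refl))))
    <⇒blockPairs {2} {3} _ _ = there (there (there (there (there (here refl)))))
    <⇒blockPairs {1} {1} (s≤s ()) _
    <⇒blockPairs {suc (suc _)} {1} (s≤s ()) _
    <⇒blockPairs {suc (suc _)} {2} (s≤s (s≤s ())) _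
    <⇒blockPairs {suc (suc (suc _))} {3} (s≤s (s≤s (s≤s ()))) _
    <⇒blockPairs {_} {suc (suc (suc (suc _)))} _ (s≤s (s≤s (s≤s (s≤s ()))))

    module _ (M≤4q : M ≤ 4 * q) where

      block<4 : ∀ (u : Fin M) → toℕ u / q < 4
      block<4 u = m<n*o⇒m/o<n (≤-trans (toℕ<n u) M≤4q)

      offset : Fin M → Fin q
      offset u = fromℕ< (m%n<n (toℕ u) q)

      in-block : ∀ u → toℕ (offset u) + toℕ u / q * q ≡ toℕ u
      in-block u = trans (cong (_+ toℕ u / q * q) (toℕ-fromℕ< (m%n<n (toℕ u) q))) (sym (m≡m%n+[m/n]*n (toℕ u) q))

      left : ∀ {α β} u → toℕ u / q ≡ α → twoBlocks (α , β) (offset u ↑ˡ q) ≡ just u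
      left {α} {β} u refl = toFin?-toℕ u (trans (cong (position (α , β)) (splitAt-↑ˡ q (offset u) q)) (in-block u))

      right : ∀ {α β} u → toℕ u / q ≡ β → twoBlocks (α , β) (q ↑ʳ offset u) ≡ just u
      right {α} {β} u refl = toFin?-toℕ u (trans (cong (position (α , β)) (splitAt-↑ʳ q q (offset u))) (in-block u))

      offset-< : ∀ {u v} → toℕ u / q ≡ toℕ v / q → toℕ u < toℕ v → toℕ (offset u) < toℕ (offset v)
      offset-< {u} {v} eq lt = +-cancelʳ-< (toℕ v / q * q) _ _
        (subst₂ _<_ (trans (sym (in-block u)) (cong (λ b → toℕ (offset u) + b * q) eq)) (sym (in-block v)) lt)

      two-blocks-cover : ∀ {u v} → toℕ u < toℕ v → ∃ λ αβ → αβ ∈ blockPairs × ∃ λ i → ∃ λ j →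
        toℕ i < toℕ j × twoBlocks αβ i ≡ just u × twoBlocks αβ j ≡ just v
      two-blocks-cover {u} {v} u<v with m≤n⇒m<n∨m≡n (/-monoˡ-≤ q (<⇒≤ u<v))
      ... | inj₁ α<β = (toℕ u / q , toℕ v / q) , <⇒blockPairs α<β (block<4 v) , offset u ↑ˡ q , q ↑ʳ offset v ,
              subst₂ _<_ (sym (toℕ-↑ˡ (offset u) q)) (sym (toℕ-↑ʳ q (offset v))) (≤-trans (toℕ<n (offset u)) (m≤m+n q _)) ,
              left u refl , right v refl
      -- An edge inside one block may use any partner block: the next one, or block 2 if it lies in
      -- the last.
      ... | inj₂ α≡β with toℕ u / q <? 3
      ...   | yes α<3 = (toℕ u / q , suc (toℕ u / q)) , <⇒blockPairs ≤-refl (s≤s α<3) , offset u ↑ˡ q , offset v ↑ˡ q ,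
              subst₂ _<_ (sym (toℕ-↑ˡ (offset u) q)) (sym (toℕ-↑ˡ (offset v) q)) (offset-< {u} {v} α≡β u<v) ,
              left u refl , left v (sym α≡β)
      ...   | no α≮3 = (2 , 3) , <⇒blockPairs ≤-refl ≤-refl , q ↑ʳ offset u , q ↑ʳ offset v ,
              subst₂ _<_ (sym (toℕ-↑ʳ q (offset u))) (sym (toℕ-↑ʳ q (offset v))) (+-monoʳ-< q (offset-< {u} {v} α≡β u<v)) ,
              right u α≡3 , right v (trans (sym α≡β) α≡3)
              where
              α≡3 : toℕ u / q ≡ 3
              α≡3 = ≤-antisym (s≤s⁻¹ (block<4 u)) (≮⇒≥ α≮3)

  -- Split the vertices into four blocks of size q: every edge lies in the union
  -- of two of them.
  ex-doubling : ∀ {g e} → IsEx g e → ∀ M q → .{{_ : NonZero q}} → M ≤ 4 * q → e M ≤ 6 * e (q + q)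
  ex-doubling {g} {e} isEx M q M≤4q with proj₁ (isEx M)
  ... | G , girth , eq = ≤-trans (≤-reflexive (sym eq)) (covered-edges G (twoBlocks M q) (blockPairs M q)
      (λ {αβ} αβ∈ → proj₂ (isEx (q + q)) (pullback G (twoBlocks M q αβ))
        (pullback-girth G (twoBlocks M q αβ) (twoBlocks-injective M q (blockPairs-< M q αβ∈)) girth))
      (two-blocks-cover M q M≤4q))

-- Ceilings of rationals

module Ceilings where
  open import Data.Nat as ℕ using (ℕ; zero; suc)
  import Data.Nat.Properties as ℕP
  open import Data.Integer as ℤ using (ℤ; +_; -[1+_]; +[1+_]; +0)
  import Data.Integer.Properties as ℤP
  import Data.Integer.DivMod as ℤD
  open import Data.Integer.Tactic.RingSolver using (solve-∀)
  open import Data.Rational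
  open import Data.Rational.Properties
  open import Data.Product using (∃; _×_; _,_)
  open import Relation.Nullary using (contradiction)
  open import Relation.Binary.PropositionalEquality
  open import Defs using (ℕ→ℚ)
  open RationalSums

  -- `ceiling` is minus the floor of the negated fraction, so the remainder `s` of that division
  -- measures the overshoot.
  neg-div : ∀ n D → ∃ λ s → (ℤ.- ((ℤ.- n) ℤ./ + suc D)) ℤ.* + suc D ≡ n ℤ.+ + s × s ℕ.< suc D
  neg-div n D = s , eq , ℤD.n%d<d (ℤ.- n) (+ suc D)
    where
    open ≡-Reasoning
    s = (ℤ.- n) ℤ.% + suc D
    Q = (ℤ.- n) ℤ./ + suc D
    ring : ∀ a b c → (ℤ.- a) ℤ.* b ≡ ℤ.- (c ℤ.+ a ℤ.* b) ℤ.+ c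
    ring = solve-∀
    eq : (ℤ.- Q) ℤ.* + suc D ≡ n ℤ.+ + s
    eq = begin
      (ℤ.- Q) ℤ.* + suc D                      ≡⟨ ring Q (+ suc D) (+ s) ⟩
      ℤ.- (+ s ℤ.+ Q ℤ.* + suc D) ℤ.+ + s       ≡⟨ cong (λ a → ℤ.- a ℤ.+ + s) (sym (ℤD.a≡a%n+[a/n]*n (ℤ.- n) (+ suc D))) ⟩
      ℤ.- (ℤ.- n) ℤ.+ + s                       ≡⟨ cong (ℤ._+ + s) (ℤP.neg-involutive n) ⟩
      n ℤ.+ + s                                 ∎

  -- The three cases are those in which the negation of a rational computes.
  ceiling-spec : ∀ p → ∃ λ s → ceiling p ℤ.* ↧ p ≡ ↥ p ℤ.+ + s × s ℕ.< ↧ₙ p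
  ceiling-spec (mkℚ +0 d _) = neg-div +0 d
  ceiling-spec (mkℚ +[1+ n ] d _) = neg-div +[1+ n ] d
  ceiling-spec (mkℚ -[1+ n ] d _) = neg-div -[1+ n ] d

  ⌈_⌉ᴺ : ℚ → ℕ
  ⌈ p ⌉ᴺ = ℤ.∣ ceiling p ∣

  module _ (p : ℚ) (0≤p : 0ℚ ≤ p) where

    private
      z = ceiling p

      0≤↥p : ℤ.0ℤ ℤ.≤ ↥ p
      0≤↥p = subst (ℤ.0ℤ ℤ.≤_) (ℤP.*-identityʳ (↥ p)) (drop-*≤* 0≤p)

      ↥p≤z*↧p : ↥ p ℤ.≤ z ℤ.* ↧ p
      ↥p≤z*↧p with ceiling-spec p
      ... | s , eq , _ = subst (↥ p ℤ.≤_) (sym eq) (ℤP.i≤i+j (↥ p) (+ s))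

      0≤z : ℤ.0ℤ ℤ.≤ z
      0≤z = ℤP.*-cancelʳ-≤-pos ℤ.0ℤ z (↧ p) (ℤP.≤-trans 0≤↥p ↥p≤z*↧p)

    p≤⌈p⌉ : p ≤ ℕ→ℚ ⌈ p ⌉ᴺ
    p≤⌈p⌉ = subst (p ≤_) (sym (ℕ→ℚ≡fromℤ ⌈ p ⌉ᴺ))
      (*≤* (subst₂ ℤ._≤_ (sym (ℤP.*-identityʳ (↥ p))) (cong (ℤ._* ↧ p) (sym (ℤP.0≤i⇒+∣i∣≡i 0≤z))) ↥p≤z*↧p))

    ⌈p⌉-least : ∀ N → p ≤ ℕ→ℚ N → ⌈ p ⌉ᴺ ℕ.≤ N
    ⌈p⌉-least N p≤N with ceiling-spec p
    ... | s , eq , s<↧p = ℤP.drop‿+≤+ (subst (ℤ._≤ + N) (sym (ℤP.0≤i⇒+∣i∣≡i 0≤z)) (ℤP.≮⇒≥ λ N<z →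
        ℤP.<-irrefl refl (ℤP.<-≤-trans z*↧p< (ℤP.*-monoʳ-≤-nonNeg (↧ p) (ℤP.i<j⇒suc[i]≤j N<z)))))
      where
      ↥p≤N*↧p : ↥ p ℤ.≤ + N ℤ.* ↧ p
      ↥p≤N*↧p = subst (ℤ._≤ + N ℤ.* ↧ p) (ℤP.*-identityʳ (↥ p)) (drop-*≤* (subst (p ≤_) (ℕ→ℚ≡fromℤ N) p≤N))
      ring : ∀ a b → a ℤ.* b ℤ.+ b ≡ (ℤ.1ℤ ℤ.+ a) ℤ.* b
      ring = solve-∀
      z*↧p< : z ℤ.* ↧ p ℤ.< ℤ.suc (+ N) ℤ.* ↧ p
      z*↧p< = subst₂ ℤ._<_ (sym eq) (ring (+ N) (↧ p)) (ℤP.+-mono-≤-< ↥p≤N*↧p (ℤ.+<+ s<↧p))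

    ⌈p⌉≤p+1 : ℕ→ℚ ⌈ p ⌉ᴺ ≤ p + 1ℚ
    ⌈p⌉≤p+1 with ⌈ p ⌉ᴺ in eq
    ... | zero = ≤-trans 0≤p (≤-trans (≤-reflexive (sym (+-identityʳ p))) (+-monoʳ-≤ p (*≤* (ℤ.+≤+ ℕ.z≤n))))
    ... | suc c = subst (_≤ p + 1ℚ) (trans (sym (ℕ→ℚ-+ c 1)) (cong ℕ→ℚ (ℕP.+-comm c 1)))
            (+-monoˡ-≤ 1ℚ (≮⇒≥ λ p<c → contradiction (subst (ℕ._≤ c) eq (⌈p⌉-least c (<⇒≤ p<c))) ℕP.1+n≰n))

-- Powers of r and their ceilings

module GeometricGrowth where
  open import Data.Nat as ℕ using (ℕ; zero; suc)
  import Data.Nat.Properties as ℕP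
  open import Data.Integer as ℤ using (+_)
  import Data.Integer.Properties as ℤP
  open import Data.Rational
  open import Data.Rational.Properties
  import Data.Rational.Unnormalised as ℚᵘ
  import Data.Rational.Unnormalised.Properties as ℚᵘP
  open import Relation.Binary.PropositionalEquality
  open import Defs using (ℕ→ℚ; _^ℚ_)
  open RationalSums
  open Ceilings

  /-*-denominator : ∀ a b → (+ a / suc b) * ℕ→ℚ (suc b) ≡ ℕ→ℚ a
  /-*-denominator a b = toℚᵘ-injective (ℚᵘP.≃-trans (toℚᵘ-homo-* (+ a / suc b) (ℕ→ℚ (suc b)))
    (ℚᵘP.≃-trans (ℚᵘP.*-cong (toℚᵘ-fromℚᵘ (ℚᵘ.mkℚᵘ (+ a) b)) (toℚᵘ-fromℚᵘ (ℚᵘ.mkℚᵘ (+ suc b) 0)))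
      (ℚᵘP.≃-trans cancel (ℚᵘP.≃-sym (toℚᵘ-fromℚᵘ (ℚᵘ.mkℚᵘ (+ a) 0))))))
    where
    cancel : ℚᵘ.mkℚᵘ (+ a) b ℚᵘ.* ℚᵘ.mkℚᵘ (+ suc b) 0 ℚᵘ.≃ ℚᵘ.mkℚᵘ (+ a) 0
    cancel = ℚᵘ.*≡* (trans (ℤP.*-identityʳ (+ a ℤ.* + suc b)) (cong (λ n → + a ℤ.* + suc n) (sym (ℕP.*-identityʳ b))))

  0<ℕ→ℚ : ∀ n → 0ℚ < ℕ→ℚ (suc n)
  0<ℕ→ℚ n = ℕ→ℚ-mono-< 0 (suc n) (ℕ.s≤s ℕ.z≤n)

  module _ (q₁ : ℕ) where

    private
      q : ℕ
      q = suc q₁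

    -- With `q = 4k - 5` these are r and its inverse.
    R I : ℚ
    R = + suc q / q
    I = + q / suc q

    R*q : R * ℕ→ℚ q ≡ ℕ→ℚ (suc q)
    R*q = /-*-denominator (suc q) q₁

    I*R : I * R ≡ 1ℚ
    I*R = ≤-antisym (*-cancelʳ-≤-pos (ℕ→ℚ q) {{positive (0<ℕ→ℚ q₁)}} (≤-reflexive eq))
                    (*-cancelʳ-≤-pos (ℕ→ℚ q) {{positive (0<ℕ→ℚ q₁)}} (≤-reflexive (sym eq)))
      where
      eq : I * R * ℕ→ℚ q ≡ 1ℚ * ℕ→ℚ q
      eq = trans (*-assoc I R (ℕ→ℚ q)) (trans (cong (I *_) R*q) (trans (/-*-denominator q q) (sym (*-identityˡ (ℕ→ℚ q)))))

    1≤R : 1ℚ ≤ R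
    1≤R = *-cancelʳ-≤-pos (ℕ→ℚ q) {{positive (0<ℕ→ℚ q₁)}} (subst₂ _≤_ (sym (*-identityˡ (ℕ→ℚ q))) (sym R*q)
      (ℕ→ℚ-mono-≤ q (suc q) (ℕP.n≤1+n q)))

    R≤2 : R ≤ ℕ→ℚ 2
    R≤2 = *-cancelʳ-≤-pos (ℕ→ℚ q) {{positive (0<ℕ→ℚ q₁)}} (subst₂ _≤_ (sym R*q) (ℕ→ℚ-* 2 q)
      (ℕ→ℚ-mono-≤ (suc q) (2 ℕ.* q) (ℕP.≤-trans (ℕP.+-monoˡ-≤ q (ℕ.s≤s ℕ.z≤n)) (ℕP.≤-reflexive (cong (q ℕ.+_) (sym (ℕP.+-identityʳ q)))))))

    0≤I : 0ℚ ≤ I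
    0≤I = *-cancelʳ-≤-pos (ℕ→ℚ (suc q)) {{positive (0<ℕ→ℚ q)}} (subst₂ _≤_ (sym (*-zeroˡ (ℕ→ℚ (suc q)))) (sym (/-*-denominator q q)) (0≤ℕ→ℚ q))

    I≤1 : I ≤ 1ℚ
    I≤1 = *-cancelʳ-≤-pos (ℕ→ℚ (suc q)) {{positive (0<ℕ→ℚ q)}} (subst₂ _≤_ (sym (/-*-denominator q q)) (sym (*-identityˡ (ℕ→ℚ (suc q))))
      (ℕ→ℚ-mono-≤ q (suc q) (ℕP.n≤1+n q)))

    0≤R : 0ℚ ≤ R
    0≤R = ≤-trans (0≤ℕ→ℚ 1) 1≤R

    1≤R^ : ∀ l → 1ℚ ≤ R ^ℚ l
    1≤R^ zero = ≤-refl
    1≤R^ (suc l) = ≤-trans 1≤R (subst (_≤ R * R ^ℚ l) (*-identityʳ R) (*-monoˡ-≤-nonNeg R {{nonNegative 0≤R}} (1≤R^ l)))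

    0≤R^ : ∀ l → 0ℚ ≤ R ^ℚ l
    0≤R^ l = ≤-trans (0≤ℕ→ℚ 1) (1≤R^ l)

    R^-suc : ∀ l → R ^ℚ l ≤ R ^ℚ suc l
    R^-suc l = subst (_≤ R * R ^ℚ l) (*-identityˡ (R ^ℚ l)) (*-monoʳ-≤-nonNeg (R ^ℚ l) {{nonNegative (0≤R^ l)}} 1≤R)

    R^-mono : ∀ t l → R ^ℚ l ≤ R ^ℚ (t ℕ.+ l)
    R^-mono zero l = ≤-refl
    R^-mono (suc t) l = ≤-trans (R^-mono t l) (R^-suc (t ℕ.+ l))

    0≤I^ : ∀ l → 0ℚ ≤ I ^ℚ l
    0≤I^ zero = 0≤ℕ→ℚ 1
    0≤I^ (suc l) = nonNegative⁻¹ (I * I ^ℚ l) {{nonNeg*nonNeg⇒nonNeg I {{nonNegative 0≤I}} (I ^ℚ l) {{nonNegative (0≤I^ l)}}}}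

    I^-suc : ∀ l → I ^ℚ suc l ≤ I ^ℚ l
    I^-suc l = subst (I * I ^ℚ l ≤_) (*-identityˡ (I ^ℚ l)) (*-monoʳ-≤-nonNeg (I ^ℚ l) {{nonNegative (0≤I^ l)}} I≤1)

    I^*R^ : ∀ l → I ^ℚ l * R ^ℚ l ≡ 1ℚ
    I^*R^ zero = refl
    I^*R^ (suc l) = begin
      (I * i) * (R * p)   ≡⟨ *-assoc I i (R * p) ⟩
      I * (i * (R * p))   ≡⟨ cong (I *_) (trans (sym (*-assoc i R p)) (trans (cong (_* p) (*-comm i R)) (*-assoc R i p))) ⟩
      I * (R * (i * p))   ≡⟨ cong (λ x → I * (R * x)) (I^*R^ l) ⟩
      I * (R * 1ℚ)        ≡⟨ cong (I *_) (*-identityʳ R) ⟩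
      I * R               ≡⟨ I*R ⟩
      1ℚ                  ∎
      where
      open ≡-Reasoning
      i = I ^ℚ l
      p = R ^ℚ l

    ceil : ℕ → ℕ
    ceil l = ⌈ R ^ℚ l ⌉ᴺ

    R^≤ceil : ∀ l → R ^ℚ l ≤ ℕ→ℚ (ceil l)
    R^≤ceil l = p≤⌈p⌉ (R ^ℚ l) (0≤R^ l)

    ceil-suc : ∀ l → ceil (suc l) ℕ.≤ 2 ℕ.* ceil l
    ceil-suc l = ⌈p⌉-least (R ^ℚ suc l) (0≤R^ (suc l)) (2 ℕ.* ceil l)
      (≤-trans (*-monoʳ-≤-nonNeg (R ^ℚ l) {{nonNegative (0≤R^ l)}} R≤2)
        (≤-trans (*-monoˡ-≤-nonNeg (ℕ→ℚ 2) (R^≤ceil l)) (≤-reflexive (sym (ℕ→ℚ-* 2 (ceil l))))))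

    -- Rounding up adds at most one, and `R ^ℚ l` is at least one, so it costs at most a factor of
    -- two.
    ceil-I^ : ∀ l → ℕ→ℚ (ceil l) * I ^ℚ l ≤ ℕ→ℚ 2
    ceil-I^ l = ≤-trans (*-monoʳ-≤-nonNeg (I ^ℚ l) {{nonNegative (0≤I^ l)}}
        (≤-trans (⌈p⌉≤p+1 (R ^ℚ l) (0≤R^ l)) (+-monoʳ-≤ (R ^ℚ l) (1≤R^ l))))
      (≤-reflexive (trans (*-distribʳ-+ (I ^ℚ l) (R ^ℚ l) (R ^ℚ l)) (cong₂ _+_ R^*I^ R^*I^)))
      where
      R^*I^ : R ^ℚ l * I ^ℚ l ≡ 1ℚ
      R^*I^ = trans (*-comm (R ^ℚ l) (I ^ℚ l)) (I^*R^ l)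

    -- Bernoulli's inequality for `(1 + 1/q)^t`, multiplied through by `q` and by `R ^ℚ l`. At
    -- `t = q` it shows that `q` levels double the power.
    bernoulli : ∀ t l → ℕ→ℚ (q ℕ.+ t) * R ^ℚ l ≤ ℕ→ℚ q * R ^ℚ (t ℕ.+ l)
    bernoulli zero l = ≤-reflexive (cong (λ n → ℕ→ℚ n * R ^ℚ l) (ℕP.+-identityʳ q))
    bernoulli (suc t) l = ≤-trans (*-monoʳ-≤-nonNeg p {{nonNegative (0≤R^ l)}} step)
        (≤-trans (≤-reflexive (*-assoc R (ℕ→ℚ (q ℕ.+ t)) p)) (≤-trans (*-monoˡ-≤-nonNeg R {{nonNegative 0≤R}} (bernoulli t l))
          (≤-reflexive (trans (sym (*-assoc R (ℕ→ℚ q) P)) (trans (cong (_* P) (*-comm R (ℕ→ℚ q))) (*-assoc (ℕ→ℚ q) R P))))))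
      where
      p = R ^ℚ l
      P = R ^ℚ (t ℕ.+ l)
      step : ℕ→ℚ (q ℕ.+ suc t) ≤ R * ℕ→ℚ (q ℕ.+ t)
      step = subst₂ _≤_ (trans (sym (ℕ→ℚ-+ (suc q) t)) (cong ℕ→ℚ (sym (ℕP.+-suc q t))))
        (trans (sym (*-distribˡ-+ R (ℕ→ℚ q) (ℕ→ℚ t))) (cong (R *_) (sym (ℕ→ℚ-+ q t))))
        (+-mono-≤ (≤-reflexive (sym R*q)) (subst (_≤ R * ℕ→ℚ t) (*-identityˡ (ℕ→ℚ t)) (*-monoʳ-≤-nonNeg (ℕ→ℚ t) {{nonNegative (0≤ℕ→ℚ t)}} 1≤R)))

    R^-doubles : ∀ l → ℕ→ℚ 2 * R ^ℚ l ≤ R ^ℚ (q ℕ.+ l)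
    R^-doubles l = *-cancelˡ-≤-pos (ℕ→ℚ q) {{positive (0<ℕ→ℚ q₁)}} (subst (_≤ ℕ→ℚ q * R ^ℚ (q ℕ.+ l)) eq (bernoulli q l))
      where
      eq : ℕ→ℚ (q ℕ.+ q) * R ^ℚ l ≡ ℕ→ℚ q * (ℕ→ℚ 2 * R ^ℚ l)
      eq = trans (cong (_* R ^ℚ l) (trans (cong ℕ→ℚ (trans (cong (q ℕ.+_) (sym (ℕP.+-identityʳ q))) (ℕP.*-comm 2 q))) (ℕ→ℚ-* q 2)))
                 (*-assoc (ℕ→ℚ q) (ℕ→ℚ 2) (R ^ℚ l))

    2^≤R^ : ∀ s → ℕ→ℚ (2 ℕ.^ s) ≤ R ^ℚ (s ℕ.* q)
    2^≤R^ zero = ≤-refl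
    2^≤R^ (suc s) = ≤-trans (≤-reflexive (ℕ→ℚ-* 2 (2 ℕ.^ s))) (≤-trans (*-monoˡ-≤-nonNeg (ℕ→ℚ 2) (2^≤R^ s)) (R^-doubles (s ℕ.* q)))

    2^≤ceil : ∀ t s → 2 ℕ.^ s ℕ.≤ ceil (t ℕ.+ s ℕ.* q)
    2^≤ceil t s = ℕP.≮⇒≥ λ lt → <-irrefl refl (<-≤-trans (ℕ→ℚ-mono-< (ceil (t ℕ.+ s ℕ.* q)) (2 ℕ.^ s) lt)
      (≤-trans (2^≤R^ s) (≤-trans (R^-mono t (s ℕ.* q)) (R^≤ceil (t ℕ.+ s ℕ.* q)))))

    1≤ceil : ∀ l → 1 ℕ.≤ ceil l
    1≤ceil l = subst (λ n → 1 ℕ.≤ ceil n) (ℕP.+-identityʳ l) (2^≤ceil l 0)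

-- Bounding U and finding a dense level

module UpperBoundSum where
  open import Data.Nat as ℕ using (ℕ; zero; suc; _∸_; z≤n; s≤s)
  import Data.Nat.Properties as ℕP
  open import Data.Nat.DivMod using (_/_; _%_; m≡m%n+[m/n]*n; m%n<n)
  open import Data.Nat.Logarithm using (⌈log₂_⌉; ⌈log₂⌉-mono-≤; ⌈log₂2^n⌉≡n)
  open import Data.Nat.Tactic.RingSolver using (solve-∀)
  open import Data.Integer as ℤ using (+_)
  open import Data.Rational as ℚ using (ℚ; 0ℚ; 1ℚ; _+_; _*_; _≤_; _<_)
  open import Data.Rational.Properties
  open import Data.Rational.Solver using (module +-*-Solver)
  open import Data.Fin using (fromℕ<)
  open import Data.Product using (Σ; ∃; _×_; _,_; proj₁)
  open import Relation.Nullary using (Dec; yes; no; contradiction)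
  open import Relation.Binary.PropositionalEquality
  open import Defs hiding (sym; d)
  open RationalSums
  open Ceilings
  open GeometricGrowth
  open ExtremalFunction using (ex≥; ex-doubling)
  open Instances

  regroup : ∀ a ρ b c i → a * (ρ * (b * c)) * i ≡ ρ * (a * b) * (c * i)
  regroup = solve 5 (λ a ρ b c i → a :* (ρ :* (b :* c)) :* i := ρ :* (a :* b) :* (c :* i)) refl
    where open +-*-Solver

  swap-front : ∀ a ρ b → a * (ρ * b) ≡ ρ * (a * b)
  swap-front = solve 3 (λ a ρ b → a :* (ρ :* b) := ρ :* (a :* b)) refl
    where open +-*-Solver

  Σℚ≤-bound : ∀ j (t : ℕ → ℚ) B → (∀ l → l ℕ.≤ j → t l ≤ B) → Σℚ≤ j t ≤ ℕ→ℚ (suc j) * B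
  Σℚ≤-bound zero t B le = ≤-trans (le 0 z≤n) (≤-reflexive (sym (*-identityˡ B)))
  Σℚ≤-bound (suc j) t B le = ≤-trans (+-mono-≤ (Σℚ≤-bound j t B λ l l≤j → le l (ℕP.m≤n⇒m≤1+n l≤j)) (le (suc j) ℕP.≤-refl))
    (≤-reflexive (trans (cong (λ b → ℕ→ℚ (suc j) * B + b) (sym (*-identityˡ B)))
      (trans (sym (*-distribʳ-+ B (ℕ→ℚ (suc j)) 1ℚ))
        (cong (_* B) (trans (sym (ℕ→ℚ-+ (suc j) 1)) (cong ℕ→ℚ (ℕP.+-comm (suc j) 1)))))))

  term≤Σℕ≤ : ∀ j f → f j ℕ.≤ Σℕ≤ j f
  term≤Σℕ≤ zero f = ℕP.≤-refl
  term≤Σℕ≤ (suc j) f = ℕP.m≤n+m (f (suc j)) (Σℕ≤ j f)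

  module _ (k : ℕ) (3≤k : 3 ℕ.≤ k) (e : ℕ → ℕ) (isEx : IsEx (2 ℕ.* k) e) where

    q₁ q : ℕ
    q₁ = 4 ℕ.* k ∸ 6
    q = suc q₁

    4k∸5≡q : 4 ℕ.* k ∸ 5 ≡ q
    4k∸5≡q = ℕP.+-∸-assoc 1 (ℕP.≤-trans (ℕP.m≤m+n 6 6) (ℕP.*-monoʳ-≤ 4 3≤k))

    r≡R : r k ≡ R q₁
    r≡R = cong (λ y → + suc y ℚ./ suc q₁) 4k∸5≡q

    rinv≡I : rinv k ≡ I q₁
    rinv≡I = cong (λ y → + suc q₁ ℚ./ suc y) 4k∸5≡q

    c : ℕ → ℕ
    c = ceil q₁

    size : ℕ → ℕ
    size l = 4 ℕ.* (k ∸ 1) ℕ.* c l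

    term≡ : ∀ l → term k e l ≡ 4 ℕ.* e (size l)
    term≡ l = cong (λ x → 4 ℕ.* e (4 ℕ.* (k ∸ 1) ℕ.* ⌈ x ^ℚ l ⌉ᴺ)) r≡R

    2≤k∸1 : 2 ℕ.≤ k ∸ 1
    2≤k∸1 = ℕP.∸-monoˡ-≤ 1 3≤k

    c<size : ∀ l → c l ℕ.< size l
    c<size l = begin-strict
      c l                    <⟨ ℕP.m<m+n (c l) (1≤ceil q₁ l) ⟩
      c l ℕ.+ c l            ≡⟨ cong (c l ℕ.+_) (ℕP.+-identityʳ (c l)) ⟨
      2 ℕ.* c l              ≤⟨ ℕP.*-monoˡ-≤ (c l) (ℕP.≤-trans 2≤k∸1 (ℕP.m≤n*m (k ∸ 1) 4)) ⟩
      size l                 ∎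
      where open ℕP.≤-Reasoning

    c≤e : ∀ l → c l ℕ.≤ e (size l)
    c≤e l = <⇒≤e (c<size l)
      where
      <⇒≤e : ∀ {a m} → a ℕ.< m → a ℕ.≤ e m
      <⇒≤e (s≤s {n = m} a≤m) = ℕP.≤-trans a≤m (ex≥ isEx m)

    e-suc : ∀ l → e (size (suc l)) ℕ.≤ 6 ℕ.* e (size l)
    e-suc l = subst (λ m → e (size (suc l)) ℕ.≤ 6 ℕ.* e m) q′+q′
        (ex-doubling isEx (size (suc l)) q′ {{ℕ.>-nonZero 0<q′}} size≤)
      where
      -- Half of `size l`: two blocks make up this level, and four cover the next one because
      -- `r ≤ 2`.
      q′ : ℕ
      q′ = 2 ℕ.* (k ∸ 1) ℕ.* c l
      0<q′ : 0 ℕ.< q′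
      0<q′ = ℕP.*-mono-≤ (ℕP.≤-trans (s≤s z≤n) (ℕP.*-monoʳ-≤ 2 2≤k∸1)) (1≤ceil q₁ l)
      ring₁ : ∀ a b → 2 ℕ.* a ℕ.* b ℕ.+ 2 ℕ.* a ℕ.* b ≡ 4 ℕ.* a ℕ.* b
      ring₁ = solve-∀
      ring₂ : ∀ a b → 4 ℕ.* a ℕ.* (2 ℕ.* b) ≡ 4 ℕ.* (2 ℕ.* a ℕ.* b)
      ring₂ = solve-∀
      q′+q′ : q′ ℕ.+ q′ ≡ size l
      q′+q′ = ring₁ (k ∸ 1) (c l)
      size≤ : size (suc l) ℕ.≤ 4 ℕ.* q′
      size≤ = ℕP.≤-trans (ℕP.*-monoʳ-≤ (4 ℕ.* (k ∸ 1)) (ceil-suc q₁ l)) (ℕP.≤-reflexive (ring₂ (k ∸ 1) (c l)))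

    -- (k (m + 2 k m) + k) ≤ c₁ m bounds the cost of the short tour of an instance
    -- built from a graph with m vertices.
    c₁ B K : ℕ
    c₁ = k ℕ.* (2 ℕ.* k ℕ.+ 2)
    B = 4 ℕ.* (c₁ ℕ.* (4 ℕ.* (k ∸ 1))) ℕ.* 2
    K = (2 ℕ.* q ℕ.+ 6) ℕ.* B

    summand : ℕ → ℚ
    summand l = ℕ→ℚ (term k e l) * (rinv k ^ℚ l)

    summand≡ : ∀ l → summand l ≡ ℕ→ℚ (4 ℕ.* e (size l)) * (I q₁ ^ℚ l)
    summand≡ l = cong₂ (λ a x → ℕ→ℚ a * (x ^ℚ l)) (term≡ l) rinv≡I

    module _ (ρ : ℚ) (0≤ρ : 0ℚ ≤ ρ) where

      Sparse : ℕ → Set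
      Sparse l = ℕ→ℚ (e (size l)) ≤ ρ * ℕ→ℚ (c₁ ℕ.* size l)

      -- `B` collects the factor 4 of `term`, the bound `c₁ * (4 * (k ∸ 1))` per unit of the
      -- ceiling, and the factor 2 lost when that ceiling is divided by the power of r.
      summand-bound : ∀ l → Sparse l → summand l ≤ ρ * ℕ→ℚ B
      summand-bound l sparse = begin
        summand l                                             ≡⟨ summand≡ l ⟩
        ℕ→ℚ (4 ℕ.* e (size l)) * i                           ≡⟨ cong (_* i) (ℕ→ℚ-* 4 (e (size l))) ⟩
        ℕ→ℚ 4 * ℕ→ℚ (e (size l)) * i
          ≤⟨ *-monoʳ-≤-nonNeg i {{ℚ.nonNegative (0≤I^ q₁ l)}} (*-monoˡ-≤-nonNeg (ℕ→ℚ 4) sparse) ⟩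
        ℕ→ℚ 4 * (ρ * ℕ→ℚ (c₁ ℕ.* size l)) * i
          ≡⟨ cong (λ x → ℕ→ℚ 4 * (ρ * x) * i) (trans (cong ℕ→ℚ (sym (ℕP.*-assoc c₁ (4 ℕ.* (k ∸ 1)) (c l)))) (ℕ→ℚ-* d (c l))) ⟩
        ℕ→ℚ 4 * (ρ * (ℕ→ℚ d * ℕ→ℚ (c l))) * i
          ≡⟨ regroup (ℕ→ℚ 4) ρ (ℕ→ℚ d) (ℕ→ℚ (c l)) i ⟩
        ρ * (ℕ→ℚ 4 * ℕ→ℚ d) * (ℕ→ℚ (c l) * i)
          ≡⟨ cong (λ x → ρ * x * (ℕ→ℚ (c l) * i)) (sym (ℕ→ℚ-* 4 d)) ⟩
        ρ * ℕ→ℚ (4 ℕ.* d) * (ℕ→ℚ (c l) * i)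
          ≤⟨ *-monoˡ-≤-nonNeg (ρ * ℕ→ℚ (4 ℕ.* d)) {{nonNeg}} (ceil-I^ q₁ l) ⟩
        ρ * ℕ→ℚ (4 ℕ.* d) * ℕ→ℚ 2                           ≡⟨ *-assoc ρ (ℕ→ℚ (4 ℕ.* d)) (ℕ→ℚ 2) ⟩
        ρ * (ℕ→ℚ (4 ℕ.* d) * ℕ→ℚ 2)                         ≡⟨ cong (ρ *_) (sym (ℕ→ℚ-* (4 ℕ.* d) 2)) ⟩
        ρ * ℕ→ℚ B                                             ∎
        where
        open ≤-Reasoning
        d : ℕ
        d = c₁ ℕ.* (4 ℕ.* (k ∸ 1))
        i : ℚ
        i = I q₁ ^ℚ l
        nonNeg : ℚ.NonNegative (ρ * ℕ→ℚ (4 ℕ.* d))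
        nonNeg = nonNeg*nonNeg⇒nonNeg ρ {{ℚ.nonNegative 0≤ρ}} (ℕ→ℚ (4 ℕ.* d)) {{ℚ.nonNegative (0≤ℕ→ℚ (4 ℕ.* d))}}

      -- Meant for the level l*, whose extremal graph may be too large for n cities: it is charged
      -- to the level before. The gain from the extra power of `rinv` is dropped.
      summand-suc : ∀ l → summand (suc l) ≤ ℕ→ℚ 6 * summand l
      summand-suc l = begin
        summand (suc l)                                ≡⟨ summand≡ (suc l) ⟩
        ℕ→ℚ (4 ℕ.* e′) * (I q₁ ^ℚ suc l)              ≤⟨ *-monoˡ-≤-nonNeg (ℕ→ℚ (4 ℕ.* e′)) {{ℚ.nonNegative (0≤ℕ→ℚ (4 ℕ.* e′))}} (I^-suc q₁ l) ⟩
        ℕ→ℚ (4 ℕ.* e′) * (I q₁ ^ℚ l)                  ≤⟨ *-monoʳ-≤-nonNeg (I q₁ ^ℚ l) {{ℚ.nonNegative (0≤I^ q₁ l)}} (ℕ→ℚ-mono-≤ (4 ℕ.* e′) (6 ℕ.* (4 ℕ.* e″)) 4e′≤) ⟩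
        ℕ→ℚ (6 ℕ.* (4 ℕ.* e″)) * (I q₁ ^ℚ l)          ≡⟨ cong (_* (I q₁ ^ℚ l)) (ℕ→ℚ-* 6 (4 ℕ.* e″)) ⟩
        ℕ→ℚ 6 * ℕ→ℚ (4 ℕ.* e″) * (I q₁ ^ℚ l)          ≡⟨ *-assoc (ℕ→ℚ 6) (ℕ→ℚ (4 ℕ.* e″)) (I q₁ ^ℚ l) ⟩
        ℕ→ℚ 6 * (ℕ→ℚ (4 ℕ.* e″) * (I q₁ ^ℚ l))        ≡⟨ cong (ℕ→ℚ 6 *_) (sym (summand≡ l)) ⟩
        ℕ→ℚ 6 * summand l                              ∎
        where
        open ≤-Reasoning
        e′ e″ : ℕ
        e′ = e (size (suc l))
        e″ = e (size l)
        ring : ∀ a → 4 ℕ.* (6 ℕ.* a) ≡ 6 ℕ.* (4 ℕ.* a)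
        ring = solve-∀
        4e′≤ : 4 ℕ.* e′ ℕ.≤ 6 ℕ.* (4 ℕ.* e″)
        4e′≤ = ℕP.≤-trans (ℕP.*-monoʳ-≤ 4 (e-suc l)) (ℕP.≤-reflexive (ring e″))

      U-bound : ∀ j → (∀ l → l ℕ.≤ j → Sparse l) → U k e (suc j) ≤ ρ * ℕ→ℚ ((suc j ℕ.+ 6) ℕ.* B)
      U-bound j sparse = begin
        Σℚ≤ j summand + summand (suc j)                       ≤⟨ +-mono-≤ (Σℚ≤-bound j summand b λ l l≤j → summand-bound l (sparse l l≤j)) (summand-suc j) ⟩
        ℕ→ℚ (suc j) * b + ℕ→ℚ 6 * summand j                  ≤⟨ +-monoʳ-≤ (ℕ→ℚ (suc j) * b) (*-monoˡ-≤-nonNeg (ℕ→ℚ 6) (summand-bound j (sparse j ℕP.≤-refl))) ⟩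
        ℕ→ℚ (suc j) * b + ℕ→ℚ 6 * b                          ≡⟨ *-distribʳ-+ b (ℕ→ℚ (suc j)) (ℕ→ℚ 6) ⟨
        (ℕ→ℚ (suc j) + ℕ→ℚ 6) * b                            ≡⟨ cong (_* b) (ℕ→ℚ-+ (suc j) 6) ⟨
        ℕ→ℚ (suc j ℕ.+ 6) * (ρ * ℕ→ℚ B)                      ≡⟨ swap-front (ℕ→ℚ (suc j ℕ.+ 6)) ρ (ℕ→ℚ B) ⟩
        ρ * (ℕ→ℚ (suc j ℕ.+ 6) * ℕ→ℚ B)                      ≡⟨ cong (ρ *_) (sym (ℕ→ℚ-* (suc j ℕ.+ 6) B)) ⟩
        ρ * ℕ→ℚ ((suc j ℕ.+ 6) ℕ.* B)                         ∎
        where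
        open ≤-Reasoning
        b : ℚ
        b = ρ * ℕ→ℚ B

    module _ {n j : ℕ} (below : 4 ℕ.* e (size j) ℕ.< n) where

      -- Every `q` levels the power of r doubles, and the star bound gives
      -- `2 ^ (j / q) ≤ ceil ≤ e (size j) < n`.
      j<q[1+log] : suc j ℕ.≤ suc ⌈log₂ n ⌉ ℕ.* q
      j<q[1+log] = begin
        suc j                      ≡⟨ cong suc (m≡m%n+[m/n]*n j q) ⟩
        suc (j % q ℕ.+ s ℕ.* q)    ≤⟨ ℕP.+-monoˡ-≤ (s ℕ.* q) (m%n<n j q) ⟩
        suc s ℕ.* q                ≤⟨ ℕP.*-monoˡ-≤ q (s≤s s≤log) ⟩
        suc ⌈log₂ n ⌉ ℕ.* q        ∎
        where
        open ℕP.≤-Reasoning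
        s : ℕ
        s = j / q
        2^s≤n : 2 ℕ.^ s ℕ.≤ n
        2^s≤n = ℕP.≤-trans (2^≤ceil q₁ (j % q) s) (ℕP.≤-trans (ℕP.≤-reflexive (cong c (sym (m≡m%n+[m/n]*n j q))))
          (ℕP.≤-trans (c≤e j) (ℕP.≤-trans (ℕP.m≤n*m (e (size j)) 4) (ℕP.<⇒≤ below))))
        s≤log : s ℕ.≤ ⌈log₂ n ⌉
        s≤log = subst (ℕ._≤ ⌈log₂ n ⌉) (⌈log₂2^n⌉≡n s) (⌈log₂⌉-mono-≤ 2^s≤n)

      -- Origin of `K`: `1 ≤ ⌈log₂ n ⌉` absorbs the additive terms into `2 * q + 6`. The successor
      -- of `K` makes the final constant evidently positive.
      levels : 2 ℕ.≤ n → (suc j ℕ.+ 6) ℕ.* B ℕ.≤ suc K ℕ.* ⌈log₂ n ⌉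
      levels 2≤n = begin
        (suc j ℕ.+ 6) ℕ.* B                              ≤⟨ ℕP.*-monoˡ-≤ B (ℕP.+-mono-≤ j<q[1+log] (ℕP.*-monoʳ-≤ 6 1≤log)) ⟩
        (suc ℓ ℕ.* q ℕ.+ 6 ℕ.* ℓ) ℕ.* B                  ≤⟨ ℕP.*-monoˡ-≤ B (ℕP.+-monoˡ-≤ (6 ℕ.* ℓ) (ℕP.*-monoˡ-≤ q (ℕP.+-monoˡ-≤ ℓ 1≤log))) ⟩
        ((ℓ ℕ.+ ℓ) ℕ.* q ℕ.+ 6 ℕ.* ℓ) ℕ.* B              ≡⟨ ring ℓ q B ⟩
        K ℕ.* ℓ                                          ≤⟨ ℕP.m≤n+m (K ℕ.* ℓ) ℓ ⟩
        suc K ℕ.* ℓ                                      ∎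
        where
        open ℕP.≤-Reasoning
        ℓ : ℕ
        ℓ = ⌈log₂ n ⌉
        1≤log : 1 ℕ.≤ ℓ
        1≤log = ⌈log₂⌉-mono-≤ 2≤n
        ring : ∀ a b c → ((a ℕ.+ a) ℕ.* b ℕ.+ 6 ℕ.* a) ℕ.* c ≡ (2 ℕ.* b ℕ.+ 6) ℕ.* c ℕ.* a
        ring = solve-∀

    -- Density is used twice. With `1 ≤ ρ` it gives `m * suc (2 * k) ≤ e m`, so the walk fits into n
    -- cities; and it makes the walk at least `ρ` times as expensive as the sorted tour.
    dense-ratio : ∀ {n} l ρ → 1ℚ ≤ ρ → 4 ℕ.* e (size l) ℕ.< n → ρ * ℕ→ℚ (c₁ ℕ.* size l) < ℕ→ℚ (e (size l)) →
                  2 ℕ.≤ n → RatioAtLeast k n ρ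
    dense-ratio {n} l ρ 1≤ρ 4e<n dense 2≤n = construct (proj₁ (isEx m))
      where
      m : ℕ
      m = size l
      0<m : 0 ℕ.< m
      0<m = ℕP.≤-<-trans z≤n (c<size l)
      2≤k : 2 ℕ.≤ k
      2≤k = ℕP.<⇒≤ 3≤k
      1≤k : 1 ℕ.≤ k
      1≤k = ℕP.<⇒≤ 2≤k
      0≤ρ : 0ℚ ≤ ρ
      0≤ρ = ≤-trans (0≤ℕ→ℚ 1) 1≤ρ
      c₁m<e : c₁ ℕ.* m ℕ.< e m
      c₁m<e = ℕ→ℚ-cancel-< (c₁ ℕ.* m) (e m) (≤-<-trans
        (subst (_≤ ρ * ℕ→ℚ (c₁ ℕ.* m)) (*-identityˡ (ℕ→ℚ (c₁ ℕ.* m)))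
          (*-monoʳ-≤-nonNeg (ℕ→ℚ (c₁ ℕ.* m)) {{ℚ.nonNegative (0≤ℕ→ℚ (c₁ ℕ.* m))}} 1≤ρ)) dense)
      2k<c₁ : suc (2 ℕ.* k) ℕ.≤ c₁
      2k<c₁ = ℕP.≤-trans (ℕP.≤-trans (ℕP.≤-reflexive (ℕP.+-comm 1 (2 ℕ.* k))) (ℕP.+-monoʳ-≤ (2 ℕ.* k) (s≤s z≤n)))
                (ℕP.m≤n*m (2 ℕ.* k ℕ.+ 2) k {{ℕ.>-nonZero 1≤k}})
      large : e m ℕ.+ m ℕ.* suc (2 ℕ.* k) ℕ.≤ n
      large = begin
        e m ℕ.+ m ℕ.* suc (2 ℕ.* k)    ≡⟨ cong (e m ℕ.+_) (ℕP.*-comm m (suc (2 ℕ.* k))) ⟩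
        e m ℕ.+ suc (2 ℕ.* k) ℕ.* m    ≤⟨ ℕP.+-monoʳ-≤ (e m) (ℕP.≤-trans (ℕP.*-monoˡ-≤ m 2k<c₁) (ℕP.<⇒≤ c₁m<e)) ⟩
        e m ℕ.+ e m                    ≤⟨ ℕP.+-monoʳ-≤ (e m) (ℕP.m≤m+n (e m) _) ⟩
        4 ℕ.* e m                      ≤⟨ ℕP.<⇒≤ 4e<n ⟩
        n                              ∎
        where open ℕP.≤-Reasoning
      ring : ∀ k m → k ℕ.* (m ℕ.+ m ℕ.* (2 ℕ.* k)) ℕ.+ k ℕ.* m ≡ k ℕ.* (2 ℕ.* k ℕ.+ 2) ℕ.* m
      ring = solve-∀
      tour≤ : k ℕ.* (m ℕ.+ m ℕ.* (2 ℕ.* k)) ℕ.+ k ℕ.≤ c₁ ℕ.* m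
      tour≤ = ℕP.≤-trans (ℕP.+-monoʳ-≤ (k ℕ.* (m ℕ.+ m ℕ.* (2 ℕ.* k))) (ℕP.m≤m*n k m {{ℕ.>-nonZero 0<m}}))
                (ℕP.≤-reflexive (ring k m))
      bound : ρ * ℕ→ℚ (k ℕ.* (m ℕ.+ m ℕ.* (2 ℕ.* k)) ℕ.+ k) ≤ ℕ→ℚ (e m)
      bound = ≤-trans (*-monoˡ-≤-nonNeg ρ {{ℚ.nonNegative 0≤ρ}}
        (ℕ→ℚ-mono-≤ (k ℕ.* (m ℕ.+ m ℕ.* (2 ℕ.* k)) ℕ.+ k) (c₁ ℕ.* m) tour≤)) (<⇒≤ dense)
      construct : (∃ λ G → GirthAtLeast {m} G (2 ℕ.* k) × numEdges G ≡ e m) → RatioAtLeast k n ρ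
      construct (G , girth , E≡) = ratio G k n 2≤k girth (fromℕ< 0<m) 2≤n
        (subst (λ E → E ℕ.+ m ℕ.* suc (2 ℕ.* k) ℕ.≤ n) (sym E≡) large)
        (subst (1 ℕ.≤_) (sym E≡) (ℕP.≤-trans (1≤ceil q₁ l) (c≤e l))) ρ 0≤ρ
        (subst (λ E → ρ * ℕ→ℚ (k ℕ.* (m ℕ.+ m ℕ.* (2 ℕ.* k)) ℕ.+ k) ≤ ℕ→ℚ E) (sym E≡) bound)

    module _ {n j : ℕ} (n₀≤n : 2 ℕ.+ term k e 0 ℕ.≤ n) (minimal : ∀ i → i ℕ.< suc j → Σℕ≤ i (term k e) ℕ.< n) (ρ : ℚ) where

      2≤n : 2 ℕ.≤ n
      2≤n = ℕP.≤-trans (ℕP.m≤m+n 2 (term k e 0)) n₀≤n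

      -- Minimality of l* bounds the partial sum up to level `l`, of which this term is a part.
      few-edges : ∀ l → l ℕ.< suc j → 4 ℕ.* e (size l) ℕ.< n
      few-edges l l<j = ℕP.≤-<-trans (subst (ℕ._≤ Σℕ≤ l (term k e)) (term≡ l) (term≤Σℕ≤ l (term k e))) (minimal l l<j)

      U≤ : (0≤ρ : 0ℚ ≤ ρ) → (∀ l → l ℕ.≤ j → Sparse ρ 0≤ρ l) → U k e (suc j) ≤ ρ * ℕ→ℚ (suc K) * ℕ→ℚ ⌈log₂ n ⌉
      U≤ 0≤ρ sparse = ≤-trans (U-bound ρ 0≤ρ j sparse)
        (≤-trans (*-monoˡ-≤-nonNeg ρ {{ℚ.nonNegative 0≤ρ}}
            (ℕ→ℚ-mono-≤ ((suc j ℕ.+ 6) ℕ.* B) (suc K ℕ.* ⌈log₂ n ⌉) (levels {n} {j} (few-edges j ℕP.≤-refl) 2≤n)))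
          (≤-reflexive (trans (cong (ρ *_) (ℕ→ℚ-* (suc K) ⌈log₂ n ⌉)) (sym (*-assoc ρ (ℕ→ℚ (suc K)) (ℕ→ℚ ⌈log₂ n ⌉))))))

      Dense : ℕ → Set
      Dense l = ρ * ℕ→ℚ (c₁ ℕ.* size l) < ℕ→ℚ (e (size l))

      some-dense : 1ℚ < ρ → Dec (∃ λ l → l ℕ.< suc j × Dense l) → ρ * ℕ→ℚ (suc K) * ℕ→ℚ ⌈log₂ n ⌉ < U k e (suc j) → RatioAtLeast k n ρ
      some-dense 1<ρ (yes (l , l<j , dense)) _ = dense-ratio {n} l ρ (<⇒≤ 1<ρ) (few-edges l l<j) dense 2≤n
      some-dense 1<ρ (no none) gap = contradiction
        (<-≤-trans gap (U≤ (≤-trans (0≤ℕ→ℚ 1) (<⇒≤ 1<ρ)) λ l l≤j → ≮⇒≥ λ dense → none (l , s≤s l≤j , dense)))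
        (<-irrefl refl)

      tight-suc : ρ * ℕ→ℚ (suc K) * ℕ→ℚ ⌈log₂ n ⌉ < U k e (suc j) → RatioAtLeast k n ρ
      tight-suc gap = by-size (ρ ≤? 1ℚ)
        where
        by-size : Dec (ρ ≤ 1ℚ) → RatioAtLeast k n ρ
        by-size (yes ρ≤1) = ratio-≤1 k n 2≤n ρ ρ≤1
        -- Comparison of rationals is decidable, so a bounded search finds the dense level
        -- constructively.
        by-size (no ρ≰1) = some-dense (≰⇒> ρ≰1) (ℕP.anyUpTo? (λ l → ρ * ℕ→ℚ (c₁ ℕ.* size l) <? ℕ→ℚ (e (size l))) (suc j)) gap

    tight : (n : ℕ) → 2 ℕ.+ term k e 0 ℕ.≤ n → (j : ℕ) → IsLStar k e n j →
            (ρ : ℚ) → ρ * ℕ→ℚ (suc K) * ℕ→ℚ ⌈log₂ n ⌉ < U k e j → RatioAtLeast k n ρ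
    -- The threshold exceeds the term of level 0, so l* is positive and a level before it exists.
    tight n n₀≤n zero (n≤ , _) ρ _ = contradiction (ℕP.≤-trans (ℕP.m≤n+m (suc (term k e 0)) 1) (ℕP.≤-trans n₀≤n n≤)) ℕP.1+n≰n
    tight n n₀≤n (suc j) (_ , minimal) ρ gap = tight-suc {n} {j} n₀≤n minimal ρ gap

open import Defs
open import Data.Nat using (ℕ; suc; _≤_)
open import Data.Nat.Logarithm using (⌈log₂_⌉)
open import Data.Rational using (ℚ; 0ℚ; _*_; _<_)
open import Data.Product using (Σ; _×_; _,_)
open GeometricGrowth using (0<ℕ→ℚ)
open UpperBoundSum using (K; tight)

theorem55 : (k : ℕ) → 3 ≤ k → (e : ℕ → ℕ) → IsEx (2 Data.Nat.* k) e →
    Σ ℚ λ C → (0ℚ < C) × Σ ℕ λ n₀ → (n : ℕ) → n₀ ≤ n →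
    (j : ℕ) → IsLStar k e n j →
    (ρ : ℚ) → ρ * C * ℕ→ℚ ⌈log₂ n ⌉ < U k e j → RatioAtLeast k n ρ
theorem55 k 3≤k e isEx = ℕ→ℚ (suc (K k 3≤k e isEx)) , 0<ℕ→ℚ (K k 3≤k e isEx) , 2 Data.Nat.+ term k e 0 , tight k 3≤k e isEx
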